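{- Let $r \in \mathbb{N}$. The set $\{H, rK_1 + \vec{P_3}\}$ is $\vec{\chi}$-finite if one of the following holds: (i) $H = K_1$; (ii) $H = H_1 \Rightarrow H_2$ where $\{H_i, rK_1 + \vec{P_3}\}$ is $\vec{\chi}$-finite for $i \in \{1,2\}$; or (iii) $H = \Delta(K_1, K_1, H_1)$ where $\{H_1, rK_1 + \vec{P_3}\}$ is $\vec{\chi}$-finite.
   Context: All digraphs are finite, loopless, and between any two distinct vertices at most one of the two possible arcs is present. A digraph $D$ is $H$-free if no induced subdigraph of $D$ is isomorphic to $H$, and $\mathcal{F}$-free if it is $H$-free for every $H\in\mathcal{F}$. The dichromatic number $\vec{\chi}(D)$ is the least $k$ such that $V(D)$ can be partitioned into $k$ sets each inducing an acyclic subdigraph. A finite family $\mathcal{F}$ is $\vec{\chi}$-finite if there is a constant $c$ such that every $\mathcal{F}$-free digraph has dichromatic number at most $c$. $K_1$ is the one-vertex digraph; $D_1 + D_2$ is the disjoint union; $rD$ is the disjoint union of $r$ copies of $D$; $\vec{P_3}$ is the directed path $a \to b \to c$ on three vertices. $D_1 \Rightarrow D_2$ is obtained from $D_1 + D_2$ by adding all arcs from $V(D_1)$ to $V(D_2)$. $\Delta(D_1,D_2,D_3)$ is obtained from $D_1+D_2+D_3$ by adding all arcs $d_id_j$ with $d_i\in V(D_i)$, $d_j\in V(D_j)$ and $(i,j)\in\{(1,2),(2,3),(3,1)\}$. -}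

module Defs where

open import Data.Nat using (ℕ; zero; suc; _+_; _≤_)
open import Data.Fin using (Fin; zero; suc; splitAt; inject₁; fromℕ)
open import Data.Sum using (_⊎_; inj₁; inj₂)
open import Data.Bool using (Bool; true; false)
open import Data.Product using (Σ; ∃; _×_; _,_)
open import Relation.Binary.PropositionalEquality using (_≡_; refl)
open import Relation.Nullary using (¬_)
open import Function.Definitions using (Injective)

record Digraph : Set where
  field
    size     : ℕ
    arc      : Fin size → Fin size → Bool
    loopless : ∀ i → arc i i ≡ false
    oriented : ∀ i j → arc i j ≡ true → arc j i ≡ false
open Digraph public

private
  arcS : (D₁ D₂ : Digraph)
         (f : Fin (size D₁) → Fin (size D₂) → Bool)
         (g : Fin (size D₂) → Fin (size D₁) → Bool) →
         Fin (size D₁) ⊎ Fin (size D₂) → Fin (size D₁) ⊎ Fin (size D₂) → Bool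
  arcS D₁ D₂ f g (inj₁ i) (inj₁ j) = arc D₁ i j
  arcS D₁ D₂ f g (inj₁ i) (inj₂ j) = f i j
  arcS D₁ D₂ f g (inj₂ i) (inj₁ j) = g i j
  arcS D₁ D₂ f g (inj₂ i) (inj₂ j) = arc D₂ i j

  arcS-loop : ∀ D₁ D₂ f g s → arcS D₁ D₂ f g s s ≡ false
  arcS-loop D₁ D₂ f g (inj₁ i) = loopless D₁ i
  arcS-loop D₁ D₂ f g (inj₂ i) = loopless D₂ i

  arcS-or : ∀ D₁ D₂ f g → (∀ i j → f i j ≡ true → g j i ≡ false) →
            (∀ i j → g i j ≡ true → f j i ≡ false) →
            ∀ s t → arcS D₁ D₂ f g s t ≡ true → arcS D₁ D₂ f g t s ≡ false
  arcS-or D₁ D₂ f g ok ok' (inj₁ i) (inj₁ j) p = oriented D₁ i j p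
  arcS-or D₁ D₂ f g ok ok' (inj₁ i) (inj₂ j) p = ok i j p
  arcS-or D₁ D₂ f g ok ok' (inj₂ i) (inj₁ j) p = ok' i j p
  arcS-or D₁ D₂ f g ok ok' (inj₂ i) (inj₂ j) p = oriented D₂ i j p

-- Vertices of D₁ are 0..size D₁ - 1, those of D₂ follow.
glue : (D₁ D₂ : Digraph)
       (f : Fin (size D₁) → Fin (size D₂) → Bool)
       (g : Fin (size D₂) → Fin (size D₁) → Bool) →
       (∀ i j → f i j ≡ true → g j i ≡ false) →
       (∀ i j → g i j ≡ true → f j i ≡ false) → Digraph
glue D₁ D₂ f g ok ok' = record
  { size     = size D₁ + size D₂
  ; arc      = λ x y → arcS D₁ D₂ f g (splitAt (size D₁) x) (splitAt (size D₁) y)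
  ; loopless = λ x → arcS-loop D₁ D₂ f g (splitAt (size D₁) x)
  ; oriented = λ x y → arcS-or D₁ D₂ f g ok ok' (splitAt (size D₁) x) (splitAt (size D₁) y)
  }

private
  noArcs : ∀ {A B : Set} (i : A) (j : B) → false ≡ true → false ≡ false
  noArcs _ _ _ = refl

  allArcs-ok : ∀ {A B : Set} (i : A) (j : B) → true ≡ true → false ≡ false
  allArcs-ok _ _ _ = refl

  noArcs-ok : ∀ {A B : Set} (i : A) (j : B) → false ≡ true → true ≡ false
  noArcs-ok _ _ ()

_⊕_ : Digraph → Digraph → Digraph
D₁ ⊕ D₂ = glue D₁ D₂ (λ _ _ → false) (λ _ _ → false) noArcs noArcs

_⇒_ : Digraph → Digraph → Digraph
D₁ ⇒ D₂ = glue D₁ D₂ (λ _ _ → true) (λ _ _ → false) allArcs-ok noArcs-ok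

private
  toThird : (n₁ n₂ n₃ : ℕ) → Fin (n₁ + n₂) → Fin n₃ → Bool
  toThird n₁ n₂ n₃ x _ with splitAt n₁ x
  ... | inj₁ _ = false
  ... | inj₂ _ = true
  fromThird : (n₁ n₂ n₃ : ℕ) → Fin n₃ → Fin (n₁ + n₂) → Bool
  fromThird n₁ n₂ n₃ _ x with splitAt n₁ x
  ... | inj₁ _ = true
  ... | inj₂ _ = false

  third-ok : ∀ n₁ n₂ n₃ x j → toThird n₁ n₂ n₃ x j ≡ true → fromThird n₁ n₂ n₃ j x ≡ false
  third-ok n₁ n₂ n₃ x j p with splitAt n₁ x
  third-ok n₁ n₂ n₃ x j () | inj₁ _
  ... | inj₂ _ = refl

  third-ok' : ∀ n₁ n₂ n₃ j x → fromThird n₁ n₂ n₃ j x ≡ true → toThird n₁ n₂ n₃ x j ≡ false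
  third-ok' n₁ n₂ n₃ j x p with splitAt n₁ x
  ... | inj₁ _ = refl
  third-ok' n₁ n₂ n₃ j x () | inj₂ _

Δ : Digraph → Digraph → Digraph → Digraph
Δ D₁ D₂ D₃ = glue (D₁ ⇒ D₂) D₃
  (toThird (size D₁) (size D₂) (size D₃))
  (fromThird (size D₁) (size D₂) (size D₃))
  (third-ok (size D₁) (size D₂) (size D₃))
  (third-ok' (size D₁) (size D₂) (size D₃))

edgeless : ℕ → Digraph
edgeless r = record
  { size = r ; arc = λ _ _ → false
  ; loopless = λ _ → refl ; oriented = λ _ _ () }

K₁ : Digraph
K₁ = edgeless 1

_·K₁ : ℕ → Digraph
zero  ·K₁ = edgeless 0
suc r ·K₁ = K₁ ⊕ (r ·K₁)

private
  p3arc : Fin 3 → Fin 3 → Bool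
  p3arc zero (suc zero) = true
  p3arc (suc zero) (suc (suc zero)) = true
  p3arc _ _ = false

  p3loop : ∀ i → p3arc i i ≡ false
  p3loop zero = refl
  p3loop (suc zero) = refl
  p3loop (suc (suc zero)) = refl

  p3or : ∀ i j → p3arc i j ≡ true → p3arc j i ≡ false
  p3or zero (suc zero) _ = refl
  p3or (suc zero) (suc (suc zero)) _ = refl
  p3or zero zero ()
  p3or zero (suc (suc zero)) ()
  p3or (suc zero) zero ()
  p3or (suc zero) (suc zero) ()
  p3or (suc (suc zero)) zero ()
  p3or (suc (suc zero)) (suc zero) ()
  p3or (suc (suc zero)) (suc (suc zero)) ()

P₃ : Digraph
P₃ = record { size = 3 ; arc = p3arc ; loopless = p3loop ; oriented = p3or }

InducedIn : Digraph → Digraph → Set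
InducedIn H D = Σ (Fin (size H) → Fin (size D)) λ φ →
  Injective _≡_ _≡_ φ × (∀ i j → arc D (φ i) (φ j) ≡ arc H i j)

Free : Digraph → Digraph → Set
Free H D = ¬ InducedIn H D

-- A directed cycle of length suc m (m ≥ 1, i.e. length ≥ 2) in D whose
-- vertices all satisfy P: distinct vertices v₀,…,v_m with arcs
-- v_i → v_{i+1} and v_m → v_0.
record CycleIn (D : Digraph) (P : Fin (size D) → Set) : Set where
  field
    m        : ℕ
    long     : 1 ≤ m
    v        : Fin (suc m) → Fin (size D)
    distinct : Injective _≡_ _≡_ v
    step     : ∀ (i : Fin m) → arc D (v (inject₁ i)) (v (suc i)) ≡ true
    close    : arc D (v (fromℕ m)) (v zero) ≡ true
    inside   : ∀ i → P (v i)

Acyclic : (D : Digraph) → (Fin (size D) → Set) → Set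
Acyclic D P = ¬ CycleIn D P

DichromaticAtMost : Digraph → ℕ → Set
DichromaticAtMost D k = Σ (Fin (size D) → Fin k) λ c →
  ∀ (a : Fin k) → Acyclic D (λ x → c x ≡ a)

ChiFinite : Digraph → ℕ → Set
ChiFinite H r = ∃ λ (c : ℕ) → ∀ (D : Digraph) →
  Free H D → Free ((r ·K₁) ⊕ P₃) D → DichromaticAtMost D c

{-# OPTIONS --safe #-}

-- Induction on r: the non-neighbourhood of a vertex is (r - 1)K₁ + P₃-free, so it has bounded
-- dichromatic number. For r = 0 the digraph is quasi-transitive, and recolouring along maximal
-- pairs of non-adjacent strongly connected sets shows that cliques decide the dichromatic number.
--
-- For H₁ ⇒ H₂, call an arc u → v heavy if the set of w with v → w → u has large dichromatic
-- number. A set with no large heavy clique is bounded: a vertex with large in- and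
-- out-neighbourhoods would yield copies of H₁ and H₂ joined completely. So every large set
-- contains a subset J of bounded size that is still hard to colour, and each vertex either
-- is dominated by a copy of H₁ in J or dominates a copy of H₂ in J.
--
-- For Δ(K₁, K₁, H), the set of w with v → w → u is bounded for every arc u → v. If all
-- out-neighbourhoods are bounded, then so is the digraph: a minimal dominating set S is short,
-- since otherwise a large part W of S has an out-neighbourhood that is hard to dominate, and
-- then rK₁ + P₃-freeness produces many pairwise crossing sets that are hard to dominate, in
-- which a bounded subset that is hard to colour can be built up colour by colour. Applied to
-- the digraph and its reverse, this splits large sets into bags with no backward arcs. In a
-- longest chain of bags every vertex has a position, the vertices of a fixed position are
-- bounded, and arcs go back by at most one position.

module Submission where

open import Defs
open import Data.Nat using (ℕ; zero; suc; _+_; _*_; _∸_; _≤_; _<_; z≤n; s≤s; _⊔_)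
open import Data.Nat.Properties using
  (≤-refl; ≤-pred; ≤-trans; ≤-reflexive; <-trans; <-≤-trans; <-irrefl; <⇒≤; <⇒≱; ≰⇒>; ≮⇒≥; n≤1+n;
   m≤m+n; m≤n+m; +-mono-≤; +-monoˡ-≤; +-monoʳ-≤; *-monoˡ-≤; +-monoʳ-<; +-cancelˡ-≡; +-cancelˡ-≤;
   m≤m⊔n; m≤n⊔m; +-suc; +-comm; +-assoc; +-identityʳ; m≤n⇒m⊓n≡m; _≤?_; _<?_; *-identityʳ;
   ∸-monoʳ-<; ≤∧≢⇒<; n<1+n; module ≤-Reasoning; +-mono-<-≤; +-mono-≤-<; ≤-total; m∸n+n≡m; <⇒≢)
  renaming (_≟_ to _≟ℕ_)
open import Data.Fin using (Fin; zero; suc; toℕ; fromℕ; inject₁; _↑ˡ_; _↑ʳ_; splitAt; fromℕ<; join)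
open import Data.Fin.Properties using
  (any?; all?; pigeonhole; splitAt-↑ˡ; splitAt-↑ʳ; ↑ˡ-injective; ↑ʳ-injective; toℕ<n; toℕ-fromℕ;
   toℕ-inject₁; toℕ-fromℕ<; toℕ-injective; join-splitAt)
  renaming (_≟_ to _≟F_)
open import Data.Bool using (Bool; true; false)
open import Data.Bool.Properties using ()
  renaming (_≟_ to _≟B_)
open import Data.Empty using (⊥; ⊥-elim)
open import Data.Unit using (⊤; tt)
open import Data.Product using (Σ; ∃; ∃₂; _×_; _,_; proj₁; proj₂)
open import Data.Sum using (_⊎_; inj₁; inj₂)
open import Data.Vec using (Vec; []; _∷_)
  renaming (lookup to lookupᵛ; tabulate to tabulateᵛ)
open import Data.Vec.Properties using (lookup∘tabulate)
open import Data.List using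
  (List; []; _∷_; _++_; length; filter; take; drop; tabulate; lookup; allFin; concatMap; upTo)
open import Data.List.Properties using
  (length-++; length-tabulate; length-take; take++drop≡id; length-upTo; ≡-dec; filter-all)
open import Data.List.Relation.Unary.All using (All; []; _∷_)
  renaming (lookup to lookupᴬ; map to mapᴬ; tabulate to tabulateᴬ; all? to allᴬ?)
open import Data.List.Relation.Unary.Any using (Any; here; there; index)
  renaming (any? to anyᴬ?; map to mapᴱ)
open import Data.List.Relation.Unary.AllPairs using (AllPairs; []; _∷_)
  renaming (map to mapᴾ)
open import Data.List.Membership.Propositional using (find; lose)
  renaming (_∈_ to _∈ₗ_; _∉_ to _∉ₗ_)
open import Data.List.Membership.Propositional.Properties using
  (∈-++⁺ˡ; ∈-++⁺ʳ; ∈-filter⁺; ∈-filter⁻; ∈-tabulate⁺; ∈-allFin; ∈-lookup; ∈-upTo⁺; ∈-upTo⁻)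
open import Data.List.Relation.Unary.Unique.Propositional using (Unique)
open import Relation.Nullary using (¬_; Dec; yes; no; contradiction; ¬?; map′; _×-dec_; _⊎-dec_; _→-dec_)
open import Relation.Nullary.Decidable using (decidable-stable)
open import Relation.Binary.PropositionalEquality using (_≡_; _≢_; refl; sym; trans; cong; cong₂; subst)
open import Relation.Binary.Definitions using (DecidableEquality)
open import Function using (_∘_; id; case_of_)
open import Function.Definitions using (Injective)
open import Data.List.Relation.Unary.All.Properties using (¬All⇒Any¬)
  renaming (++⁺ to All-++⁺; take⁺ to All-take⁺; drop⁺ to All-drop⁺;
            tabulate⁺ to All-tabulate⁺; tabulate⁻ to All-tabulate⁻)
open import Data.List.Relation.Unary.AllPairs.Properties using ()
  renaming (filter⁺ to AllPairs-filter⁺; ++⁺ to AllPairs-++⁺; take⁺ to AllPairs-take⁺;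
            drop⁺ to AllPairs-drop⁺)
open import Data.List.Relation.Unary.Unique.Propositional.Properties using ()
  renaming (take⁺ to Unique-take⁺; filter⁺ to Unique-filter⁺; upTo⁺ to Unique-upTo⁺;
            allFin⁺ to Unique-allFin⁺)
open import Data.List.Relation.Unary.Any.Properties using (lookup-index)
  renaming (++⁺ˡ to Any-++⁺ˡ; ++⁺ʳ to Any-++⁺ʳ; ++⁻ to Any-++⁻)

-- Being hard to colour is a global property, and the obstacle is to see it on boundedly many
-- vertices. `Bad m J` does this: every colouring of the list `J` with `m` colours has a
-- monochromatic triangle, and such lists are found with a length that depends on `m` and on earlier
-- constants, never on the digraph. A vertex `v` divides `J` into in-neighbours, out-neighbours and
-- non-neighbours. The last need few colours, so for large `m` one of the first two needs many;
-- since `J` is bounded, this sorts all vertices into boundedly many types.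
--
-- Non-adjacency separates the problem from tournaments. In colour counts it costs a summand `c₀`;
-- in domination arguments it must be controlled by the conditions `Sparse` and `Cross`, which are
-- themselves derived from forbidden stable sets.
--
-- Colourability and domination by few vertices are decided by exhaustive search. This is what
-- permits case distinctions such as "this neighbourhood is small or contains a certificate", and
-- the negative hypotheses `¬ Col` and `¬ Null`, without classical axioms.

-- Decidable vertex sets and finite search

record Sub (n : ℕ) : Set₁ where
  constructor sub
  field
    mem  : Fin n → Set
    mem? : ∀ x → Dec (mem x)
open Sub

infix 4 _∈_ _∉_ _⊆_
infixl 6 _∩_ _∖_

_∈_ _∉_ : ∀ {n} → Fin n → Sub n → Set
x ∈ X = mem X x
x ∉ X = ¬ (x ∈ X)

_∈?_ : ∀ {n} (x : Fin n) (X : Sub n) → Dec (x ∈ X)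
x ∈? X = mem? X x

_⊆_ : ∀ {n} → Sub n → Sub n → Set
X ⊆ Y = ∀ {x} → x ∈ X → x ∈ Y

full : ∀ {n} → Sub n
full = sub (λ _ → ⊤) (λ _ → yes tt)

_∩_ _∖_ : ∀ {n} → Sub n → Sub n → Sub n
X ∩ Y = sub (λ x → x ∈ X × x ∈ Y) (λ x → (x ∈? X) ×-dec (x ∈? Y))
X ∖ Y = sub (λ x → x ∈ X × x ∉ Y) (λ x → (x ∈? X) ×-dec ¬? (x ∈? Y))

sing : ∀ {n} → Fin n → Sub n
sing v = sub (_≡ v) (_≟F v)

list : ∀ {n} → List (Fin n) → Sub n
list J = sub (_∈ₗ J) (λ x → anyᴬ? (x ≟F_) J)

all-or-some : ∀ {n} {a b} {A : Fin n → Set a} {B : Fin n → Set b} →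
  (∀ x → A x ⊎ B x) → (∀ x → A x) ⊎ ∃ B
all-or-some {zero}  f = inj₁ λ ()
all-or-some {suc n} f with f zero | all-or-some (f ∘ suc)
... | inj₂ b | _            = inj₂ (zero , b)
... | inj₁ _ | inj₂ (x , b) = inj₂ (suc x , b)
... | inj₁ a | inj₁ as      = inj₁ λ { zero → a ; (suc x) → as x }

bound : ∀ {n} (f : Fin n → ℕ) → ∃ λ N → ∀ x → f x ≤ N
bound {zero}  f = 0 , λ ()
bound {suc n} f with N , p ← bound (f ∘ suc) =
  f zero ⊔ N , λ { zero → m≤m⊔n _ _ ; (suc x) → ≤-trans (p x) (m≤n⊔m (f zero) N) }

tailˢ : ∀ {n} → Sub (suc n) → Sub n
tailˢ X = sub (mem X ∘ suc) (mem? X ∘ suc)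

count : ∀ {n} → Sub n → ℕ
count {zero}  X = 0
count {suc n} X with zero ∈? X
... | yes _ = suc (count (tailˢ X))
... | no  _ = count (tailˢ X)

count-mono : ∀ {n} (X Y : Sub n) → X ⊆ Y → count X ≤ count Y
count-mono {zero}  X Y s = z≤n
count-mono {suc n} X Y s with count-mono (tailˢ X) (tailˢ Y) s | zero ∈? X | zero ∈? Y
... | ih | yes p | yes _ = s≤s ih
... | ih | yes p | no ¬q = contradiction (s p) ¬q
... | ih | no _  | yes _ = ≤-trans ih (n≤1+n _)
... | ih | no _  | no _  = ih

count-strict : ∀ {n} (X Y : Sub n) → X ⊆ Y → ∀ {a} → a ∈ Y → a ∉ X → count X < count Y
count-strict {suc n} X Y s {zero} q ¬p with count-mono (tailˢ X) (tailˢ Y) s | zero ∈? X | zero ∈? Y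
... | ih | yes p | _     = contradiction p ¬p
... | ih | no _  | yes _ = s≤s ih
... | ih | no _  | no ¬q = contradiction q ¬q
count-strict {suc n} X Y s {suc a} q ¬p
  with count-strict (tailˢ X) (tailˢ Y) s {a} q ¬p | zero ∈? X | zero ∈? Y
... | ih | yes p | yes _ = s≤s ih
... | ih | yes p | no ¬q = contradiction (s p) ¬q
... | ih | no _  | yes _ = ≤-trans ih (n≤1+n _)
... | ih | no _  | no _  = ih

-- Sinks of `R` are removed one at a time. If this exhausts `X`, the time of removal is a rank;
-- otherwise it halts at a non-empty set where every vertex has a successor, which carries an
-- endless walk.
peel : ∀ {n} {R : Fin n → Fin n → Set} (R? : ∀ x y → Dec (R x y)) (X : Sub n) →
  (Σ (Fin n → ℕ) λ rk → ∀ {x y} → x ∈ X → y ∈ X → R x y → rk y < rk x) ⊎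
  (Σ (Fin n → Set) λ S → (∀ {x} → S x → x ∈ X) × ∃ S × (∀ {x} → S x → ∃ λ y → S y × R x y))
peel {n} {R} R? X₀ = go (count X₀) X₀ ≤-refl
  where
  Goal : Sub n → Set₁
  Goal X = (Σ (Fin n → ℕ) λ rk → ∀ {x y} → x ∈ X → y ∈ X → R x y → rk y < rk x) ⊎
    (Σ (Fin n → Set) λ S → (∀ {x} → S x → x ∈ X) × ∃ S × (∀ {x} → S x → ∃ λ y → S y × R x y))
  go : ∀ m (X : Sub n) → count X ≤ m → Goal X
  go m X le with any? (λ x → (x ∈? X) ×-dec all? (λ y → (y ∈? X) →-dec ¬? (R? x y)))
  go m X le | no ¬sink with any? (_∈? X)
  ... | no ¬x     = inj₁ ((λ _ → 0) , λ {x} p → contradiction (x , p) ¬x)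
  ... | yes start = inj₂ (mem X , id , start , next)
    where
    next : ∀ {x} → x ∈ X → ∃ λ y → y ∈ X × R x y
    next {x} p with any? (λ y → (y ∈? X) ×-dec R? x y)
    ... | yes r = r
    ... | no ¬r = contradiction (x , p , λ y q r → ¬r (y , q , r)) ¬sink
  go zero X le | yes (x , p , _) =
    contradiction (count-strict (X ∖ X) X proj₁ p (λ q → proj₂ q p)) (λ lt → <⇒≱ lt (≤-trans le z≤n))
  go (suc m) X le | yes (x , p , s)
    with go m (X ∖ sing x) (≤-pred (≤-trans (count-strict (X ∖ sing x) X proj₁ p (λ q → proj₂ q refl)) le))
  ... | inj₂ (S , S⊆ , ne , nx) = inj₂ (S , proj₁ ∘ S⊆ , ne , nx)
  ... | inj₁ (rk , dn) = inj₁ (rk′ , dn′)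
    where
    rk′ : Fin n → ℕ
    rk′ z with z ≟F x
    ... | yes _ = 0
    ... | no _  = suc (rk z)
    dn′ : ∀ {a b} → a ∈ X → b ∈ X → R a b → rk′ b < rk′ a
    dn′ {a} {b} pa pb r with a ≟F x | b ≟F x
    ... | yes refl | _    = contradiction r (s b pb)
    ... | no _  | yes _   = s≤s z≤n
    ... | no a≢ | no b≢   = s≤s (dn (pa , a≢) (pb , b≢) r)

vec-any? : ∀ {k} n {P : Vec (Fin k) n → Set} → (∀ v → Dec (P v)) → Dec (∃ P)
vec-any? zero P? = map′ (λ p → [] , p) (λ { ([] , p) → p }) (P? [])
vec-any? (suc n) P? =
  map′ (λ { (a , v , p) → a ∷ v , p }) (λ { (a ∷ v , p) → a , v , p })
       (any? (λ a → vec-any? n (λ v → P? (a ∷ v))))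

list-any? : ∀ {n} k {P : List (Fin n) → Set} → (∀ S → Dec (P S)) → Dec (∃ λ S → length S ≤ k × P S)
list-any? zero P? = map′ (λ p → [] , z≤n , p) (λ { ([] , _ , p) → p }) (P? [])
list-any? (suc k) {P} P? = map′ to from (P? [] ⊎-dec any? (λ a → list-any? k (λ S → P? (a ∷ S))))
  where
  to : P [] ⊎ (∃ λ a → ∃ λ S → length S ≤ k × P (a ∷ S)) → ∃ λ S → length S ≤ suc k × P S
  to (inj₁ p) = [] , z≤n , p
  to (inj₂ (a , S , l , p)) = a ∷ S , s≤s l , p
  from : (∃ λ S → length S ≤ suc k × P S) → P [] ⊎ (∃ λ a → ∃ λ S → length S ≤ k × P (a ∷ S))
  from ([] , _ , p) = inj₁ p
  from (a ∷ S , s≤s l , p) = inj₂ (a , S , l , p)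

filter-split : ∀ {a} {A : Set a} {P : A → Set} (P? : ∀ x → Dec (P x)) (xs : List A) →
  length xs ≡ length (filter P? xs) + length (filter (¬? ∘ P?) xs)
filter-split P? [] = refl
filter-split P? (x ∷ xs) with P? x
... | yes _ = cong suc (filter-split P? xs)
... | no _  = trans (cong suc (filter-split P? xs)) (sym (+-suc _ _))

filter-shrink : ∀ {a} {A : Set a} {P Q : A → Set} (P? : ∀ x → Dec (P x)) (Q? : ∀ x → Dec (Q x)) (xs : List A) →
  length (filter P? (filter Q? xs)) ≤ length (filter P? xs)
filter-shrink P? Q? [] = z≤n
filter-shrink P? Q? (x ∷ xs) with Q? x
... | yes _ with P? x
...   | yes _ = s≤s (filter-shrink P? Q? xs)
...   | no _  = filter-shrink P? Q? xs
filter-shrink P? Q? (x ∷ xs) | no _ with P? x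
...   | yes _ = ≤-trans (filter-shrink P? Q? xs) (n≤1+n _)
...   | no _  = filter-shrink P? Q? xs

pigeonᴸ : ∀ {a} {A : Set a} (f : A → ℕ) (xs : List A) c s → (∀ {x} → x ∈ₗ xs → f x < c) →
  c * s < length xs → ∃ λ γ → γ < c × s < length (filter (λ x → f x ≟ℕ γ) xs)
pigeonᴸ f (x ∷ xs) zero s f< lt with () ← f< (here refl)
pigeonᴸ {A = A} f xs (suc c) s f< lt with s <? length (filter (λ x → f x ≟ℕ c) xs)
... | yes p = c , ≤-refl , p
... | no ¬p = widen (pigeonᴸ f ys c s ys< long)
  where
  ys : List A
  ys = filter (λ x → ¬? (f x ≟ℕ c)) xs
  ys< : ∀ {x} → x ∈ₗ ys → f x < c
  ys< p with q , ne ← ∈-filter⁻ (λ x → ¬? (f x ≟ℕ c)) {xs = xs} p = ≤∧≢⇒< (≤-pred (f< q)) ne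
  long : c * s < length ys
  long = +-cancelˡ-≤ s _ _ (begin
    s + suc (c * s)       ≡⟨ +-suc s (c * s) ⟩
    suc (s + c * s)       ≤⟨ lt ⟩
    length xs             ≡⟨ filter-split (λ x → f x ≟ℕ c) xs ⟩
    length (filter (λ x → f x ≟ℕ c) xs) + length ys ≤⟨ +-monoˡ-≤ _ (≮⇒≥ ¬p) ⟩
    s + length ys ∎)
    where open ≤-Reasoning
  widen : (∃ λ γ → γ < c × s < length (filter (λ x → f x ≟ℕ γ) ys)) →
          ∃ λ γ → γ < suc c × s < length (filter (λ x → f x ≟ℕ γ) xs)
  widen (γ , l , p) = γ , <-trans l (n<1+n c) , <-≤-trans p (filter-shrink (λ x → f x ≟ℕ γ) (λ x → ¬? (f x ≟ℕ c)) xs)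

-- Acyclic colourings

module Dig (D : Digraph) where

  V : Set
  V = Fin (size D)

  infix 4 _⟶_ _o_ _▷_ _⟶?_ _▷?_

  -- As there are no loops, `x o x` always holds. Hence `Non v` contains `v`, and distinctness is
  -- demanded separately wherever stable sets or copies are built.
  _⟶_ _o_ _▷_ : V → V → Set
  x ⟶ y = arc D x y ≡ true
  x o y = ¬ (x ⟶ y) × ¬ (y ⟶ x)
  s ▷ x = s ≡ x ⊎ s ⟶ x

  _⟶?_ : ∀ x y → Dec (x ⟶ y)
  x ⟶? y = arc D x y ≟B true

  _o?_ : ∀ x y → Dec (x o y)
  x o? y = ¬? (x ⟶? y) ×-dec ¬? (y ⟶? x)

  _▷?_ : ∀ x y → Dec (x ▷ y)
  x ▷? y = (x ≟F y) ⊎-dec (x ⟶? y)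

  irrefl : ∀ {x} → ¬ x ⟶ x
  irrefl {x} p = case trans (sym p) (loopless D x) of λ ()

  asym : ∀ {x y} → x ⟶ y → ¬ y ⟶ x
  asym {x} {y} p q = case trans (sym q) (oriented D x y p) of λ ()

  o-sym : ∀ {x y} → x o y → y o x
  o-sym (p , q) = q , p

  adj? : ∀ x y → x ⟶ y ⊎ y ⟶ x ⊎ x o y
  adj? x y with x ⟶? y | y ⟶? x
  ... | yes p | _     = inj₁ p
  ... | no _  | yes q = inj₂ (inj₁ q)
  ... | no p  | no q  = inj₂ (inj₂ (p , q))

  Out In Non : V → Sub (size D)
  Out v = sub (v ⟶_) (v ⟶?_)
  In  v = sub (_⟶ v) (_⟶? v)
  Non v = sub (v o_) (v o?_)

  -- The colour classes are acyclic because the rank increases along monochromatic arcs.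
  record Col (X : Sub (size D)) (k : ℕ) : Set where
    field
      col  : V → ℕ
      rk   : V → ℕ
      col< : ∀ {x} → x ∈ X → col x < k
      up   : ∀ {x y} → x ∈ X → y ∈ X → x ⟶ y → col x ≡ col y → rk x < rk y
  open Col public

  col-mono : ∀ {X Y k l} → (∀ {x} → x ∈ X → x ∈ Y) → k ≤ l → Col Y k → Col X l
  col-mono s le c = record
    { col = col c ; rk = rk c
    ; col< = λ p → <-≤-trans (col< c (s p)) le
    ; up = λ p q → up c (s p) (s q) }

  col-⊆ : ∀ {X Y k} → (∀ {x} → x ∈ X → x ∈ Y) → Col Y k → Col X k
  col-⊆ s = col-mono s ≤-refl

  col-≤ : ∀ {X k l} → k ≤ l → Col X k → Col X l
  col-≤ = col-mono id

  col-∅ : ∀ {X k} → (∀ {x} → x ∉ X) → Col X k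
  col-∅ e = record { col = λ _ → 0 ; rk = λ _ → 0
    ; col< = λ p → contradiction p e ; up = λ p → contradiction p e }

  col-stable : ∀ {X} → (∀ {x y} → x ∈ X → y ∈ X → ¬ x ⟶ y) → Col X 1
  col-stable e = record { col = λ _ → 0 ; rk = λ _ → 0
    ; col< = λ p → s≤s z≤n ; up = λ p q r → contradiction r (e p q) }

  col-∪ : ∀ {X} Y {Z a b} → (∀ {x} → x ∈ X → x ∉ Y → x ∈ Z) →
    Col Y a → Col Z b → Col X (a + b)
  col-∪ {X} Y {Z} {a} {b} cov c d = record { col = κ ; rk = ρ ; col< = κ< ; up = inc }
    where
    κ ρ : V → ℕ
    κ x with x ∈? Y
    ... | yes _ = col c x
    ... | no _  = a + col d x
    ρ x with x ∈? Y
    ... | yes _ = rk c x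
    ... | no _  = rk d x
    κ< : ∀ {x} → x ∈ X → κ x < a + b
    κ< {x} p with x ∈? Y
    ... | yes q = <-≤-trans (col< c q) (m≤m+n a b)
    ... | no q  = +-monoʳ-< a (col< d (cov p q))
    inc : ∀ {x y} → x ∈ X → y ∈ X → x ⟶ y → κ x ≡ κ y → ρ x < ρ y
    inc {x} {y} p q r e with x ∈? Y | y ∈? Y
    ... | yes p′ | yes q′ = up c p′ q′ r e
    ... | yes p′ | no q′ = contradiction (≤-trans (m≤m+n a _) (≤-reflexive (sym e))) (<⇒≱ (col< c p′))
    ... | no p′  | yes q′ = contradiction (≤-trans (m≤m+n a _) (≤-reflexive e)) (<⇒≱ (col< c q′))
    ... | no p′  | no q′ = up d (cov p p′) (cov q q′) r (+-cancelˡ-≡ a _ _ e)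

  col-cover : ∀ {i} {I : Set i} {X} (L : List I) (F : I → Sub (size D)) {k} →
    (∀ {x} → x ∈ X → Any (λ i → x ∈ F i) L) → All (λ i → Col (F i) k) L → Col X (length L * k)
  col-cover [] F cov [] = col-∅ (λ p → case cov p of λ ())
  col-cover {X = X} (i ∷ L) F cov (c ∷ cs) = col-∪ (F i) {Z = X ∖ F i} (λ p q → p , q) c
    (col-cover L F (λ { (p , q) → case cov p of λ { (here r) → contradiction r q ; (there r) → r } }) cs)

  -- All layers share one palette. The rank is lexicographic, position first: no arc drops to a
  -- lower position, and `suc N` exceeds every rank inside a layer.
  col-layers : ∀ {X k} (pos : V → ℕ) →
    (∀ {x y} → x ∈ X → y ∈ X → x ⟶ y → pos x ≤ pos y) →
    (∀ i → Col (X ∩ sub (λ x → pos x ≡ i) (λ x → pos x ≟ℕ i)) k) → Col X k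
  col-layers {X} {k} pos mon c with N , bd ← bound (λ x → rk (c (pos x)) x) = record
    { col = λ x → col (c (pos x)) x
    ; rk = λ x → pos x * suc N + rk (c (pos x)) x
    ; col< = λ {x} p → col< (c (pos x)) (p , refl)
    ; up = inc }
    where
    inc : ∀ {x y} → x ∈ X → y ∈ X → x ⟶ y → col (c (pos x)) x ≡ col (c (pos y)) y →
      pos x * suc N + rk (c (pos x)) x < pos y * suc N + rk (c (pos y)) y
    inc {x} {y} p q r e with pos x ≟ℕ pos y
    ... | no i≢j = begin
      suc (pos x * suc N + rk (c (pos x)) x) ≤⟨ s≤s (+-monoʳ-≤ (pos x * suc N) (bd x)) ⟩
      suc (pos x * suc N + N)     ≡⟨ trans (sym (+-suc _ N)) (+-comm (pos x * suc N) (suc N)) ⟩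
      suc (pos x) * suc N         ≤⟨ *-monoˡ-≤ (suc N) (≤∧≢⇒< (mon p q r) i≢j) ⟩
      pos y * suc N               ≤⟨ m≤m+n _ _ ⟩
      pos y * suc N + rk (c (pos y)) y ∎
      where open ≤-Reasoning
    ... | yes i≡j = subst (λ j → pos x * suc N + rk (c (pos x)) x < j * suc N + rk (c j) y) i≡j
      (+-monoʳ-< (pos x * suc N)
        (up (c (pos x)) (p , refl) (q , sym i≡j) r (trans e (cong (λ j → col (c j) y) (sym i≡j)))))

  -- Between positions of equal parity a drop by exactly one cannot happen, so `col-layers` colours
  -- each parity class, with a palette of its own.
  col-parity : ∀ {X k} (pos : V → ℕ) →
    (∀ {x y} → x ∈ X → y ∈ X → x ⟶ y → pos x ≤ suc (pos y)) →
    (∀ i → Col (X ∩ sub (λ x → pos x ≡ i) (λ x → pos x ≟ℕ i)) k) → Col X (k + k)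
  col-parity {X} {k} pos mon c =
    col-∪ Even {Z = X ∖ Even} (λ p q → p , q) (half Even proj₁ even) (half (X ∖ Even) proj₁ odd)
    where
    par : ℕ → Bool
    par zero = true
    par (suc zero) = false
    par (suc (suc i)) = par i
    par-suc : ∀ i → par i ≢ par (suc i)
    par-suc (suc (suc i)) e = par-suc i e
    Even : Sub (size D)
    Even = sub (λ x → x ∈ X × par (pos x) ≡ true) (λ x → (x ∈? X) ×-dec (par (pos x) ≟B true))
    even : ∀ {x y} → x ∈ Even → y ∈ Even → par (pos x) ≡ par (pos y)
    even (_ , p) (_ , q) = trans p (sym q)
    odd : ∀ {x y} → x ∈ (X ∖ Even) → y ∈ (X ∖ Even) → par (pos x) ≡ par (pos y)
    odd {x} {y} (p , p′) (q , q′) with par (pos x) ≟B true | par (pos y) ≟B true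
    ... | yes e | _ = contradiction (p , e) p′
    ... | no _ | yes e = contradiction (q , e) q′
    ... | no e | no e′ = trans (not-true e) (sym (not-true e′))
      where
      not-true : ∀ {b} → b ≢ true → b ≡ false
      not-true {true} n = contradiction refl n
      not-true {false} n = refl
    half : ∀ Y → (∀ {x} → x ∈ Y → x ∈ X) →
      (∀ {x y} → x ∈ Y → y ∈ Y → par (pos x) ≡ par (pos y)) → Col Y k
    half Y Y⊆ same = col-layers pos down (λ i → col-⊆ (λ { (p , e) → Y⊆ p , e }) (c i))
      where
      down : ∀ {x y} → x ∈ Y → y ∈ Y → x ⟶ y → pos x ≤ pos y
      down {x} {y} p q r with pos x ≟ℕ suc (pos y)
      ... | no ne = ≤-pred (≤∧≢⇒< (mon (Y⊆ p) (Y⊆ q) r) ne)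
      ... | yes e = contradiction (trans (sym (same p q)) (cong par e)) (par-suc (pos y))

  flip-rank : (rk : V → ℕ) → ∃ λ (rk′ : V → ℕ) → ∀ {x y} → rk y < rk x → rk′ x < rk′ y
  flip-rank rk with N , bd ← bound rk = (λ x → N ∸ rk x) , λ {x} lt → ∸-monoʳ-< lt (bd x)

  no-endless : (rk : V → ℕ) (S : V → Set) → ∃ S →
    (∀ {x} → S x → ∃ λ y → S y × rk x < rk y) → ⊥
  no-endless rk S (s , p) next with N , bd ← bound rk = case climb (suc N) of λ { (x , _ , lt) → <⇒≱ lt (bd x) }
    where
    climb : ∀ m → ∃ λ x → S x × m ≤ rk x
    climb zero = s , p , z≤n
    climb (suc m) with x , q , le ← climb m with y , q′ , lt ← next q = y , q′ , ≤-trans (s≤s le) lt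

  -- Only the colours are searched; `peel` supplies or refutes the rank. `Fin (suc k)` in place of
  -- `Fin k` leaves a colour for vertices outside `X` even when `k` is zero.
  col? : ∀ X k → Dec (Col X k)
  col? X k = map′ to from (vec-any? (size D) {P = Good} good?)
    where
    module _ (v : Vec (Fin (suc k)) (size D)) where
      R : V → V → Set
      R x y = x ⟶ y × lookupᵛ v x ≡ lookupᵛ v y
      Rank Small Good : Set
      Rank = Σ (V → ℕ) λ rk → ∀ {x y} → x ∈ X → y ∈ X → R x y → rk x < rk y
      Small = ∀ x → x ∈ X → toℕ (lookupᵛ v x) < k
      Good = Small × Rank
      good? : Dec Good
      good? = all? (λ x → (x ∈? X) →-dec (_ <? k)) ×-dec rank?
        where
        rank? : Dec Rank
        rank? with peel (λ x y → (x ⟶? y) ×-dec (lookupᵛ v x ≟F lookupᵛ v y)) X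
        ... | inj₁ (rk , dn) with rk′ , fl ← flip-rank rk = yes (rk′ , λ p q r → fl (dn p q r))
        ... | inj₂ (S , S⊆ , ne , nx) = no λ { (rk , u) → no-endless rk S ne
                (λ p → case nx p of λ { (y , q , r) → y , q , u (S⊆ p) (S⊆ q) r }) }
    to : ∃ Good → Col X k
    to (v , sm , rk , u) = record { col = toℕ ∘ lookupᵛ v ; rk = rk ; col< = sm _
      ; up = λ p q r e → u p q (r , toℕ-injective e) }
    from : Col X k → ∃ Good
    from c = v , sm , rk c , λ { {x} {y} p q (r , e) →
        up c p q r (trans (sym (val p)) (trans (cong toℕ e) (val q))) }
      where
      clip : ∀ i → Dec (i < suc k) → Fin (suc k)
      clip i (yes lt) = fromℕ< lt
      clip i (no _) = zero
      clip-val : ∀ i (d : Dec (i < suc k)) → i < suc k → toℕ (clip i d) ≡ i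
      clip-val i (yes lt) _ = toℕ-fromℕ< lt
      clip-val i (no n) lt = contradiction lt n
      v : Vec (Fin (suc k)) (size D)
      v = tabulateᵛ (λ x → clip (col c x) (col c x <? suc k))
      val : ∀ {x} → x ∈ X → toℕ (lookupᵛ v x) ≡ col c x
      val {x} p = trans (cong toℕ (lookup∘tabulate _ x))
        (clip-val (col c x) (col c x <? suc k) (<-trans (col< c p) (n<1+n k)))
      sm : Small v
      sm x p = subst (_< k) (sym (val p)) (col< c p)

  record MonoTriangle (κ : V → ℕ) (X : Sub (size D)) : Set where
    constructor tri
    field
      {x y z} : V
      x∈ : x ∈ X
      y∈ : y ∈ X
      z∈ : z ∈ X
      xy : x ⟶ y
      yz : y ⟶ z
      zx : z ⟶ x
      κxy : κ x ≡ κ y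
      κyz : κ y ≡ κ z

  tri-⊆ : ∀ {κ} {X Y} → (∀ {x} → x ∈ X → x ∈ Y) → MonoTriangle κ X → MonoTriangle κ Y
  tri-⊆ s (tri p q r a b c e f) = tri (s p) (s q) (s r) a b c e f

  col-no-triangle : ∀ {X k} (c : Col X k) → ¬ MonoTriangle (col c) X
  col-no-triangle c (tri p q r a b d e f) =
    <-irrefl refl (<-trans (up c p q a e) (<-trans (up c q r b f) (up c r p d (sym (trans e f)))))

  -- A finite certificate that m colours do not suffice to avoid monochromatic
  -- triangles on J; its length will be bounded independently of D.
  Bad : ℕ → List V → Set
  Bad m J = ∀ (κ : V → ℕ) → (∀ {j} → j ∈ₗ J → κ j < m) → MonoTriangle κ (list J)

  bad-not-col : ∀ {m J X} → Bad m J → (∀ {x} → x ∈ₗ J → x ∈ X) → ¬ Col X m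
  bad-not-col b s c = col-no-triangle c (tri-⊆ s (b (col c) (λ p → col< c (s p))))

  -- If `γ` is absent from `B`, renaming colour `m` to `γ` leaves `m` colours and identifies no two
  -- colours used on `B`, so the triangle that `Bad m` yields was already monochromatic under `κ`.
  bad-all-colours : ∀ {m B} → Bad m B → ∀ κ γ → (∀ {j} → j ∈ₗ B → κ j < suc m) → γ < suc m →
    MonoTriangle κ (list B) ⊎ ∃ λ b → b ∈ₗ B × κ b ≡ γ
  bad-all-colours {m} {B} bad κ γ κ< γ< with anyᴬ? (λ b → κ b ≟ℕ γ) B
  ... | yes p = inj₂ (find p)
  ... | no ¬p = inj₁ (back (bad κ′ κ′<))
    where
    miss : ∀ {b} → b ∈ₗ B → κ b ≢ γ
    miss p e = ¬p (lose p e)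
    κ′ : V → ℕ
    κ′ x with κ x ≟ℕ m
    ... | yes _ = γ
    ... | no _ = κ x
    κ′< : ∀ {j} → j ∈ₗ B → κ′ j < m
    κ′< {j} p with κ j ≟ℕ m
    ... | yes e = ≤∧≢⇒< (≤-pred γ<) (λ g → miss p (trans e (sym g)))
    ... | no ne = ≤∧≢⇒< (≤-pred (κ< p)) ne
    inj : ∀ {i j} → i ∈ₗ B → j ∈ₗ B → κ′ i ≡ κ′ j → κ i ≡ κ j
    inj {i} {j} p q e with κ i ≟ℕ m | κ j ≟ℕ m
    ... | yes a | yes b = trans a (sym b)
    ... | yes a | no b = contradiction (sym e) (miss q)
    ... | no a | yes b = contradiction e (miss p)
    ... | no a | no b = e
    back : MonoTriangle κ′ (list B) → MonoTriangle κ (list B)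
    back (tri p q r a b c e f) = tri p q r a b c (inj p q e) (inj q r f)

  -- Unlike in tournaments, an undominated vertex need not be an in-neighbour of the
  -- dominating set: non-adjacency does not count as domination.
  record Null (Z : Sub (size D)) (K : ℕ) (X : Sub (size D)) : Set where
    constructor null
    field
      dom : List V
      dom⊆ : All (_∈ Z) dom
      dom≤ : length dom ≤ K
      dominated : ∀ {x} → x ∈ X → Any (_▷ x) dom
  open Null public

  null-mono : ∀ {Z Z′ K K′ X X′} → (∀ {x} → x ∈ Z → x ∈ Z′) → K ≤ K′ → (∀ {x} → x ∈ X′ → x ∈ X) →
    Null Z K X → Null Z′ K′ X′
  null-mono s le t (null S a b c) = null S (mapᴬ s a) (≤-trans b le) (c ∘ t)

  null-≤ : ∀ {Z K K′ X} → K ≤ K′ → Null Z K X → Null Z K′ X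
  null-≤ le (null S a b c) = null S a (≤-trans b le) c

  null? : ∀ Z K X → Dec (Null Z K X)
  null? Z K X = map′ (λ { (S , l , a , d) → null S a l (d _) }) (λ n → dom n , dom≤ n , dom⊆ n , λ _ → dominated n)
    (list-any? K {P = λ S → All (_∈ Z) S × (∀ x → x ∈ X → Any (_▷ x) S)}
      (λ S → allᴬ? (_∈? Z) S ×-dec all? (λ x → (x ∈? X) →-dec anyᴬ? (_▷? x) S)))

rev : Digraph → Digraph
rev D = record { size = size D ; arc = λ x y → arc D y x ; loopless = loopless D
  ; oriented = λ x y → oriented D y x }

col-rev : ∀ {D X k} → Dig.Col D X k → Dig.Col (rev D) X k
col-rev {D} c with rk′ , fl ← Dig.flip-rank D (Dig.rk c) = record
  { col = Dig.col c ; rk = rk′ ; col< = Dig.col< c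
  ; up = λ p q r e → fl (Dig.up c q p r (sym e)) }

-- The construction H₁ ⇒ H₂

module Splitting (D : Digraph) where
  open Dig D

  To From : List V → Sub (size D) → Sub (size D)
  To   J X = sub (λ x → x ∈ X × All (x ⟶_) J) (λ x → (x ∈? X) ×-dec allᴬ? (x ⟶?_) J)
  From J X = sub (λ x → x ∈ X × All (_⟶ x) J) (λ x → (x ∈? X) ×-dec allᴬ? (_⟶? x) J)

  -- Meant for `A` the vertices of `X` joined to all of `J` in one direction: any other vertex fails
  -- at some `j`, so it is a non-neighbour of `j` or joined to it the wrong way.
  col-split : ∀ {X A h a b c} (J : List V) (F : V → Sub (size D)) → length J ≤ h → Col A a →
    (∀ {j} → j ∈ₗ J → Col (Non j ∩ X) b) → (∀ {j} → j ∈ₗ J → Col (F j ∩ X) c) →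
    (∀ {x} → x ∈ X → x ∉ A → Any (λ j → j o x ⊎ x ∈ F j) J) → Col X (a + h * (b + c))
  col-split {X} {A} {h} {a} {b} {c} J F le cA cN cF cov = col-∪ A {Z = X ∖ A} (λ p q → p , q) cA
    (col-≤ (*-monoˡ-≤ (b + c) le) (col-cover J G (λ { (p , q) → mapᴱ (p ,_) (cov p q) })
      (tabulateᴬ (λ {j} j∈ → col-∪ (Non j ∩ X) {Z = F j ∩ X}
        (λ { (p , inj₁ q) n → contradiction (q , p) n ; (p , inj₂ q) n → q , p }) (cN j∈) (cF j∈)))))
    where
    G : V → Sub (size D)
    G j = sub (λ x → x ∈ X × (j o x ⊎ x ∈ F j)) (λ x → (x ∈? X) ×-dec ((j o? x) ⊎-dec (x ∈? F j)))

  col-towards : ∀ {X h a b c} (J : List V) → length J ≤ h → Col (To J X) a →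
    (∀ {j} → j ∈ₗ J → Col (Non j ∩ X) b) → (∀ {j} → j ∈ₗ J → Col (Out j ∩ X) c) →
    Col X (a + h * (b + c))
  col-towards {X} J le cA cN cF = col-split J Out le cA cN cF
    (λ {x} p n → mapᴱ (λ {j} → dir x j) (¬All⇒Any¬ (x ⟶?_) J (λ q → n (p , q))))
    where
    dir : ∀ x j → ¬ x ⟶ j → j o x ⊎ j ⟶ x
    dir x j n with j ⟶? x
    ... | yes p = inj₂ p
    ... | no q = inj₁ (q , n)

  col-away : ∀ {X h a b c} (J : List V) → length J ≤ h → Col (From J X) a →
    (∀ {j} → j ∈ₗ J → Col (Non j ∩ X) b) → (∀ {j} → j ∈ₗ J → Col (In j ∩ X) c) →
    Col X (a + h * (b + c))
  col-away {X} J le cA cN cF = col-split J In le cA cN cF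
    (λ {x} p n → mapᴱ (λ {j} → dir x j) (¬All⇒Any¬ (_⟶? x) J (λ q → n (p , q))))
    where
    dir : ∀ x j → ¬ j ⟶ x → j o x ⊎ x ⟶ j
    dir x j n with x ⟶? j
    ... | yes p = inj₂ p
    ... | no q = inj₁ (n , q)

  _∷ʰ_≟_ : ∀ (j : V) L L′ → Dec (L ≡ j ∷ L′)
  _∷ʰ_≟_ j L L′ = ≡-dec _≟F_ L (j ∷ L′)

  tl : List V → List V
  tl [] = []
  tl (_ ∷ L) = L

  Fibre : Sub (size D) → (V → List V) → List V → Sub (size D)
  Fibre X S L = X ∩ sub (λ x → S x ≡ L) (λ x → ≡-dec _≟F_ (S x) L)

-- This is `c * (1 + b + ... + b ^ h)`: a palette of `c` colours for each list of length at most `h`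
-- over `b` letters.
tuples : (h b c : ℕ) → ℕ
tuples zero    b c = c
tuples (suc h) b c = c + b * tuples h b c

module Fibres (D : Digraph) where
  open Dig D
  open Splitting D

  col-fibres : ∀ h {b c} (J : List V) → length J ≤ b → ∀ X (S : V → List V) →
    (∀ {x} → x ∈ X → All (_∈ₗ J) (S x) × length (S x) ≤ h) →
    (∀ L → Col (Fibre X S L) c) → Col X (tuples h b c)
  col-fibres zero J le X S bd c = col-⊆ {Y = Fibre X S []} (λ p → p , empty (proj₂ (bd p))) (c [])
    where
    empty : ∀ {L : List V} → length L ≤ 0 → L ≡ []
    empty {[]} _ = refl
  col-fibres (suc h) {b} {c} J le X S bd cf =
    col-∪ (Fibre X S []) {Z = X ∖ Fibre X S []} (λ p q → p , q) (cf [])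
      (col-≤ (*-monoˡ-≤ (tuples h b c) le) (col-cover J F cov (tabulateᴬ (λ _ → colF _))))
    where
    F : V → Sub (size D)
    F j = X ∩ sub (λ x → S x ≡ j ∷ tl (S x)) (λ x → j ∷ʰ S x ≟ tl (S x))
    cov : ∀ {x} → x ∈ (X ∖ Fibre X S []) → Any (λ j → x ∈ F j) J
    cov {x} (p , q) with S x | bd p
    ... | [] | _ = contradiction (p , refl) q
    ... | j ∷ L | (j∈ ∷ _) , _ = lose j∈ (p , refl)
    colF : ∀ j → Col (F j) (tuples h b c)
    colF j = col-fibres h J le (F j) (tl ∘ S) bd′
      (λ L → col-⊆ {Y = Fibre X S (j ∷ L)} (λ { ((p , e) , e′) → p , trans e (cong (j ∷_) e′) }) (cf (j ∷ L)))
      where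
      bd′ : ∀ {x} → x ∈ F j → All (_∈ₗ J) (tl (S x)) × length (tl (S x)) ≤ h
      bd′ {x} (p , e) with S x | bd p
      ... | _ ∷ _ | (_ ∷ a) , s≤s l = a , l

-- `C₁ J` and `C₂ J` stand for: `J` lists the vertices of a copy of H₁, or of H₂. Copies enter the
-- argument only through their bounded size, their presence in sets that are hard to colour, and
-- `no₁₂`.
record Setting (c₀ c₁ c₂ h₁ h₂ : ℕ) (D : Digraph) : Set₁ where
  open Dig D
  field
    C₁ C₂ : List V → Set
    non : ∀ v → Col (Non v) c₀
    has₁ : ∀ X → Col X c₁ ⊎ ∃ λ J → All (_∈ X) J × length J ≤ h₁ × C₁ J
    has₂ : ∀ X → Col X c₂ ⊎ ∃ λ J → All (_∈ X) J × length J ≤ h₂ × C₂ J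
    no₁₂ : ∀ {J J′} → C₁ J → C₂ J′ → (∀ {a b} → a ∈ₗ J → b ∈ₗ J′ → a ⟶ b) → ⊥

module Arrow (c₀ c₁ c₂ h₁ h₂ : ℕ) where

  loc⁺ loc⁻ : ℕ → ℕ
  loc⁺ k = c₂ + (c₁ + h₂ * (c₀ + k))
  loc⁻ k = c₁ + (c₂ + h₁ * (c₀ + k))

  clq : (K t : ℕ) → ℕ
  clq K zero = 0
  clq K (suc t) = loc⁻ (c₁ + clq K t) + loc⁺ (c₂ + h₁ * (c₀ + K))

  -- `ℓ` times the number of pairs among `t` vertices.
  links : (ℓ t : ℕ) → ℕ
  links ℓ zero = 0
  links ℓ (suc t) = t * ℓ + links ℓ t

  mtK mtℓ : ℕ → ℕ
  mtK zero = 0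
  mtK (suc m) = clq (mtK m) (2 + m)
  mtℓ zero = 1
  mtℓ (suc m) = (2 + m) + links (mtℓ m) (2 + m)

  module _ {D : Digraph} (S : Setting c₀ c₁ c₂ h₁ h₂ D) where
    open Dig D
    open Splitting D
    open Fibres D
    open Setting S

    From-col : ∀ {J} X → C₁ J → Col (From J X) c₂
    From-col {J} X cJ with has₂ (From J X)
    ... | inj₁ c = c
    ... | inj₂ (J′ , J′⊆ , _ , cJ′) =
      ⊥-elim (no₁₂ cJ cJ′ (λ a∈ b∈ → lookupᴬ (proj₂ (lookupᴬ J′⊆ b∈)) a∈))

    To-col : ∀ {J} X → C₂ J → Col (To J X) c₁
    To-col {J} X cJ with has₁ (To J X)
    ... | inj₁ c = c
    ... | inj₂ (J′ , J′⊆ , _ , cJ′) =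
      ⊥-elim (no₁₂ cJ′ cJ (λ a∈ b∈ → lookupᴬ (proj₂ (lookupᴬ J′⊆ a∈)) b∈))

    -- Take a copy `J` of H₂ in `X`. The vertices pointing to all of `J` contain no copy of H₁; any
    -- other vertex is a non-neighbour or an out-neighbour of a member of `J`.
    local⁺ : ∀ {X k} → (∀ {v} → v ∈ X → Col (Out v ∩ X) k) → Col X (loc⁺ k)
    local⁺ {X} {k} loc with has₂ X
    ... | inj₁ c = col-≤ (m≤m+n _ _) c
    ... | inj₂ (J , J⊆ , le , cJ) = col-≤ (m≤n+m _ c₂) (col-towards J le (To-col X cJ)
      (λ {j} _ → col-⊆ {Y = Non j} proj₁ (non _)) (λ j∈ → loc (lookupᴬ J⊆ j∈)))

    local⁻ : ∀ {X k} → (∀ {v} → v ∈ X → Col (In v ∩ X) k) → Col X (loc⁻ k)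
    local⁻ {X} {k} loc with has₁ X
    ... | inj₁ c = col-≤ (m≤m+n _ _) c
    ... | inj₂ (J , J⊆ , le , cJ) = col-≤ (m≤n+m _ c₁) (col-away J le (From-col X cJ)
      (λ {j} _ → col-⊆ {Y = Non j} proj₁ (non _)) (λ j∈ → loc (lookupᴬ J⊆ j∈)))

    module Heavy (X₀ : Sub (size D)) (K : ℕ) where

      Back : V → V → Sub (size D)
      Back u v = Out v ∩ In u ∩ X₀

      Heavy HAdj : V → V → Set
      Heavy u v = u ⟶ v × ¬ Col (Back u v) K
      HAdj u v = Heavy u v ⊎ Heavy v u

      heavy? : ∀ u v → Dec (Heavy u v)
      heavy? u v = (u ⟶? v) ×-dec ¬? (col? (Back u v) K)

      HNbr : V → Sub (size D)
      HNbr v = sub (HAdj v) (λ u → heavy? v u ⊎-dec heavy? u v)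

      Clique : ℕ → Sub (size D) → Set
      Clique t X = ∃ λ ws → length ws ≡ t × All (_∈ X) ws × AllPairs HAdj ws

      -- Otherwise a copy of H₁ in In v is complete to a set containing a copy of H₂ in Out v.
      one-side : ∀ {X g} v → (∀ {x} → x ∈ X → x ∈ X₀) → Col (HNbr v ∩ X) g →
        Col (In v ∩ X) (c₁ + g) ⊎ Col (Out v ∩ X) (c₂ + h₁ * (c₀ + K))
      one-side {X} {g} v X⊆ cg with has₁ (In v ∩ X ∖ HNbr v)
      ... | inj₁ c = inj₁ (col-∪ (In v ∩ X ∖ HNbr v) {Z = HNbr v ∩ X} rest c cg)
        where
        rest : ∀ {x} → x ∈ (In v ∩ X) → x ∉ (In v ∩ X ∖ HNbr v) → x ∈ (HNbr v ∩ X)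
        rest {x} (p , q) n = decidable-stable (x ∈? HNbr v) (λ h → n ((p , q) , h)) , q
      ... | inj₂ (J , J⊆ , le , cJ) = inj₂ (col-away J le (From-col (Out v ∩ X) cJ)
          (λ {j} _ → col-⊆ {Y = Non j} proj₁ (non _)) light)
        where
        light : ∀ {j} → j ∈ₗ J → Col (In j ∩ (Out v ∩ X)) K
        light {j} j∈ with (p , _) , nh ← lookupᴬ J⊆ j∈ =
          col-⊆ {Y = Back j v} (λ { (a , b , c) → (b , a) , X⊆ c })
            (decidable-stable (col? (Back j v) K) (λ n → nh (inj₂ (p , n))))

      -- If no heavy neighbourhood contains a clique on `t` vertices, all of them are small by
      -- induction. Then `one-side` gives each vertex a small in- or out-neighbourhood, and `local⁻`
      -- and `local⁺` colour the two classes.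
      clique : ∀ t X → (∀ {x} → x ∈ X → x ∈ X₀) → Col X (clq K t) ⊎ Clique t X
      clique zero X X⊆ = inj₂ ([] , refl , [] , [])
      clique (suc t) X X⊆ with all-or-some step
        where
        step : ∀ v → (v ∈ X → Col (HNbr v ∩ X) (clq K t)) ⊎ (v ∈ X × Clique t (HNbr v ∩ X))
        step v with v ∈? X | clique t (HNbr v ∩ X) (λ p → X⊆ (proj₂ p))
        ... | no n | _ = inj₁ (λ p → contradiction p n)
        ... | yes p | inj₁ c = inj₁ (λ _ → c)
        ... | yes p | inj₂ c = inj₂ (p , c)
      ... | inj₂ (v , v∈ , ws , len , ws⊆ , prs) =
        inj₂ (v ∷ ws , cong suc len , v∈ ∷ mapᴬ proj₂ ws⊆ , mapᴬ proj₁ ws⊆ ∷ prs)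
      ... | inj₁ small = inj₁ (col-∪ Sm {Z = X ∖ Sm} (λ p q → p , q)
          (local⁻ {X = Sm} (λ { {v} (_ , c) → col-⊆ {Y = In v ∩ X} (λ { (a , b , _) → a , b }) c }))
          (local⁺ {X = X ∖ Sm} (λ { {v} (p , n) → col-⊆ {Y = Out v ∩ X} (λ { (a , b , _) → a , b }) (other p n) })))
        where
        Sm : Sub (size D)
        Sm = X ∩ sub (λ v → Col (In v ∩ X) (c₁ + clq K t)) (λ v → col? (In v ∩ X) (c₁ + clq K t))
        other : ∀ {v} → v ∈ X → v ∉ Sm → Col (Out v ∩ X) (c₂ + h₁ * (c₀ + K))
        other {v} p n with one-side v X⊆ (small v p)
        ... | inj₁ c = contradiction (p , c) n
        ... | inj₂ c = c

    Mountain : ℕ → Set₁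
    Mountain m = ∀ X → Col X (mtK m) ⊎ ∃ λ J → All (_∈ X) J × length J ≤ mtℓ m × Bad m J

    -- With the threshold `mtK m` for heaviness, the set `Back` of each heavy arc contains a `Bad m`
    -- list by induction. A heavy clique on `2 + m` vertices and one such list for each pair form
    -- the next certificate.
    mountain : ∀ m → Mountain m
    mountain zero X with any? (_∈? X)
    ... | no n = inj₁ (col-∅ (λ p → n (_ , p)))
    ... | yes (x , p) = inj₂ (x ∷ [] , p ∷ [] , ≤-refl , λ κ lt → case lt (here refl) of λ ())
    mountain (suc m) X with Heavy.clique X (mtK m) (2 + m) X id
    ... | inj₁ c = inj₁ c
    ... | inj₂ (ws , len , ws⊆ , prs) = inj₂ (ws ++ J , All-++⁺ ws⊆ J⊆ ,
        ≤-trans (≤-reflexive (length-++ ws)) (+-mono-≤ (≤-reflexive len) (subst (λ t → length J ≤ links (mtℓ m) t) len J≤)) , bad)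
      where
      open Heavy X (mtK m)
      ℓ = mtℓ m
      Link : List V → V → V → Set
      Link J u v = ∃ λ B → Bad m B × (∀ {b} → b ∈ₗ B → b ∈ₗ J) ×
        ((u ⟶ v × All (λ b → v ⟶ b × b ⟶ u) B) ⊎ (v ⟶ u × All (λ b → u ⟶ b × b ⟶ v) B))
      grow : ∀ {J J′ u v} → (∀ {b} → b ∈ₗ J → b ∈ₗ J′) → Link J u v → Link J′ u v
      grow s (B , bB , B⊆ , r) = B , bB , (λ p → s (B⊆ p)) , r
      Heap : List V → ℕ → Set
      Heap J k = All (_∈ X) J × length J ≤ k
      link : ∀ {u v} → HAdj u v → ∃ λ B → Heap B ℓ × Link B u v
      link {u} {v} (inj₁ (uv , n)) with mountain m (Back u v)
      ... | inj₁ c = contradiction c n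
      ... | inj₂ (B , B⊆ , le , bB) = B , (mapᴬ proj₂ B⊆ , le) , B , bB , id , inj₁ (uv , mapᴬ proj₁ B⊆)
      link {u} {v} (inj₂ (vu , n)) with mountain m (Back v u)
      ... | inj₁ c = contradiction c n
      ... | inj₂ (B , B⊆ , le , bB) = B , (mapᴬ proj₂ B⊆ , le) , B , bB , id , inj₂ (vu , mapᴬ proj₁ B⊆)
      joinᴴ : ∀ {J J′ k k′} → Heap J k → Heap J′ k′ → Heap (J ++ J′) (k + k′)
      joinᴴ {J} (a , l) (b , l′) = All-++⁺ a b , ≤-trans (≤-reflexive (length-++ J)) (+-mono-≤ l l′)
      star : ∀ u vs → All (HAdj u) vs → ∃ λ J → Heap J (length vs * ℓ) × All (Link J u) vs
      star u [] [] = [] , ([] , z≤n) , []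
      star u (v ∷ vs) (h ∷ hs) with B , hB , lB ← link h | J , hJ , lJ ← star u vs hs =
        B ++ J , joinᴴ hB hJ , grow ∈-++⁺ˡ lB ∷ mapᴬ (grow (∈-++⁺ʳ B)) lJ
      web : ∀ vs → AllPairs HAdj vs → ∃ λ J → Heap J (links ℓ (length vs)) × AllPairs (Link J) vs
      web [] [] = [] , ([] , z≤n) , []
      web (v ∷ vs) (h ∷ hs) with B , hB , lB ← star v vs h | J , hJ , lJ ← web vs hs =
        B ++ J , joinᴴ hB hJ , mapᴬ (grow ∈-++⁺ˡ) lB ∷ mapᴾ (grow (∈-++⁺ʳ B)) lJ
      J = proj₁ (web ws prs)
      J⊆ = proj₁ (proj₁ (proj₂ (web ws prs)))
      J≤ = proj₂ (proj₁ (proj₂ (web ws prs)))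
      twins : ∀ (κ : V → ℕ) γ us → AllPairs (Link J) us → All (λ u → κ u ≡ γ × u ∈ₗ ws) us → 1 < length us →
        ∃₂ λ u v → Link J u v × (κ u ≡ γ × u ∈ₗ ws) × (κ v ≡ γ × v ∈ₗ ws)
      twins κ γ (u ∷ v ∷ _) ((l ∷ _) ∷ _) (a ∷ b ∷ _) _ = u , v , l , a , b
      twins κ γ (u ∷ []) _ _ (s≤s ())
      -- Two of the m + 2 vertices of ws get the same colour, and the bad list between them
      -- either contains a triangle or uses that colour.
      bad : Bad (suc m) (ws ++ J)
      bad κ κ< with γ , γ< , lt ← pigeonᴸ κ ws (suc m) 1 (λ p → κ< (∈-++⁺ˡ p))
                     (≤-reflexive (trans (cong suc (*-identityʳ (suc m))) (sym len)))
        with twins κ γ (filter (λ x → κ x ≟ℕ γ) ws) (AllPairs-filter⁺ (λ x → κ x ≟ℕ γ) (proj₂ (proj₂ (web ws prs))))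
               (tabulateᴬ (λ p → let q , e = ∈-filter⁻ (λ x → κ x ≟ℕ γ) {xs = ws} p in e , q)) lt
      ... | u , v , (B , bB , B⊆ , r) , (eu , u∈) , (ev , v∈)
        with bad-all-colours bB κ γ (λ p → κ< (∈-++⁺ʳ ws (B⊆ p))) γ<
      ... | inj₁ t = tri-⊆ (λ p → ∈-++⁺ʳ ws (B⊆ p)) t
      ... | inj₂ (b , b∈ , eb) with r
      ...   | inj₁ (uv , bs) = tri (∈-++⁺ˡ u∈) (∈-++⁺ˡ v∈) (∈-++⁺ʳ ws (B⊆ b∈)) uv (proj₁ (lookupᴬ bs b∈))
                (proj₂ (lookupᴬ bs b∈)) (trans eu (sym ev)) (trans ev (sym eb))
      ...   | inj₂ (vu , bs) = tri (∈-++⁺ˡ v∈) (∈-++⁺ˡ u∈) (∈-++⁺ʳ ws (B⊆ b∈)) vu (proj₁ (lookupᴬ bs b∈))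
                (proj₂ (lookupᴬ bs b∈)) (trans ev (sym eu)) (trans eu (sym eb))

    M ℓM : ℕ
    M = c₁ + (c₂ + c₀)
    ℓM = mtℓ M

    -- If `J` had no copy of H₁ among the in-neighbours of `v` and none of H₂ among its
    -- out-neighbours, then `c₁ + (c₂ + c₀)` colours would do for `J`, and `M` is this sum. Vertices
    -- assigned the same copy lie in one `From` or `To` set, and `J` has boundedly many copies.
    covered : ∀ {J} → Bad M J → length J ≤ ℓM → Col full (tuples h₁ ℓM c₂ + tuples h₂ ℓM c₁)
    covered {J} bJ le = col-∪ A {Z = full ∖ A} (λ p q → p , q)
      (col-fibres h₁ J le A S′ (λ {x} → bdA x) fibA) (col-fibres h₂ J le (full ∖ A) S′ (λ {x} → bdB x) fibB)
      where
      R₁ R₂ : V → Set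
      R₁ v = ∃ λ L → All (_∈ (In v ∩ list J)) L × length L ≤ h₁ × C₁ L
      R₂ v = ∃ λ L → All (_∈ (Out v ∩ list J)) L × length L ≤ h₂ × C₂ L
      pick : ∀ v → R₁ v ⊎ R₂ v
      pick v with has₁ (In v ∩ list J) | has₂ (Out v ∩ list J)
      ... | inj₂ r | _ = inj₁ r
      ... | inj₁ _ | inj₂ r = inj₂ r
      ... | inj₁ a | inj₁ b = contradiction
          (col-∪ (In v ∩ list J) {Z = (Out v ∩ list J) ∪ᴺ v} rest a
            (col-∪ (Out v ∩ list J) {Z = Non v} rest′ b (non v))) (bad-not-col {X = list J} bJ id)
        where
        _∪ᴺ_ : Sub (size D) → V → Sub (size D)
        X ∪ᴺ v = sub (λ x → x ∈ X ⊎ v o x) (λ x → (x ∈? X) ⊎-dec (v o? x))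
        rest : ∀ {x} → x ∈ list J → x ∉ (In v ∩ list J) → x ∈ ((Out v ∩ list J) ∪ᴺ v)
        rest {x} p n with adj? v x
        ... | inj₁ q = inj₁ (q , p)
        ... | inj₂ (inj₁ q) = contradiction (q , p) n
        ... | inj₂ (inj₂ q) = inj₂ q
        rest′ : ∀ {x} → x ∈ ((Out v ∩ list J) ∪ᴺ v) → x ∉ (Out v ∩ list J) → x ∈ Non v
        rest′ (inj₁ p) n = contradiction p n
        rest′ (inj₂ p) n = p
      left : ∀ {v} → R₁ v ⊎ R₂ v → Bool
      left (inj₁ _) = true
      left (inj₂ _) = false
      lst : ∀ {v} → R₁ v ⊎ R₂ v → List V
      lst (inj₁ r) = proj₁ r
      lst (inj₂ r) = proj₁ r
      A : Sub (size D)
      A = sub (λ v → left (pick v) ≡ true) (λ v → left (pick v) ≟B true)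
      S′ : V → List V
      S′ v = lst (pick v)
      bdA : ∀ x → x ∈ A → All (_∈ₗ J) (S′ x) × length (S′ x) ≤ h₁
      bdA x p with pick x
      ... | inj₁ (_ , a , l , _) = mapᴬ proj₂ a , l
      bdB : ∀ x → x ∈ (full ∖ A) → All (_∈ₗ J) (S′ x) × length (S′ x) ≤ h₂
      bdB x (_ , n) with pick x
      ... | inj₁ _ = contradiction refl n
      ... | inj₂ (_ , a , l , _) = mapᴬ proj₂ a , l
      goodA : ∀ {L} x → x ∈ Fibre A S′ L → C₁ L × All (_⟶ x) L
      goodA x (p , refl) with pick x
      ... | inj₁ (_ , a , _ , c) = c , mapᴬ proj₁ a
      goodB : ∀ {L} x → x ∈ Fibre (full ∖ A) S′ L → C₂ L × All (x ⟶_) L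
      goodB x ((_ , n) , refl) with pick x
      ... | inj₁ _ = contradiction refl n
      ... | inj₂ (_ , a , _ , c) = c , mapᴬ proj₁ a
      fibA : ∀ L → Col (Fibre A S′ L) c₂
      fibA L with any? (_∈? Fibre A S′ L)
      ... | no n = col-∅ (λ p → n (_ , p))
      ... | yes (x , p) = col-⊆ {Y = From L full} (λ q → tt , proj₂ (goodA _ q)) (From-col full (proj₁ (goodA x p)))
      fibB : ∀ L → Col (Fibre (full ∖ A) S′ L) c₁
      fibB L with any? (_∈? Fibre (full ∖ A) S′ L)
      ... | no n = col-∅ (λ p → n (_ , p))
      ... | yes (x , p) = col-⊆ {Y = To L full} (λ q → tt , proj₂ (goodB _ q)) (To-col full (proj₁ (goodB x p)))

  arrow : ∃ λ c → ∀ {D} → Setting c₀ c₁ c₂ h₁ h₂ D → Dig.Col D full c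
  arrow = mtK (c₁ + (c₂ + c₀)) + (tuples h₁ (mtℓ (c₁ + (c₂ + c₀))) c₂ + tuples h₂ (mtℓ (c₁ + (c₂ + c₀))) c₁) , λ {D} → go
    where
    go : ∀ {D} → Setting c₀ c₁ c₂ h₁ h₂ D → Dig.Col D full _
    go {D} S with mountain S (c₁ + (c₂ + c₀)) full
    ... | inj₁ c = Dig.col-≤ D (m≤m+n _ _) c
    ... | inj₂ (J , _ , le , bJ) = Dig.col-≤ D (m≤n+m _ (mtK (c₁ + (c₂ + c₀)))) (covered S bJ le)

-- Domination

-- The choice depends on `i` alone and not on the proof of membership, so an index reached through
-- different proofs keeps its witness.
choose : ∀ {i b p} {I : Set i} {B : Set b} {P : I → B → Set p} → DecidableEquality I → B → ∀ is →
  (∀ {i} → i ∈ₗ is → ∃ (P i)) → ∃ λ (f : I → B) → ∀ {i} → i ∈ₗ is → P i (f i)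
choose _≟_ b₀ [] h = (λ _ → b₀) , λ ()
choose {I = I} {B} {P} _≟_ b₀ (i ∷ is) h with f , pf ← choose {P = P} _≟_ b₀ is (h ∘ there) = g , pg
  where
  g : I → B
  g j with j ≟ i
  ... | yes _ = proj₁ (h (here refl))
  ... | no _ = f j
  pg : ∀ {j} → j ∈ₗ (i ∷ is) → P j (g j)
  pg {j} j∈ with j ≟ i
  ... | yes refl = proj₂ (h (here refl))
  pg (here e) | no ne = contradiction e ne
  pg (there j∈) | no ne = pf j∈

module Exclude {i} {I : Set i} (_≟_ : DecidableEquality I) where

  excl : List I → List I → List I
  excl [] is = is
  excl (e ∷ ex) is = excl ex (filter (λ i → ¬? (i ≟ e)) is)

  excl-∈ : ∀ ex {is x} → x ∈ₗ excl ex is → x ∈ₗ is × x ∉ₗ ex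
  excl-∈ [] p = p , λ ()
  excl-∈ (e ∷ ex) {is} p with q , n ← excl-∈ ex p with r , ne ← ∈-filter⁻ (λ i → ¬? (i ≟ e)) {xs = is} q =
    r , λ { (here x≡e) → ne x≡e ; (there x∈) → n x∈ }

  excl-unique : ∀ ex {is} → Unique is → Unique (excl ex is)
  excl-unique [] u = u
  excl-unique (e ∷ ex) u = excl-unique ex (Unique-filter⁺ (λ i → ¬? (i ≟ e)) u)

  remove-length : ∀ e {is} → Unique is → length is ≤ suc (length (filter (λ i → ¬? (i ≟ e)) is))
  remove-length e [] = z≤n
  remove-length e {i ∷ is} (n ∷ u) with i ≟ e
  ... | yes refl = s≤s (≤-reflexive (sym (cong length (filter-all (λ i → ¬? (i ≟ e)) (mapᴬ (_∘ sym) n)))))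
  ... | no _ = s≤s (remove-length e u)

  excl-length : ∀ ex {is} → Unique is → length is ≤ length ex + length (excl ex is)
  excl-length [] u = ≤-refl
  excl-length (e ∷ ex) u = ≤-trans (remove-length e u) (s≤s (excl-length ex (Unique-filter⁺ (λ i → ¬? (i ≟ e)) u)))

-- This is `ℓ * c ^ n`: a list of length `ℓ` for each colouring of `n` vertices with `c` colours.
choices : (c ℓ n : ℕ) → ℕ
choices c ℓ zero = ℓ
choices c ℓ (suc n) = c * choices c ℓ n

length-concatMap : ∀ {a b} {A : Set a} {B : Set b} (f : A → List B) {w} xs →
  (∀ {x} → x ∈ₗ xs → length (f x) ≡ w) → length (concatMap f xs) ≡ length xs * w
length-concatMap f [] h = refl
length-concatMap f (x ∷ xs) h = trans (length-++ (f x)) (cong₂ _+_ (h (here refl)) (length-concatMap f xs (h ∘ there)))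

∈-concatMap : ∀ {a b} {A : Set a} {B : Set b} (f : A → List B) {x y} xs →
  x ∈ₗ xs → y ∈ₗ f x → y ∈ₗ concatMap f xs
∈-concatMap f (x ∷ xs) (here refl) q = ∈-++⁺ˡ q
∈-concatMap f (x ∷ xs) (there p) q = ∈-++⁺ʳ (f x) (∈-concatMap f xs p q)

All-concatMap : ∀ {a b p} {A : Set a} {B : Set b} {P : B → Set p} (f : A → List B) xs →
  (∀ {x} → x ∈ₗ xs → All P (f x)) → All P (concatMap f xs)
All-concatMap f [] h = []
All-concatMap f (x ∷ xs) h = All-++⁺ (h (here refl)) (All-concatMap f xs (h ∘ there))

∈-take : ∀ {a} {A : Set a} n {xs : List A} {x} → x ∈ₗ take n xs → x ∈ₗ xs
∈-take (suc n) {_ ∷ _} (here e) = here e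
∈-take (suc n) {_ ∷ _} (there p) = there (∈-take n p)

module Choices (D : Digraph) (Z : Sub (size D)) where
  open Dig D

  upd : (V → ℕ) → V → ℕ → V → ℕ
  upd κ w γ x with x ≟F w
  ... | yes _ = γ
  ... | no _ = κ x

  upd-self : ∀ κ w x → upd κ w (κ w) x ≡ κ x
  upd-self κ w x with x ≟F w
  ... | yes refl = refl
  ... | no _ = refl

  upd-cong : ∀ {κ κ′} w γ x → (x ≢ w → κ x ≡ κ′ x) → upd κ w γ x ≡ upd κ′ w γ x
  upd-cong w γ x h with x ≟F w
  ... | yes _ = refl
  ... | no ne = h ne

  -- By `inv` only the restriction of `κ` to `W` matters, so finitely many colourings represent all,
  -- and their lists are concatenated. `upto` runs over the colour of the first vertex, which `upd`
  -- prescribes.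
  collect : ∀ c ℓ (W : List V) (P : (V → ℕ) → List V → Set) →
    (∀ {κ κ′ B} → (∀ {w} → w ∈ₗ W → κ w ≡ κ′ w) → P κ B → P κ′ B) →
    (∀ κ → (∀ {w} → w ∈ₗ W → κ w < c) → ∃ λ B → All (_∈ Z) B × length B ≤ ℓ × P κ B) →
    ∃ λ J → All (_∈ Z) J × length J ≤ choices c ℓ (length W) ×
      (∀ κ → (∀ {w} → w ∈ₗ W → κ w < c) → ∃ λ B → (∀ {b} → b ∈ₗ B → b ∈ₗ J) × P κ B)
  collect c ℓ [] P inv h with B , B⊆ , le , p ← h (λ _ → 0) (λ ()) =
    B , B⊆ , le , λ κ _ → B , id , inv (λ ()) p
  collect c ℓ (w ∷ W) P inv h =
    let J , J⊆ , le , p = upto c ≤-refl in J , J⊆ , le , λ κ lt →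
      let B , B⊆ , q = p κ (κ w) (lt (here refl)) (lt ∘ there) in B , B⊆ , inv (λ {x} _ → upd-self κ w x) q
    where
    upto : ∀ c′ → c′ ≤ c → ∃ λ J → All (_∈ Z) J × length J ≤ c′ * choices c ℓ (length W) ×
      (∀ κ γ → γ < c′ → (∀ {w} → w ∈ₗ W → κ w < c) → ∃ λ B → (∀ {b} → b ∈ₗ B → b ∈ₗ J) × P (upd κ w γ) B)
    upto zero _ = [] , [] , z≤n , λ κ γ ()
    upto (suc γ₀) lt =
      J′ ++ J , All-++⁺ J′⊆ J⊆ , ≤-trans (≤-reflexive (length-++ J′)) (+-mono-≤ le′ le) , all
      where
      upd-here : ∀ {κ κ′} → (∀ {x} → x ∈ₗ W → κ x ≡ κ′ x) → upd κ w γ₀ w ≡ upd κ′ w γ₀ w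
      upd-here {κ} {κ′} e = upd-cong {κ} {κ′} w γ₀ w (λ ne → contradiction refl ne)
      small : ∀ κ → (∀ {x} → x ∈ₗ W → κ x < c) → ∀ {x} → x ∈ₗ (w ∷ W) → upd κ w γ₀ x < c
      small κ κ< {x} q with x ≟F w
      ... | yes _ = lt
      small κ κ< (here e) | no ne = contradiction e ne
      small κ κ< (there q) | no ne = κ< q
      rest = upto γ₀ (<⇒≤ lt)
      new = collect c ℓ W (λ κ B → P (upd κ w γ₀) B)
        (λ {κ} {κ′} e → inv (λ { (here refl) → upd-here {κ} {κ′} e ; {x} (there q) → upd-cong {κ} {κ′} w γ₀ x (λ _ → e q) }))
        (λ κ κ< → h (upd κ w γ₀) (small κ κ<))
      J = proj₁ rest
      J⊆ = proj₁ (proj₂ rest)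
      le = proj₁ (proj₂ (proj₂ rest))
      p = proj₂ (proj₂ (proj₂ rest))
      J′ = proj₁ new
      J′⊆ = proj₁ (proj₂ new)
      le′ = proj₁ (proj₂ (proj₂ new))
      p′ = proj₂ (proj₂ (proj₂ new))
      all : ∀ κ γ → γ < suc γ₀ → (∀ {x} → x ∈ₗ W → κ x < c) →
        ∃ λ B → (∀ {b} → b ∈ₗ B → b ∈ₗ (J′ ++ J)) × P (upd κ w γ) B
      all κ γ γ< κ< with γ ≟ℕ γ₀
      ... | yes refl = let B , s , q = p′ κ κ< in B , (λ r → ∈-++⁺ˡ (s r)) , q
      ... | no ne = let B , s , q = p κ γ (≤∧≢⇒< (≤-pred γ<) ne) κ< in B , (λ r → ∈-++⁺ʳ J′ (s r)) , q

module Domination (D : Digraph) where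
  open Dig D
  open Splitting D

  -- A substitute for adjacency of `a` to all of `Y`. Speaking of every subset `Q`, dominated from
  -- within itself, makes the condition pass to smaller `Y` and usable in any ambient set that
  -- contains `Q`.
  Sparse : ℕ → V → Sub (size D) → Set₁
  Sparse e a Y = ∀ Q → (∀ {x} → x ∈ Q → a o x) → (∀ {x} → x ∈ Q → x ∈ Y) → Null Q e Q

  Cross : ℕ → Sub (size D) → Sub (size D) → Set₁
  Cross e X Y = ∀ {a} → a ∈ X → Sparse e a Y

  sparse-⊆ : ∀ {e a Y Y′} → (∀ {x} → x ∈ Y′ → x ∈ Y) → Sparse e a Y → Sparse e a Y′
  sparse-⊆ s c Q n q = c Q n (s ∘ q)

  null-∪ : ∀ {Z a b X} A {B} → Null Z a A → Null Z b B → (∀ {x} → x ∈ X → x ∈ A ⊎ x ∈ B) → Null Z (a + b) X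
  null-∪ A {B} (null S s l d) (null T t k f) cov = null (S ++ T) (All-++⁺ s t)
    (≤-trans (≤-reflexive (length-++ S)) (+-mono-≤ l k)) (λ p → go (cov p))
    where
    go : ∀ {x} → x ∈ A ⊎ x ∈ B → Any (_▷ x) (S ++ T)
    go (inj₁ p) = Any-++⁺ˡ (d p)
    go (inj₂ p) = Any-++⁺ʳ S (f p)

  -- Each `l` costs `suc e` vertices: `l` dominates itself and its out-neighbours, and `e` vertices
  -- dominate its non-neighbours. What remains points to `l`.
  prune : ∀ {Z e K} L X → (∀ {x} → x ∈ X → x ∈ Z) → All (_∈ Z) L → (∀ {l} → l ∈ₗ L → Sparse e l X) →
    Null Z K (To L X) → Null Z (length L * suc e + K) X
  prune {Z} [] X X⊆ _ _ n = null-mono {Z = Z} id ≤-refl (λ p → p , []) n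
  prune {Z} {e} {K} (l ∷ L) X X⊆ (l∈ ∷ L⊆) sp n =
    null-≤ (≤-reflexive (sym (+-assoc (suc e) (length L * suc e) K)))
      (null-∪ (X ∖ (X ∩ In l)) {X ∩ In l} (null-∪ (Out′ l) {X ∩ Non l} (null (l ∷ []) (l∈ ∷ []) ≤-refl here)
          (null-mono (λ p → X⊆ (proj₁ p)) ≤-refl id (sp (here refl) (X ∩ Non l) proj₂ proj₁)) near)
        (prune L (X ∩ In l) (X⊆ ∘ proj₁) L⊆ (λ q → sparse-⊆ {Y = X} {X ∩ In l} proj₁ (sp (there q)))
          (null-mono id ≤-refl (λ { ((a , b) , c) → a , b ∷ c }) n))
        far)
    where
    Out′ : V → Sub (size D)
    Out′ l = sub (l ▷_) (l ▷?_)
    near : ∀ {x} → x ∈ (X ∖ (X ∩ In l)) → (l ▷ x) ⊎ x ∈ (X ∩ Non l)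
    near {x} (p , q) with adj? l x
    ... | inj₁ r = inj₁ (inj₂ r)
    ... | inj₂ (inj₁ r) = contradiction (p , r) q
    ... | inj₂ (inj₂ r) = inj₂ (p , r)
    far : ∀ {x} → x ∈ X → x ∈ (X ∖ (X ∩ In l)) ⊎ x ∈ (X ∩ In l)
    far {x} p with x ⟶? l
    ... | yes q = inj₂ (p , q)
    ... | no q = inj₁ (p , q ∘ proj₂)

  -- `S` has at most `suc K′` vertices where `K′` do not suffice, so an exchange that saves a single
  -- vertex is already a contradiction.
  record Minimal (Z X : Sub (size D)) (K : ℕ) (S : List V) : Set where
    field
      K′ : ℕ
      K≤ : K ≤ K′
      ¬null : ¬ Null Z K′ X
      S≤ : length S ≤ suc K′
      S⊆ : All (_∈ Z) S
      covers : ∀ {x} → x ∈ X → Any (_▷ x) S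
    long : K < length S
    long with K <? length S
    ... | yes lt = lt
    ... | no n = contradiction (null S S⊆ (≤-trans (≮⇒≥ n) K≤) covers) ¬null

  minimal : ∀ {Z X K} → (∀ {x} → x ∈ X → x ∈ Z) → ¬ Null Z K X → ∃ (Minimal Z X K)
  minimal {Z} {X} {K} X⊆ ¬n = go _ (null all-X (tabulateᴬ (λ p → X⊆ (proj₂ (∈-filter⁻ (_∈? X) {xs = allFin _} p)))) ≤-refl
      (λ p → lose (∈-filter⁺ (_∈? X) (∈-allFin _) p) (inj₁ refl)))
    where
    all-X : List V
    all-X = filter (_∈? X) (allFin (size D))
    go : ∀ N → Null Z N X → ∃ (Minimal Z X K)
    go zero n = contradiction (null-mono id z≤n id n) ¬n
    go (suc N) n with null? Z N X
    ... | yes n′ = go N n′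
    ... | no ¬n′ = dom n , record { K′ = N ; K≤ = K≤ ; ¬null = ¬n′ ; S≤ = dom≤ n ; S⊆ = dom⊆ n ; covers = dominated n }
      where
      K≤ : K ≤ N
      K≤ with K ≤? N
      ... | yes p = p
      ... | no p = contradiction (null-mono id (≰⇒> p) id n) ¬n

-- Families of pairwise crossing sets

-- `richS` pays for pruning against a `Bad m` list with `richK e m` to spare. Among `richW` vertices
-- more than `richS` share one of `suc m` colours; among `richN` indices more than `richT e m` share
-- their popular colour. At `suc m`, `richT` reserves `richN` indices, one more for each of the
-- `richN * richW` chosen vertices, and `richT e m` others.
richK richT richL : (e m : ℕ) → ℕ
richS richW richN : (e m : ℕ) → ℕ
richS e m = richL e m * suc e + richK e m
richW e m = suc (suc m * richS e m)
richN e m = suc (suc m * richT e m)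
richK e zero = 0
richK e (suc m) = richW e m + (richN e m * richW e m * suc e + richK e m)
richT e zero = 1
richT e (suc m) = richN e m + (richN e m * richW e m + richT e m)
richL e zero = 1
richL e (suc m) = richN e m * richW e m + (richL e m + choices (suc m) (richL e m) (richN e m * richW e m))

module Rich (D : Digraph) (e : ℕ) where
  open Dig D
  open Splitting D
  open Domination D

  ⋃ : ∀ {I : Set} → (I → Sub (size D)) → List I → Sub (size D)
  ⋃ X is = sub (λ x → Any (λ i → x ∈ X i) is) (λ x → anyᴬ? (λ i → x ∈? X i) is)

  ⋃-mono : ∀ {I : Set} (X′ X : I → Sub (size D)) {is′ is} → (∀ {i} → i ∈ₗ is′ → i ∈ₗ is) →
    (∀ {i x} → x ∈ X′ i → x ∈ X i) → ∀ {x} → x ∈ ⋃ X′ is′ → x ∈ ⋃ X is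
  ⋃-mono X′ X s t p = let i , i∈ , q = find p in lose (s i∈) (t q)

  Crossing : ∀ {I : Set} → (I → Sub (size D)) → List I → Set₁
  Crossing X is = ∀ {i j} → i ∈ₗ is → j ∈ₗ is → i ≢ j → Cross e (X i) (X j)

  HasBad : Sub (size D) → ℕ → ℕ → Set
  HasBad Z ℓ m = ∃ λ J → All (_∈ Z) J × length J ≤ ℓ × Bad m J

  -- Sets are indexed, so one set may be repeated, as in `alpha`. Domination is measured from the
  -- union, which shrinks along sub-families, so hardness is inherited by them.
  RichFor : ℕ → Set₁
  RichFor m = ∀ {I : Set} (_≟_ : DecidableEquality I) (X : I → Sub (size D)) (is : List I) → Unique is →
    richT e m ≤ length is → Crossing X is → (∀ {i} → i ∈ₗ is → ¬ Null (⋃ X is) (richK e m) (X i)) →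
    HasBad (⋃ X is) (richL e m) m

  -- `Ws` collects initial parts `W i` of smallest dominating sets `S i`, and `A` is a `Bad m` list
  -- pointing to all of `Ws`. Given a colouring of `Ws`, a `Bad m` list `B` pointing to all of `A`
  -- is found among vertices that, within their `S i`, only vertices of a popular colour `γ` in
  -- `W i` dominate. Both `A` and `B` must then use `γ` or contain a monochromatic triangle.
  module Step (m : ℕ) (rich : RichFor m) {I : Set} (_≟_ : DecidableEquality I) (X : I → Sub (size D))
    (is : List I) (uniq : Unique is) (many : richT e (suc m) ≤ length is) (cross : Crossing X is)
    (big : ∀ {i} → i ∈ₗ is → ¬ Null (⋃ X is) (richK e (suc m)) (X i)) where

    open Exclude _≟_
    k t ℓ s w n : ℕ
    k = richK e m
    t = richT e m
    ℓ = richL e m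
    s = richS e m
    w = richW e m
    n = richN e m

    Z : Sub (size D)
    Z = ⋃ X is

    X⊆Z : ∀ {i x} → i ∈ₗ is → x ∈ X i → x ∈ Z
    X⊆Z p q = lose p q

    ts : List I
    ts = take n is

    ts-length : length ts ≡ n
    ts-length = trans (length-take n is) (m≤n⇒m⊓n≡m (≤-trans (m≤m+n n _) many))

    ts⊆ : ∀ {i} → i ∈ₗ ts → i ∈ₗ is
    ts⊆ = ∈-take n

    abstract
     min-dom : ∃ λ (S : I → List V) → ∀ {i} → i ∈ₗ ts → Minimal Z (X i) (richK e (suc m)) (S i)
     min-dom = choose {P = λ i S → Minimal Z (X i) (richK e (suc m)) S} _≟_ [] ts
       (λ p → minimal (X⊆Z (ts⊆ p)) (big (ts⊆ p)))

    S W R : I → List V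
    S = proj₁ min-dom
    W i = take w (S i)
    R i = drop w (S i)

    min : ∀ {i} → i ∈ₗ ts → Minimal Z (X i) (richK e (suc m)) (S i)
    min = proj₂ min-dom

    W-length : ∀ {i} → i ∈ₗ ts → length (W i) ≡ w
    W-length {i} p = trans (length-take w (S i))
      (m≤n⇒m⊓n≡m (≤-trans (m≤m+n w _) (<⇒≤ (Minimal.long (min p)))))

    Ws : List V
    Ws = concatMap W ts

    Ws-length : length Ws ≡ n * w
    Ws-length = trans (length-concatMap W ts W-length) (cong (_* w) ts-length)

    Ws⊆Z : All (_∈ Z) Ws
    Ws⊆Z = All-concatMap W ts (λ p → All-take⁺ w (Minimal.S⊆ (min p)))

    parts : ∀ {L} → All (_∈ Z) L → ∃ λ (ps : List I) → length ps ≡ length L ×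
      (∀ {l} → l ∈ₗ L → ∃ λ p → p ∈ₗ ps × p ∈ₗ is × l ∈ X p)
    parts [] = [] , refl , λ ()
    parts (z ∷ zs) with i , i∈ , zi ← find z | ps , len , h ← parts zs =
      i ∷ ps , cong suc len , λ { (here refl) → i , here refl , i∈ , zi
                                ; (there q) → let p , a , b = h q in p , there a , b }

    abstract
     parts-Ws : ∃ λ (ps : List I) → length ps ≡ length Ws ×
       (∀ {l} → l ∈ₗ Ws → ∃ λ p → p ∈ₗ ps × p ∈ₗ is × l ∈ X p)
     parts-Ws = parts Ws⊆Z

    ps : List I
    ps = proj₁ parts-Ws

    -- `Crossing` speaks of different indices only. The vertices of `Ws` may come from any set of
    -- the family, so the indices of their home sets are excluded as well.
    others : List I
    others = excl (ts ++ ps) is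

    other∈ : ∀ {i} → i ∈ₗ others → i ∈ₗ is
    other∈ p = proj₁ (excl-∈ (ts ++ ps) p)

    other≢ts : ∀ {i j} → i ∈ₗ others → j ∈ₗ ts → i ≢ j
    other≢ts p q refl = proj₂ (excl-∈ (ts ++ ps) p) (∈-++⁺ˡ q)

    other≢ps : ∀ {i j} → i ∈ₗ others → j ∈ₗ ps → j ≢ i
    other≢ps p q refl = proj₂ (excl-∈ (ts ++ ps) p) (∈-++⁺ʳ ts q)

    others-many : t ≤ length others
    others-many = +-cancelˡ-≤ (n + n * w) _ _ (begin
      n + n * w + t                  ≡⟨ +-assoc n (n * w) t ⟩
      n + (n * w + t)                ≤⟨ many ⟩
      length is                      ≤⟨ excl-length (ts ++ ps) uniq ⟩
      length (ts ++ ps) + length others ≡⟨ cong (_+ length others) (trans (length-++ ts)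
        (cong₂ _+_ ts-length (trans (proj₁ (proj₂ parts-Ws)) Ws-length))) ⟩
      n + n * w + length others ∎)
      where open ≤-Reasoning

    Y : I → Sub (size D)
    Y i = To Ws (X i)

    abstract
     A-all : HasBad (⋃ Y others) ℓ m
     A-all = rich _≟_ Y others (excl-unique (ts ++ ps) uniq) others-many
       (λ p q ne a → sparse-⊆ {Y = X _} {Y _} proj₁ (cross (other∈ p) (other∈ q) ne (proj₁ a)))
       (λ p nl → big (other∈ p) (null-≤ (≤-trans (≤-reflexive (cong (λ z → z * suc e + k) Ws-length)) (m≤n+m _ w))
         (prune Ws (X _) (X⊆Z (other∈ p)) Ws⊆Z
           (λ q → let j , j∈ , j∈is , lj = proj₂ (proj₂ parts-Ws) q in cross j∈is (other∈ p) (other≢ps p j∈) lj)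
           (null-mono {X′ = Y _} (⋃-mono Y X other∈ proj₁) ≤-refl id nl))))

    A : List V
    A = proj₁ A-all

    A-home : ∀ {a} → a ∈ₗ A → ∃ λ q → q ∈ₗ others × a ∈ X q × All (a ⟶_) Ws
    A-home p with q , q∈ , a , b ← find (lookupᴬ (proj₁ (proj₂ A-all)) p) = q , q∈ , a , b

    A≤ : length A ≤ ℓ
    A≤ = proj₁ (proj₂ (proj₂ A-all))

    A-bad : Bad m A
    A-bad = proj₂ (proj₂ (proj₂ A-all))

    A⊆Z : All (_∈ Z) A
    A⊆Z = tabulateᴬ (λ p → let q , q∈ , a , _ = A-home p in X⊆Z (other∈ q∈) a)

    P : (V → ℕ) → List V → Set
    P κ B = Bad m B × ∃ λ γ → γ < suc m × (∀ {b} → b ∈ₗ B → All (b ⟶_) A × ∃ λ x → x ∈ₗ Ws × κ x ≡ γ × x ▷ b)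

    module _ (κ : V → ℕ) (κ< : ∀ {x} → x ∈ₗ Ws → κ x < suc m) where

      abstract
       popular : ∃ λ (pop : I → ℕ) → ∀ {i} → i ∈ₗ ts → pop i < suc m × s < length (filter (λ x → κ x ≟ℕ pop i) (W i))
       popular = choose {P = λ i γ → γ < suc m × s < length (filter (λ x → κ x ≟ℕ γ) (W i))} _≟_ 0 ts
         (λ {i} p → pigeonᴸ κ (W i) (suc m) s (λ q → κ< (∈-concatMap W ts p q)) (≤-reflexive (sym (W-length p))))

      pop : I → ℕ
      pop = proj₁ popular

      abstract
       winner : ∃ λ γ → γ < suc m × t < length (filter (λ i → pop i ≟ℕ γ) ts)
       winner = pigeonᴸ pop ts (suc m) t (λ p → proj₁ (proj₂ popular p)) (≤-reflexive (sym ts-length))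

      γ : ℕ
      γ = proj₁ winner

      js : List I
      js = filter (λ i → pop i ≟ℕ γ) ts

      js∈ : ∀ {i} → i ∈ₗ js → i ∈ₗ ts × pop i ≡ γ
      js∈ = ∈-filter⁻ (λ i → pop i ≟ℕ γ) {xs = ts}

      E : I → List V
      E i = R i ++ filter (λ x → ¬? (κ x ≟ℕ γ)) (W i)

      Rest U : I → Sub (size D)
      Rest i = X i ∖ sub (λ x → Any (_▷ x) (E i)) (λ x → anyᴬ? (_▷? x) (E i))
      U i = To A (Rest i)

      E⊆Z : ∀ {i} → i ∈ₗ ts → All (_∈ Z) (E i)
      E⊆Z {i} p = All-++⁺ (All-drop⁺ w (Minimal.S⊆ (min p)))
        (tabulateᴬ (λ q → lookupᴬ (All-take⁺ w (Minimal.S⊆ (min p))) (proj₁ (∈-filter⁻ (λ x → ¬? (κ x ≟ℕ γ)) {xs = W i} q))))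

      E-short : ∀ {i} (p : i ∈ₗ js) → length (E i) + s ≤ Minimal.K′ (min (proj₁ (js∈ p)))
      E-short {i} p = ≤-pred (begin
        suc (length (E i) + s)             ≡⟨ sym (+-suc (length (E i)) s) ⟩
        length (E i) + suc s               ≤⟨ +-monoʳ-≤ (length (E i))
          (subst (λ g → s < length (filter (λ x → κ x ≟ℕ g) (W i))) (proj₂ (js∈ p)) (proj₂ (proj₂ popular i∈))) ⟩
        length (E i) + length W₌           ≡⟨ cong (_+ length W₌) (length-++ (R i)) ⟩
        length (R i) + length W≠ + length W₌ ≡⟨ +-assoc (length (R i)) _ _ ⟩
        length (R i) + (length W≠ + length W₌) ≡⟨ cong (length (R i) +_) (trans (+-comm (length W≠) _)
          (sym (filter-split (λ x → κ x ≟ℕ γ) (W i)))) ⟩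
        length (R i) + length (W i)        ≡⟨ trans (+-comm (length (R i)) _)
          (trans (sym (length-++ (W i))) (cong length (take++drop≡id w (S i)))) ⟩
        length (S i)                       ≤⟨ Minimal.S≤ (min i∈) ⟩
        suc (Minimal.K′ (min i∈)) ∎)
        where
        open ≤-Reasoning
        i∈ = proj₁ (js∈ p)
        W₌ = filter (λ x → κ x ≟ℕ γ) (W i)
        W≠ = filter (λ x → ¬? (κ x ≟ℕ γ)) (W i)

      -- `E i` lacks more than `s` vertices of `S i`, so `E i` and `s` further vertices are too few
      -- to dominate `X i`. The `s` vertices would cover the pruning against `A` and a dominating
      -- set of `U i` of size `k`.
      U-big : ∀ {i} → i ∈ₗ js → ¬ Null (⋃ U js) k (U i)
      U-big {i} p nl = Minimal.¬null (min i∈) (null-≤ count≤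
          (null-∪ Dominated {Rest i} (null (E i) (E⊆Z i∈) ≤-refl id) rest-null split))
        where
        i∈ = proj₁ (js∈ p)
        Dominated : Sub (size D)
        Dominated = sub (λ x → Any (_▷ x) (E i)) (λ x → anyᴬ? (_▷? x) (E i))
        rest-null : Null Z (length A * suc e + k) (Rest i)
        rest-null = prune A (Rest i) (X⊆Z (ts⊆ i∈) ∘ proj₁) A⊆Z
          (λ q → let j , j∈ , aj , _ = A-home q in
            sparse-⊆ {Y = X i} {Rest i} proj₁ (cross (other∈ j∈) (ts⊆ i∈) (other≢ts j∈ i∈) aj))
          (null-mono {Z = ⋃ U js} {Z} {X = U i} {U i} (⋃-mono U X (λ j∈ → ts⊆ (proj₁ (js∈ j∈))) (proj₁ ∘ proj₁)) ≤-refl id nl)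
        split : ∀ {x} → x ∈ X i → Any (_▷ x) (E i) ⊎ x ∈ Rest i
        split {x} q with x ∈? Dominated
        ... | yes d = inj₁ d
        ... | no d = inj₂ (q , d)
        count≤ : length (E i) + (length A * suc e + k) ≤ Minimal.K′ (min i∈)
        count≤ = ≤-trans (+-monoʳ-≤ (length (E i)) (+-monoˡ-≤ k (*-monoˡ-≤ (suc e) A≤))) (E-short p)

      abstract
       B-all : HasBad (⋃ U js) ℓ m
       B-all = rich _≟_ U js (Unique-filter⁺ (λ i → pop i ≟ℕ γ) (Unique-take⁺ n uniq)) (<⇒≤ (proj₂ (proj₂ winner)))
         (λ {i} {j} p q ne a → sparse-⊆ {Y = X j} {U j} (proj₁ ∘ proj₁)
           (cross (ts⊆ (proj₁ (js∈ p))) (ts⊆ (proj₁ (js∈ q))) ne (proj₁ (proj₁ a))))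
         U-big

      B-found : ∃ λ B → All (_∈ Z) B × length B ≤ ℓ × P κ B
      B-found = B , mapᴬ (⋃-mono U X (λ j∈ → ts⊆ (proj₁ (js∈ j∈))) (proj₁ ∘ proj₁)) B⊆ ,
          proj₁ (proj₂ (proj₂ B-all)) , proj₂ (proj₂ (proj₂ B-all)) , γ , proj₁ (proj₂ winner) , tie
        where
        B = proj₁ B-all
        B⊆ = proj₁ (proj₂ B-all)
        tie : ∀ {b} → b ∈ₗ B → All (b ⟶_) A × ∃ λ x → x ∈ₗ Ws × κ x ≡ γ × x ▷ b
        tie {b} p with i , i∈ , ((xi , undom) , toA) ← find (lookupᴬ B⊆ p)
          with Any-++⁻ (W i) (subst (Any (_▷ b)) (sym (take++drop≡id w (S i))) (Minimal.covers (min (proj₁ (js∈ i∈))) xi))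
        ... | inj₂ r = contradiction (Any-++⁺ˡ r) undom
        ... | inj₁ q with x , x∈ , xb ← find q with κ x ≟ℕ γ
        ...   | yes eq = toA , x , ∈-concatMap W ts (proj₁ (js∈ i∈)) x∈ , eq , xb
        ...   | no ne = contradiction (Any-++⁺ʳ (R i) (lose (∈-filter⁺ (λ x → ¬? (κ x ≟ℕ γ)) x∈ ne) xb)) undom

    abstract
     gathered : ∃ λ J → All (_∈ Z) J × length J ≤ choices (suc m) ℓ (length Ws) ×
       (∀ κ → (∀ {x} → x ∈ₗ Ws → κ x < suc m) → ∃ λ B → (∀ {b} → b ∈ₗ B → b ∈ₗ J) × P κ B)
     gathered = Choices.collect D Z (suc m) ℓ Ws P
       (λ { eq (bB , γ , γ< , h) → bB , γ , γ< , λ p → let a , x , x∈ , κx , r = h p in a , x , x∈ , trans (sym (eq x∈)) κx , r })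
       B-found

    G : List V
    G = proj₁ gathered

    result : HasBad Z (richL e (suc m)) (suc m)
    result = Ws ++ (A ++ G) , All-++⁺ Ws⊆Z (All-++⁺ A⊆Z (proj₁ (proj₂ gathered))) , short , bad
      where
      short : length (Ws ++ (A ++ G)) ≤ richL e (suc m)
      short = begin
        length (Ws ++ (A ++ G))            ≡⟨ trans (length-++ Ws) (cong (length Ws +_) (length-++ A)) ⟩
        length Ws + (length A + length G)  ≤⟨ +-mono-≤ (≤-reflexive Ws-length) (+-mono-≤ A≤
          (≤-trans (proj₁ (proj₂ (proj₂ gathered))) (≤-reflexive (cong (choices (suc m) ℓ) Ws-length)))) ⟩
        richL e (suc m) ∎
        where open ≤-Reasoning
      -- Triangles x → b → a → x, with x in Ws, b in G and a in A of the same colour.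
      bad : Bad (suc m) (Ws ++ (A ++ G))
      bad κ κ< with B , B⊆ , bB , γ , γ< , tie ← proj₂ (proj₂ (proj₂ gathered)) κ (λ p → κ< (∈-++⁺ˡ p))
        with bad-all-colours A-bad κ γ (λ p → κ< (∈-++⁺ʳ Ws (∈-++⁺ˡ p))) γ<
           | bad-all-colours bB κ γ (λ p → κ< (∈-++⁺ʳ Ws (∈-++⁺ʳ A (B⊆ p)))) γ<
      ... | inj₁ t | _ = tri-⊆ (λ p → ∈-++⁺ʳ Ws (∈-++⁺ˡ p)) t
      ... | inj₂ _ | inj₁ t = tri-⊆ (λ p → ∈-++⁺ʳ Ws (∈-++⁺ʳ A (B⊆ p))) t
      ... | inj₂ (a , a∈ , κa) | inj₂ (b , b∈ , κb) with toA , x , x∈ , κx , xb ← tie b∈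
        with _ , _ , _ , toW ← A-home a∈ | ba ← lookupᴬ toA a∈ with xb
      ...   | inj₁ refl = contradiction ba (asym (lookupᴬ toW x∈))
      ...   | inj₂ arc = tri (∈-++⁺ˡ x∈) (∈-++⁺ʳ Ws (∈-++⁺ʳ A (B⊆ b∈))) (∈-++⁺ʳ Ws (∈-++⁺ˡ a∈))
                arc ba (lookupᴬ toW x∈) (trans κx (sym κb)) (trans κb (sym κa))

  rich : ∀ m → RichFor m
  rich zero _≟_ X (i ∷ is) uniq many cross big with any? (_∈? X i)
  ... | yes (x , p) = x ∷ [] , here p ∷ [] , ≤-refl , λ κ lt → case lt (here refl) of λ ()
  ... | no n = contradiction (null [] [] z≤n (λ p → contradiction (_ , p) n)) (big (here refl))
  rich (suc m) _≟_ X is uniq many cross big = Step.result m (rich m) _≟_ X is uniq many cross big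

-- From local to global

alphaD alphaL : (M s : ℕ) → ℕ
alphaD M zero = 0
alphaD M (suc s) = richK (suc (alphaD M s)) M
alphaL M zero = 0
alphaL M (suc s) = alphaL M s ⊔ richL (suc (alphaD M s)) M

module Independence (D : Digraph) where
  open Dig D
  open Domination D

  Stable : List V → Set
  Stable = AllPairs (λ x y → x o y × x ≢ y)

  -- Induction on `s`: the non-neighbours of `a` in `X` have no stable set of size one less, hence
  -- are dominated by few, with one more vertex for `a` itself. So `X` crosses itself, and if it
  -- were hard to dominate, `rich` applied to a constant family would give a forbidden `Bad M` list.
  alpha : ∀ M s X → (∀ {L} → Stable L → All (_∈ X) L → length L ≡ s → ⊥) →
    (∀ {J} → All (_∈ X) J → length J ≤ alphaL M s → ¬ Bad M J) → Null X (alphaD M s) X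
  alpha M zero X no-stable no-bad = ⊥-elim (no-stable [] [] refl)
  alpha M (suc s) X no-stable no-bad with null? X (alphaD M (suc s)) X
  ... | yes n = n
  ... | no ¬n = ⊥-elim (no-bad (mapᴬ in-X (proj₁ (proj₂ found))) (≤-trans (proj₁ (proj₂ (proj₂ found))) (m≤n⊔m (alphaL M s) _))
                   (proj₂ (proj₂ (proj₂ found))))
    where
    e = suc (alphaD M s)
    open Rich D e
    in-X : ∀ {is : List ℕ} {x} → x ∈ ⋃ (λ _ → X) is → x ∈ X
    in-X p = proj₂ (proj₂ (find p))
    crossing : ∀ {a} → a ∈ X → Sparse e a X
    crossing {a} a∈ Q Q⊆N Q⊆X = null-∪ (sub (_≡ a) (_≟F a) ∩ Q) {Q ∖ sing a} single
        (null-mono {Z = Q ∖ sing a} proj₁ ≤-refl id (alpha M s (Q ∖ sing a)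
          (λ {L} st L⊆ len → no-stable
            (mapᴬ (λ { (q , ne) → Q⊆N q , λ a≡x → ne (sym a≡x) }) L⊆ ∷ st)
            (a∈ ∷ mapᴬ (Q⊆X ∘ proj₁) L⊆) (cong suc len))
          (λ J⊆ le → no-bad (mapᴬ (Q⊆X ∘ proj₁) J⊆) (≤-trans le (m≤m⊔n _ _)))))
        (λ {x} p → case x ≟F a of λ { (yes e) → inj₁ (e , p) ; (no ne) → inj₂ (p , ne) })
      where
      single : Null Q 1 (sing a ∩ Q)
      single with a ∈? Q
      ... | yes p = null (a ∷ []) (p ∷ []) ≤-refl (λ { (refl , _) → here (inj₁ refl) })
      ... | no n = null [] [] z≤n (λ { (refl , p) → contradiction p n })
    found = rich M _≟ℕ_ (λ _ → X) (upTo (richT e M)) (Unique-upTo⁺ _) (≤-reflexive (sym (length-upTo _)))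
      (λ _ _ _ → crossing) (λ _ n → ¬n (null-mono {Z = ⋃ (λ _ → X) (upTo (richT e M))} in-X ≤-refl id n))

-- In `hero` the list `J` is a copy of H; in `frag` it is a copy of (r - 1)K₁ + P₃, or one vertex of
-- a clique when r is zero. Only the configurations they exclude are recorded, and these are
-- invariant under reversal.
record Dense (c₀ c h f q r : ℕ) (D : Digraph) : Set₁ where
  open Dig D
  open Independence D
  field
    non : ∀ v → Col (Non v) c₀
    hero : ∀ X → Col X c ⊎ ∃ λ J → All (_∈ X) J × length J ≤ h ×
      (∀ {w x} → w ⟶ x → All (x ⟶_) J → All (_⟶ w) J → ⊥)
    frag : ∀ X → Col X f ⊎ ∃ λ J → All (_∈ X) J × length J ≤ q ×
      (∀ {x} → All (λ j → x o j × x ≢ j) J → ⊥)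
    path : ∀ {x y a L} → x ⟶ y → y ⟶ a → x o a → Stable L → length L ≡ r →
      All (λ l → (l o x × l ≢ x) × (l o y × l ≢ y) × (l o a × l ≢ a)) L → ⊥

module LocalToGlobal (c₀ c h f q r k : ℕ) where

  M e t : ℕ
  M = k + c₀
  e = alphaD M r
  t = richT e M

  -- A set not dominated by `lev j` vertices tolerates `j` further choices of `y`, each at the price
  -- in `spoilt-col`; `lev zero` is what `rich` requires.
  lev : ℕ → ℕ
  lev zero = richK e M
  lev (suc j) = (h + q) * suc (lev j)

  -- `w` exceeds by one the `1 + d₁` vertices that will replace `W`. The summands of `G` rule out in
  -- turn that `w` vertices dominate `U`, that `U` contains a `Bad M` list of length at most `ℓ`,
  -- and that `Y` has an `a₁`-colouring.
  ℓ d₁ w b a₁ G : ℕ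
  ℓ = alphaL M r ⊔ richL e M
  d₁ = h * suc (lev t)
  w = suc (suc d₁)
  b = suc t * (c + f)
  a₁ = c + (b + 1 * (c₀ + k))
  G = w * suc k + (ℓ * k + (a₁ + w * (c₀ + k)))

  module _ {D : Digraph} (dense : Dense c₀ c h f q r D) (U : Sub (size D)) where
    open Dig D
    open Splitting D
    open Domination D
    open Independence D
    open Dense dense
    open Rich D e using (⋃; rich)

    null-star : ∀ {κ X m} (F : V → Sub (size D)) J → All (_∈ U) J → length J ≤ m →
      (∀ {j} → j ∈ₗ J → Null U κ (X ∩ F j)) → (∀ {x} → x ∈ X → Any (λ j → j ▷ x ⊎ x ∈ F j) J) →
      Null U (m * suc κ) X
    null-star {κ} {X} F J J⊆ le nF cov = null-≤ (*-monoˡ-≤ (suc κ) le) (go J J⊆ nF X id cov)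
      where
      go : ∀ J → All (_∈ U) J → (∀ {j} → j ∈ₗ J → Null U κ (X ∩ F j)) → ∀ Y → (∀ {x} → x ∈ Y → x ∈ X) →
        (∀ {x} → x ∈ Y → Any (λ j → j ▷ x ⊎ x ∈ F j) J) → Null U (length J * suc κ) Y
      go [] _ _ Y _ cov = null [] [] z≤n (λ p → case cov p of λ ())
      go (j ∷ J) (j∈ ∷ J⊆) nF Y Y⊆ cov = null-∪ B {Y ∖ B}
          (null-∪ (sub (j ▷_) (j ▷?_)) {X ∩ F j} (null (j ∷ []) (j∈ ∷ []) ≤-refl here) (nF (here refl))
            (λ { (p , inj₁ q) → inj₁ q ; (p , inj₂ q) → inj₂ (Y⊆ p , q) }))
          (go J J⊆ (nF ∘ there) (Y ∖ B) (Y⊆ ∘ proj₁)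
            (λ { (p , n) → case cov p of λ { (here s) → contradiction (p , s) n ; (there s) → s } }))
          (λ {x} p → case x ∈? B of λ { (yes s) → inj₁ s ; (no n) → inj₂ (p , n) })
        where
        B : Sub (size D)
        B = sub (λ x → x ∈ Y × (j ▷ x ⊎ x ∈ F j)) (λ x → (x ∈? Y) ×-dec ((j ▷? x) ⊎-dec (x ∈? F j)))

    Spoilt : ℕ → Sub (size D) → Sub (size D) → Sub (size D)
    Spoilt κ X Ys = Ys ∩ sub (λ y → Null U κ (X ∩ Non y) ⊎ Null U κ (X ∩ In y))
      (λ y → null? U κ (X ∩ Non y) ⊎-dec null? U κ (X ∩ In y))

    -- In S₁ a copy of H would lie on a triangle w → x ⇒ H ⇒ w; in S₂ a copy of (r - 1)K₁ + P₃
    -- would be completed by an isolated x.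
    spoilt-col : ∀ {κ X Ys W} → (∀ {x} → x ∈ X → Any (_⟶ x) W) → (∀ {y} → y ∈ Ys → y ∈ U × All (y ⟶_) W) →
      ¬ Null U ((h + q) * suc κ) X → Col (Spoilt κ X Ys) (c + f)
    spoilt-col {κ} {X} {Ys} {W} X⊆ Ys⊆ ¬n = col-∪ S₁ {Z = S₂} other (proj₁ both) (proj₂ both)
      where
      S₁ S₂ : Sub (size D)
      S₁ = Ys ∩ sub (λ y → Null U κ (X ∩ Non y)) (λ y → null? U κ (X ∩ Non y))
      S₂ = Ys ∩ sub (λ y → Null U κ (X ∩ In y)) (λ y → null? U κ (X ∩ In y))
      other : ∀ {x} → x ∈ Spoilt κ X Ys → x ∉ S₁ → x ∈ S₂
      other (p , inj₁ n) m = contradiction (p , n) m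
      other (p , inj₂ n) m = p , n
      both : Col S₁ c × Col S₂ f
      both with hero S₁ | frag S₂
      ... | inj₁ a | inj₁ b = a , b
      ... | inj₂ (J , J⊆ , le , bad) | _ = contradiction
            (null-star Non J (mapᴬ (λ p → proj₁ (Ys⊆ (proj₁ p))) J⊆) (≤-trans le (m≤m+n h q)) (λ p → proj₂ (lookupᴬ J⊆ p)) cov) ¬n
        where
        cov : ∀ {x} → x ∈ X → Any (λ j → j ▷ x ⊎ x ∈ Non j) J
        cov {x} p with anyᴬ? (λ j → (j ▷? x) ⊎-dec (x ∈? Non j)) J
        ... | yes a = a
        ... | no n with w , w∈ , wx ← find (X⊆ p) = ⊥-elim (bad wx
              (tabulateᴬ (λ {j} j∈ → case adj? x j of λ
                { (inj₁ s) → s ; (inj₂ (inj₁ s)) → contradiction (lose j∈ (inj₁ (inj₂ s))) n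
                ; (inj₂ (inj₂ s)) → contradiction (lose j∈ (inj₂ (o-sym s))) n }))
              (mapᴬ (λ s → lookupᴬ (proj₂ (Ys⊆ (proj₁ s))) w∈) J⊆))
      ... | inj₁ _ | inj₂ (J , J⊆ , le , bad) = contradiction
            (null-star In J (mapᴬ (λ p → proj₁ (Ys⊆ (proj₁ p))) J⊆) (≤-trans le (m≤n+m q h)) (λ p → proj₂ (lookupᴬ J⊆ p)) cov) ¬n
        where
        cov : ∀ {x} → x ∈ X → Any (λ j → j ▷ x ⊎ x ∈ In j) J
        cov {x} p with anyᴬ? (λ j → (j ▷? x) ⊎-dec (x ∈? In j)) J
        ... | yes a = a
        ... | no n = ⊥-elim (bad (tabulateᴬ (λ {j} j∈ → case adj? x j of λ
                { (inj₁ s) → contradiction (lose j∈ (inj₂ s)) n ; (inj₂ (inj₁ s)) → contradiction (lose j∈ (inj₁ (inj₂ s))) n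
                ; (inj₂ (inj₂ s)) → s , λ e → n (lose j∈ (inj₁ (inj₁ (sym e)))) })))

    -- The sets `P ys y`, in-neighbours of `y` non-adjacent to the other chosen vertices, cross: for
    -- `x` in one of them, `x`, `y`, `a` is an induced path, and non-neighbours of `x` in another
    -- set are non-adjacent to all three. A stable set of size `r` among them is forbidden by
    -- `path`, so `alpha` applies.
    module Parts (no-bad : ∀ {J} → All (_∈ U) J → length J ≤ ℓ → ¬ Bad M J)
      (W : List V) (a : V) (X₁ Y : Sub (size D))
      (X₁⊆ : ∀ {x} → x ∈ X₁ → x ∈ U × x o a × Any (_⟶ x) W)
      (Y⊆ : ∀ {y} → y ∈ Y → y ∈ U × y ⟶ a × All (y ⟶_) W)
      (X₁-big : ¬ Null U (lev t) X₁) (Y-big : ¬ Col Y b) where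

      P : List V → V → Sub (size D)
      P ys y = X₁ ∩ In y ∩ sub (λ x → All (λ y′ → y′ ≢ y → x o y′) ys)
        (λ x → allᴬ? (λ y′ → ¬? (y′ ≟F y) →-dec (x o? y′)) ys)

      R : List V → Sub (size D)
      R ys = X₁ ∩ sub (λ x → All (x o_) ys) (λ x → allᴬ? (x o?_) ys)

      record Inv (κ : ℕ) (ys : List V) : Set where
        field
          ys⊆ : All (_∈ Y) ys
          uniq : Unique ys
          P-big : ∀ {y} → y ∈ₗ ys → ¬ Null U κ (P ys y)
          R-big : ¬ Null U κ (R ys)

      -- The in-neighbours of the new `y` in the reserve `R ys` become its set; the reserve and the
      -- earlier sets are cut down to non-neighbours of `y`. At most `suc t` spoilt sets must be
      -- avoided, each with `c + f` colours, which gives `b`.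
      extend : ∀ {j ys} → length ys ≤ t → Inv (lev (suc j)) ys → ∃ λ y → Inv (lev j) (y ∷ ys)
      extend {j} {ys} le inv with any? (_∈? (Y ∖ All-spoilt))
        where
        All-spoilt : Sub (size D)
        All-spoilt = sub (λ y → y ∈ Spoilt (lev j) (R ys) Y ⊎ Any (λ y′ → y ∈ Spoilt (lev j) (P ys y′) Y) ys)
          (λ y → (y ∈? Spoilt (lev j) (R ys) Y) ⊎-dec anyᴬ? (λ y′ → y ∈? Spoilt (lev j) (P ys y′) Y) ys)
      ... | no none = contradiction (col-∪ (Spoilt (lev j) (R ys) Y) {Z = Y ∖ Spoilt (lev j) (R ys) Y} (λ p n → p , n)
              (spoilt-col {X = R ys} {Y} {W} (λ p → proj₂ (proj₂ (X₁⊆ (proj₁ p))))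
                (λ p → let u , _ , s = Y⊆ p in u , s) (Inv.R-big inv))
              (col-≤ (*-monoˡ-≤ (c + f) le) (col-cover ys (λ y′ → Spoilt (lev j) (P ys y′) Y)
                (λ { {y} (p , n) → case anyᴬ? (λ y′ → y ∈? Spoilt (lev j) (P ys y′) Y) ys of λ
                  { (yes s) → s ; (no m) → contradiction (y , p , λ { (inj₁ s) → n s ; (inj₂ s) → m s }) none } })
                (tabulateᴬ (λ {y′} y∈ → spoilt-col {X = P ys y′} {Y} {W} (λ p → proj₂ (proj₂ (X₁⊆ (proj₁ (proj₁ p)))))
                  (λ p → let u , _ , s = Y⊆ p in u , s) (Inv.P-big inv y∈)))))) Y-big
      ... | yes (y , y∈ , fine) = y , record
        { ys⊆ = y∈ ∷ Inv.ys⊆ inv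
        ; uniq = tabulateᴬ new ∷ Inv.uniq inv
        ; P-big = λ { (here refl) n → fine (inj₁ (y∈ , inj₂ (null-mono {Z = U} id ≤-refl
                       (λ { ((p , s) , i) → (p , i) , (λ ne → contradiction refl ne) ∷ mapᴬ (λ o _ → o) s }) n)))
                    ; (there {x = _} y′∈) n → fine (inj₂ (lose y′∈ (y∈ , inj₁ (null-mono {Z = U} id ≤-refl
                       (λ { ((p , s) , o) → p , (λ _ → o-sym o) ∷ s }) n)))) }
        ; R-big = λ n → fine (inj₁ (y∈ , inj₁ (null-mono {Z = U} id ≤-refl (λ { ((p , s) , o) → p , o-sym o ∷ s }) n))) }
        where
        new : ∀ {y′} → y′ ∈ₗ ys → y ≢ y′
        new y′∈ refl = fine (inj₂ (lose y′∈ (y∈ , inj₁ (null [] [] z≤n (λ { (((_ , i) , _) , (_ , o)) → contradiction i o })))))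

      run : ∀ i j → i + j ≡ t → ∃ λ ys → length ys ≡ i × Inv (lev j) ys
      run zero j refl = [] , refl , record { ys⊆ = [] ; uniq = [] ; P-big = λ ()
        ; R-big = λ n → X₁-big (null-mono {Z = U} id ≤-refl (λ p → p , []) n) }
      run (suc i) j eq with ys , len , inv ← run i (suc j) (trans (+-suc i j) eq)
        with y , inv′ ← extend {j} (≤-trans (≤-reflexive len) (≤-trans (m≤m+n i (suc j)) (≤-reflexive (trans (+-suc i j) eq)))) inv =
        y ∷ ys , cong suc len , inv′

      impossible : ⊥
      impossible with ys , len , inv ← run t 0 (+-identityʳ t) =
        let J , J⊆ , le , bad = rich M _≟F_ (P ys) ys (Inv.uniq inv) (≤-reflexive (sym len)) (cross inv)
              (λ y∈ n → Inv.P-big inv y∈ (null-mono {Z = ⋃ (P ys) ys} in-U ≤-refl id n))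
        in no-bad (mapᴬ in-U J⊆) (≤-trans le (m≤n⊔m (alphaL M r) _)) bad
        where
        in-U : ∀ {ys x} → x ∈ ⋃ (P ys) ys → x ∈ U
        in-U p = let _ , _ , ((x∈ , _) , _) = find p in proj₁ (X₁⊆ x∈)
        cross : ∀ {ys} → Inv (lev 0) ys → ∀ {y y′} → y ∈ₗ ys → y′ ∈ₗ ys → y ≢ y′ → Cross e (P ys y) (P ys y′)
        cross {ys} inv {y} {y′} y∈ y′∈ ne {x} ((x∈ , xy) , xs) Q Q⊆N Q⊆P = alpha M r Q no-stable
            (λ J⊆ le → no-bad (mapᴬ (λ p → proj₁ (X₁⊆ (proj₁ (proj₁ (Q⊆P p))))) J⊆) (≤-trans le (m≤m⊔n _ _)))
          where
          ya : y ⟶ a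
          ya = proj₁ (proj₂ (Y⊆ (lookupᴬ (Inv.ys⊆ inv) y∈)))
          y′a : y′ ⟶ a
          y′a = proj₁ (proj₂ (Y⊆ (lookupᴬ (Inv.ys⊆ inv) y′∈)))
          no-stable : ∀ {L} → Stable L → All (_∈ Q) L → length L ≡ r → ⊥
          no-stable st L⊆ len = path xy ya (proj₁ (proj₂ (X₁⊆ x∈))) st len (mapᴬ apart L⊆)
            where
            apart : ∀ {l} → l ∈ Q → (l o x × l ≢ x) × (l o y × l ≢ y) × (l o a × l ≢ a)
            apart {l} l∈ with (l∈X , ly′) , ls ← Q⊆P l∈ =
              (o-sym (Q⊆N l∈) , λ { refl → proj₁ (lookupᴬ xs y′∈ (ne ∘ sym)) ly′ }) ,
              (lookupᴬ ls y∈ ne , λ { refl → proj₁ (proj₁ (proj₂ (X₁⊆ l∈X))) ya }) ,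
              (proj₁ (proj₂ (X₁⊆ l∈X)) , λ { refl → asym ly′ y′a })

    local : (∀ {v} → v ∈ U → Col (Out v ∩ U) k) → Col U G
    local loc = decidable-stable (col? U G) (λ ¬col → refute ¬col)
      where
      module _ (¬col : ¬ Col U G) where
        -- A vertex without an in-neighbour in `J` would colour `J` by its out-neighbours and
        -- non-neighbours with `k + c₀` colours, which is `M`. So the out-neighbourhoods of `J`
        -- cover `U`.
        no-bad : ∀ {J} → All (_∈ U) J → length J ≤ ℓ → ¬ Bad M J
        no-bad {J} J⊆ le bad = ¬col (col-≤ (≤-trans (m≤m+n (ℓ * k) _) (m≤n+m _ (w * suc k)))
            (col-≤ (*-monoˡ-≤ k le) (col-cover J (λ j → Out j ∩ U) cov (mapᴬ (λ p → loc p) J⊆))))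
          where
          cov : ∀ {v} → v ∈ U → Any (λ j → v ∈ (Out j ∩ U)) J
          cov {v} v∈ with anyᴬ? (_⟶? v) J
          ... | yes s = mapᴱ (_, v∈) s
          ... | no n = contradiction
                (col-∪ (Out v ∩ U) {Z = Non v} (λ {j} j∈ out → case adj? v j of λ
                  { (inj₁ s) → contradiction (s , lookupᴬ J⊆ j∈) out
                  ; (inj₂ (inj₁ s)) → contradiction (lose j∈ s) n ; (inj₂ (inj₂ s)) → s })
                  (loc v∈) (non v)) (bad-not-col {X = list J} bad id)

        ¬null : ¬ Null U w U
        ¬null (null S S⊆ le dom) = ¬col (col-≤ (m≤m+n (w * suc k) _) (col-≤ (*-monoˡ-≤ (suc k) le)
          (col-cover S (λ s → U ∩ sub (s ▷_) (s ▷?_)) (λ p → mapᴱ (p ,_) (dom p))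
            (mapᴬ (λ {s} s∈ → col-∪ (sing s) {Z = Out s ∩ U}
              (λ { (p , inj₁ e) n → contradiction (sym e) n ; (p , inj₂ t) n → t , p })
              (col-stable (λ { refl refl → irrefl })) (loc s∈)) S⊆))))

        S-min = minimal {U} {U} id ¬null
        S W R : List V
        S = proj₁ S-min
        W = take w S
        R = drop w S
        module S = Minimal (proj₂ S-min)

        W-length : length W ≡ w
        W-length = trans (length-take w S) (m≤n⇒m⊓n≡m (<⇒≤ S.long))

        X Y : Sub (size D)
        X = U ∩ sub (λ x → Any (_⟶ x) W) (λ x → anyᴬ? (_⟶? x) W)
        Y = To W U

        non-in : ∀ {j Z} → Col (Non j ∩ Z) c₀
        non-in {j} = col-⊆ {Y = Non j} proj₁ (non j)

        Y-big : ¬ Col Y a₁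
        Y-big cY = ¬col (col-≤ (≤-trans (m≤n+m _ (ℓ * k)) (m≤n+m _ (w * suc k)))
          (col-towards W (≤-reflexive W-length) cY (λ _ → non-in) (λ p → loc (lookupᴬ (All-take⁺ w S.S⊆) p))))

        non-null : ∀ {a} → a ∈ Y → Null U (lev t) (X ∩ Non a)
        non-null {a} (a∈ , _) = decidable-stable (null? U (lev t) (X ∩ Non a)) (λ ¬n →
          Parts.impossible no-bad W a (X ∩ Non a) (To (a ∷ []) Y)
            (λ { ((u , s) , o) → u , o-sym o , s }) (λ { ((u , s) , (i ∷ [])) → u , i , s })
            ¬n (λ cY → Y-big (col-≤ (m≤n+m _ c) (col-towards (a ∷ []) ≤-refl cY (λ _ → non-in)
              (λ { (here refl) → col-⊆ {Y = Out a ∩ U} (λ { (i , (u , _)) → i , u }) (loc a∈) })))))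

        -- Let `J` be a copy of H in `Y`. Every `x` in `X` has an in-neighbour `v` in `W`, and `J`
        -- points to `v`, so `x` cannot point to all of `J`: some `j` dominates it or is
        -- non-adjacent to it, and `non-null` treats the latter.
        X-null : Null U d₁ X
        X-null with hero Y
        ... | inj₁ cY = contradiction (col-≤ (m≤m+n c _) cY) Y-big
        ... | inj₂ (J , J⊆ , le , bad) = null-star Non J (mapᴬ proj₁ J⊆) le (λ j∈ → non-null (lookupᴬ J⊆ j∈)) cov
          where
          cov : ∀ {x} → x ∈ X → Any (λ j → j ▷ x ⊎ x ∈ Non j) J
          cov {x} (_ , p) with anyᴬ? (λ j → (j ▷? x) ⊎-dec (x ∈? Non j)) J
          ... | yes s = s
          ... | no n with v , v∈ , vx ← find p = ⊥-elim (bad vx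
                (tabulateᴬ (λ {j} j∈ → case adj? x j of λ
                  { (inj₁ s) → s ; (inj₂ (inj₁ s)) → contradiction (lose j∈ (inj₁ (inj₂ s))) n
                  ; (inj₂ (inj₂ s)) → contradiction (lose j∈ (inj₂ (o-sym s))) n }))
                (mapᴬ (λ s → lookupᴬ (proj₂ s) v∈) J⊆))

        -- W can be replaced in S by y, which dominates W, and by d₁ vertices dominating X.
        refute : ⊥
        refute with any? (_∈? Y)
        ... | no n = Y-big (col-∅ (λ p → n (_ , p)))
        ... | yes (y , (y∈ , yW)) = S.¬null (null-≤ count≤ (null-∪ By-R {U ∖ By-R}
              (null R (All-drop⁺ w S.S⊆) ≤-refl id)
              (null-∪ (sub (y ▷_) (y ▷?_)) {X} (null (y ∷ []) (y∈ ∷ []) ≤-refl here) X-null rest)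
              (λ {x} p → case x ∈? By-R of λ { (yes s) → inj₁ s ; (no s) → inj₂ (p , s) })))
          where
          By-R : Sub (size D)
          By-R = sub (λ x → Any (_▷ x) R) (λ x → anyᴬ? (_▷? x) R)
          rest : ∀ {x} → x ∈ (U ∖ By-R) → y ▷ x ⊎ x ∈ X
          rest {x} (p , n) with Any-++⁻ W (subst (Any (_▷ x)) (sym (take++drop≡id w S)) (S.covers p))
          ... | inj₂ s = contradiction s n
          ... | inj₁ s with find s
          ...   | v , v∈ , inj₁ refl = inj₁ (inj₂ (lookupᴬ yW v∈))
          ...   | v , v∈ , inj₂ vx = inj₂ (p , lose v∈ vx)
          count≤ : length R + (1 + d₁) ≤ S.K′
          count≤ = ≤-pred (begin
            suc (length R + suc d₁)   ≡⟨ sym (+-suc (length R) (suc d₁)) ⟩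
            length R + w              ≡⟨ trans (+-comm (length R) w) (cong (_+ length R) (sym W-length)) ⟩
            length W + length R       ≡⟨ trans (sym (length-++ W)) (cong length (take++drop≡id w S)) ⟩
            length S                  ≤⟨ S.S≤ ⟩
            suc S.K′ ∎)
            where open ≤-Reasoning

-- Chains of bags

dense-rev : ∀ {c₀ c h f q r D} → Dense c₀ c h f q r D → Dense c₀ c h f q r (rev D)
dense-rev {D = D} dense = record
  { non = λ v → Dig.col-⊆ (rev D) {Y = Non v} o-sym (col-rev (non v))
  ; hero = λ X → case hero X of λ
      { (inj₁ c) → inj₁ (col-rev c)
      ; (inj₂ (J , J⊆ , le , bad)) → inj₂ (J , J⊆ , le , λ {_} {_} xw jx wj → bad xw wj jx) }
  ; frag = λ X → case frag X of λ
      { (inj₁ c) → inj₁ (col-rev c)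
      ; (inj₂ (J , J⊆ , le , bad)) → inj₂ (J , J⊆ , le , λ {_} o → bad (mapᴬ (λ { (p , ne) → o-sym p , ne }) o)) }
  ; path = λ yx ay xa st len apart → path ay yx xa (mapᴾ (λ { (p , ne) → o-sym p , ne }) st) len
      (mapᴬ (λ { ((p , m) , (p′ , m′) , (p″ , m″)) → (o-sym p″ , m″) , (o-sym p′ , m′) , (o-sym p , m) }) apart) }
  where
  open Dig D
  open Dense dense

module Chains (c₀ c h f q r : ℕ) where

  abstract
    local-bound : ℕ → ℕ
    local-bound k = LocalToGlobal.G c₀ c h f q r k

    local-col : ∀ {D} → Dense c₀ c h f q r D → ∀ U k → (∀ {v} → v ∈ U → Dig.Col D (Dig.Out D v ∩ U) k) →
      Dig.Col D U (local-bound k)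
    local-col dense U k = LocalToGlobal.local c₀ c h f q r k dense U

  split-bound : ℕ → ℕ
  split-bound s = local-bound s + local-bound s

  -- Each `c` pays for a set `Out v ∩ In u` over an arc from `u` to `v`, each `c₀` for a
  -- non-neighbourhood. `θ` arises in `between`, `τ` in `ahead`, and `σ` in `behind` and `no-jump`.
  θ τ σ : ℕ
  θ = c + (c₀ + (c + (c₀ + c)))
  τ = c + c₀
  σ = τ + (c₀ + (c₀ + c))

  abstract
    pair-bound : ℕ → ℕ → ℕ
    pair-bound s s′ = split-bound (s ⊔ split-bound (θ ⊔ s′))

  triple-bound : ℕ
  triple-bound = pair-bound σ (pair-bound σ σ)

  module _ {D : Digraph} (dense : Dense c₀ c h f q r D) where
    open Dig D
    open Dense dense

    light : ∀ {u v} → u ⟶ v → Col (Out v ∩ In u) c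
    light {u} {v} uv with hero (Out v ∩ In u)
    ... | inj₁ p = p
    ... | inj₂ (J , J⊆ , _ , bad) = ⊥-elim (bad uv (mapᴬ proj₁ J⊆) (mapᴬ proj₂ J⊆))

    -- Otherwise each vertex of `X` has a small out- or in-neighbourhood in `X`, and `local-col`
    -- colours the two classes, the second in the reversed digraph.
    split : ∀ {X} s → ¬ Col X (split-bound s) →
      ∃ λ v → v ∈ X × ¬ Col (In v ∩ X) s × ¬ Col (Out v ∩ X) s
    split {X} s big with any? (λ v → (v ∈? X) ×-dec ¬? (col? (In v ∩ X) s) ×-dec ¬? (col? (Out v ∩ X) s))
    ... | yes found = found
    ... | no none = contradiction (col-∪ S {Z = X ∖ S} (λ p n → p , n)
        (local-col dense S s (λ { {v} (_ , p) → col-⊆ {Y = Out v ∩ X} (λ { (a , b , _) → a , b }) p }))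
        (col-rev (local-col (dense-rev dense) (X ∖ S) s small))) big
      where
      S : Sub (size D)
      S = X ∩ sub (λ v → Col (Out v ∩ X) s) (λ v → col? (Out v ∩ X) s)
      small : ∀ {v} → v ∈ (X ∖ S) → Dig.Col (rev D) (Dig.Out (rev D) v ∩ (X ∖ S)) s
      small {v} (p , n) = col-rev (col-⊆ {Y = In v ∩ X} (λ { (a , b , _) → a , b })
        (decidable-stable (col? (In v ∩ X) s) (λ m → none (v , p , m , λ k → n (p , k)))))

    record Exact (X Y : Sub (size D)) : Set where
      constructor exact
      field
        sep : ∀ {x y} → x ∈ X → y ∈ Y → ¬ y ⟶ x × x ≢ y
    open Exact

    abstract
      pair : ∀ {X} s s′ → ¬ Col X (pair-bound s s′) → ∃₂ λ B B′ →
        (∀ {x} → x ∈ B → x ∈ X) × (∀ {x} → x ∈ B′ → x ∈ X) × ¬ Col B s × ¬ Col B′ s′ × Exact B B′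
      pair {X} s s′ big
        with v , v∈ , bigP , bigQ ← split {X} _ big
        with u , (vu , u∈) , bigP₂ , bigQ₂ ← split {Out v ∩ X} (θ ⊔ s′) (λ k → bigQ (col-≤ (m≤n⊔m s _) k)) =
        In v ∩ X , Out u ∩ (Out v ∩ X) , proj₂ , proj₂ ∘ proj₂ , (λ k → bigP (col-≤ (m≤m⊔n s _) k)) ,
        (λ k → bigQ₂ (col-≤ (m≤n⊔m θ s′) k)) , exact λ { (pv , _) (uz , vz , _) →
          (λ zp → bigP₂ (col-≤ (m≤m⊔n θ s′) (between v u pv uz zp))) , λ { refl → asym pv vz } }
        where
        -- The large set between `v` and `u` forbids an arc from `z` back to `p`. A middle vertex
        -- outside the two light sets over `p → v` and `u → z`, and adjacent to `p` and `z`,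
        -- satisfies `p → x → z`, so it is in the light set over `z → p`.
        between : ∀ v u {p z} → p ⟶ v → u ⟶ z → z ⟶ p → Col (In u ∩ (Out v ∩ X)) θ
        between v u {p} {z} pv uz zp =
          col-∪ (Out v ∩ In p) {Z = Y ∖ (Out v ∩ In p)} (λ m n → m , n) (light pv)
          (col-∪ (Non p) {Z = Y ∩ Out p} (λ { {x} (m@(_ , vx , _) , n) np → m , forced vx n np }) (non p)
          (col-∪ (Out z ∩ In u) {Z = (Y ∩ Out p) ∖ (Out z ∩ In u)} (λ m n → m , n) (light uz)
          (col-∪ (Non z) {Z = Out p ∩ In z} (λ { {x} (((xu , _) , px) , n) nz → px , forced′ xu n nz }) (non z)
          (light zp))))
          where
          Y : Sub (size D)
          Y = In u ∩ (Out v ∩ X)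
          forced : ∀ {x} → v ⟶ x → x ∉ (Out v ∩ In p) → x ∉ Non p → p ⟶ x
          forced {x} vx n np with adj? p x
          ... | inj₁ a = a
          ... | inj₂ (inj₁ a) = contradiction (vx , a) n
          ... | inj₂ (inj₂ a) = contradiction a np
          forced′ : ∀ {x} → x ⟶ u → x ∉ (Out z ∩ In u) → x ∉ Non z → x ⟶ z
          forced′ {x} xu n nz with adj? x z
          ... | inj₁ a = a
          ... | inj₂ (inj₁ a) = contradiction (a , xu) n
          ... | inj₂ (inj₂ a) = contradiction (o-sym a) nz

    record Triple (X : Sub (size D)) : Set₁ where
      field
        B₁ B₂ B₃ : Sub (size D)
        B₁⊆ : ∀ {x} → x ∈ B₁ → x ∈ X
        B₂⊆ : ∀ {x} → x ∈ B₂ → x ∈ X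
        B₃⊆ : ∀ {x} → x ∈ B₃ → x ∈ X
        big₁ : ¬ Col B₁ σ
        big₂ : ¬ Col B₂ σ
        big₃ : ¬ Col B₃ σ
        ex₁₂ : Exact B₁ B₂
        ex₁₃ : Exact B₁ B₃
        ex₂₃ : Exact B₂ B₃

    triple : ∀ X → Col X triple-bound ⊎ Triple X
    triple X with col? X triple-bound
    ... | yes p = inj₁ p
    ... | no big with B , B′ , B⊆ , B′⊆ , bB , bB′ , ex ← pair {X} σ (pair-bound σ σ) big
      with C , C′ , C⊆ , C′⊆ , bC , bC′ , ex′ ← pair {B′} σ σ bB′ = inj₂ record
      { B₁ = B ; B₂ = C ; B₃ = C′ ; B₁⊆ = B⊆ ; B₂⊆ = B′⊆ ∘ C⊆ ; B₃⊆ = B′⊆ ∘ C′⊆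
      ; big₁ = bB ; big₂ = bC ; big₃ = bC′
      ; ex₁₂ = exact λ x y → sep ex x (C⊆ y) ; ex₁₃ = exact λ x y → sep ex x (C′⊆ y) ; ex₂₃ = ex′ }

    -- The position of v is the index of the first bag containing many out-neighbours of v.
    pos : V → List (Sub (size D)) → ℕ
    pos v [] = 0
    pos v (B ∷ Bs) with col? (Out v ∩ B) τ
    ... | yes _ = suc (pos v Bs)
    ... | no _ = 0

    Big : Sub (size D) → Set
    Big B = ¬ Col B σ

    Behind Ahead : V → Sub (size D) → Set
    Behind v B = ∀ p → p ∈ B → ¬ v ⟶ p × v ≢ p
    Ahead v B = ∀ p → p ∈ B → ¬ p ⟶ v × v ≢ p

    -- Suppose `p` in `B′` had an arc to `v`. Out-neighbours of `v` in `B` that point to `p` form a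
    -- light set; the others are non-neighbours of `p`, as no arc leads from `B′` to `B`.
    ahead : ∀ {v B B′} → ¬ Col (Out v ∩ B) τ → Exact B B′ → Ahead v B′
    ahead {v} {B} {B′} big ex p p∈ = (λ pv → big (col-∪ (Out v ∩ In p) {Z = Non p} other (light pv) (non p)) ) ,
        λ { refl → big (col-∅ (λ { (vx , x∈) → proj₁ (sep ex x∈ p∈) vx })) }
      where
      other : ∀ {x} → x ∈ (Out v ∩ B) → x ∉ (Out v ∩ In p) → x ∈ Non p
      other {x} (vx , x∈) n = proj₁ (sep ex x∈ p∈) , λ xp → n (vx , xp)

    behind : ∀ {v B B′} → Col (Out v ∩ B′) τ → Exact B B′ → Big B′ → Behind v B
    behind {v} {B} {B′} small ex big p p∈ =
        (λ vp → big (col-∪ (Out v ∩ B′) {Z = B′ ∖ Out v} (λ m n → m , λ vx → n (vx , m)) small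
          (col-∪ (Non v) {Z = B′ ∩ In v} (λ { {x} (m , n) nv → m , forced n nv }) (non v)
          (col-∪ (Non p) {Z = Out p ∩ In v} (λ { {x} (m , xv) np → forced′ (proj₁ (sep ex p∈ m)) np , xv }) (non p) (light vp))))) ,
        λ { refl → big (col-≤ (+-monoʳ-≤ τ (m≤m+n c₀ _)) (col-∪ (Out v ∩ B′) {Z = Non v} (λ {x} m n →
             (λ vx → n (vx , m)) , proj₁ (sep ex p∈ m)) small (non v))) }
      where
      forced : ∀ {x} → ¬ v ⟶ x → x ∉ Non v → x ⟶ v
      forced {x} n nv = decidable-stable (x ⟶? v) (λ m → nv (n , m))
      forced′ : ∀ {x} → ¬ x ⟶ p → x ∉ Non p → p ⟶ x
      forced′ {x} n np = decidable-stable (p ⟶? x) (λ m → np (m , n))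

    -- A vertex of `B′` outside `Out u`, and adjacent to both ends, receives an arc from `v` and
    -- sends one to `u`, so it belongs to the light set over the arc.
    no-jump : ∀ {u v B′} → u ⟶ v → Col (Out u ∩ B′) τ → Ahead v B′ → Big B′ → ⊥
    no-jump {u} {v} {B′} uv small ah big =
      big (col-∪ (Out u ∩ B′) {Z = B′ ∖ Out u} (λ m n → m , λ ux → n (ux , m)) small
        (col-∪ (Non v) {Z = Out v ∖ Out u} (λ { {x} (m , n) nv → forced (proj₁ (ah _ m)) nv , n }) (non v)
        (col-∪ (Non u) {Z = Out v ∩ In u} (λ { {x} (vx , n) nu → vx , forced′ n nu }) (non u) (light uv))))
      where
      forced : ∀ {x} → ¬ x ⟶ v → x ∉ Non v → v ⟶ x
      forced {x} n nv = decidable-stable (v ⟶? x) (λ m → nv (m , n))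
      forced′ : ∀ {x} → ¬ u ⟶ x → x ∉ Non u → x ⟶ u
      forced′ {x} n nu = decidable-stable (x ⟶? u) (λ m → nu (n , m))

    first-bag : ∀ {p} {P : Sub (size D) → Set p} v Bs {n} → suc n ≤ pos v Bs → All P Bs → All Big Bs →
      ∃ λ B → P B × Big B × Col (Out v ∩ B) τ
    first-bag v (B ∷ Bs) lt (p ∷ _) (b ∷ _) with col? (Out v ∩ B) τ
    ... | yes s = B , p , b , s
    first-bag v (B ∷ Bs) () (p ∷ _) (b ∷ _) | no _

    -- `behind` needs a later bag with few out-neighbours of `v`. The last bag before the position
    -- has no such witness, hence `∸ 1`.
    all-behind : ∀ v Bs → AllPairs Exact Bs → All Big Bs → All (Behind v) (take (pos v Bs ∸ 1) Bs)
    all-behind v [] _ _ = []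
    all-behind v (B ∷ Bs) (ex ∷ exs) (b ∷ bs) with col? (Out v ∩ B) τ
    ... | no _ = []
    ... | yes _ with pos v Bs | all-behind v Bs exs bs | (λ {n} → first-bag {P = Exact B} v Bs {n})
    ...   | zero | _ | _ = []
    ...   | suc n | ih | fst with B″ , ex″ , b″ , s″ ← fst {n} ≤-refl ex bs =
      behind {v} {B} {B″} s″ ex″ b″ ∷ ih

    all-ahead : ∀ v Bs → AllPairs Exact Bs → All (Ahead v) (drop (suc (pos v Bs)) Bs)
    all-ahead v [] _ = []
    all-ahead v (B ∷ Bs) (ex ∷ exs) with col? (Out v ∩ B) τ
    ... | yes _ = all-ahead v Bs exs
    ... | no big = mapᴬ (λ {B′} e → ahead {v} {B} {B′} big e) ex

    no-back : ∀ {u v} Bs → AllPairs Exact Bs → All Big Bs → u ⟶ v → 2 + pos v Bs ≤ pos u Bs → ⊥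
    no-back {u} {v} (B ∷ Bs) (ex ∷ exs) (b ∷ bs) uv le with col? (Out v ∩ B) τ | col? (Out u ∩ B) τ
    no-back {u} {v} (B ∷ Bs) (ex ∷ exs) (b ∷ bs) uv () | _ | no _
    no-back {u} {v} (B ∷ Bs) (ex ∷ exs) (b ∷ bs) uv (s≤s le) | yes _ | yes _ = no-back Bs exs bs uv le
    no-back {u} {v} (B ∷ Bs) (ex ∷ exs) (b ∷ bs) uv (s≤s le) | no big | yes _
      with B′ , e , b′ , s ← first-bag {P = Exact B} u Bs le ex bs = no-jump {B′ = B′} uv s (ahead {v} {B} {B′} big e) b′

    -- Bags are non-empty and pairwise disjoint, so representatives are distinct.
    chain-short : ∀ Bs → AllPairs Exact Bs → All Big Bs → length Bs ≤ size D
    chain-short Bs exs bs = let L , len , u , _ = reps Bs exs bs in subst (_≤ size D) len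
        (≤-trans (excl-length (allFin _) u)
          (≤-reflexive (trans (cong₂ _+_ (length-tabulate {n = size D} id) (none L)) (+-identityʳ _))))
      where
      open Exclude (_≟F_ {size D})
      none : ∀ L → length (excl (allFin _) L) ≡ 0
      none L with excl (allFin _) L | (λ {x} → excl-∈ (allFin _) {L} {x})
      ... | [] | _ = refl
      ... | x ∷ _ | h = contradiction (∈-allFin x) (proj₂ (h (here refl)))
      reps : ∀ Bs → AllPairs Exact Bs → All Big Bs →
        ∃ λ (L : List V) → length L ≡ length Bs × Unique L × All (λ l → Any (l ∈_) Bs) L
      reps [] _ _ = [] , refl , [] , []
      reps (B ∷ Bs) (ex ∷ exs) (b ∷ bs) with any? (_∈? B) | reps Bs exs bs
      ... | no n | _ = contradiction (col-∅ (λ p → n (_ , p))) b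
      ... | yes (x , x∈) | L , len , u , L∈ = x ∷ L , cong suc len ,
        mapᴬ (λ l∈ → let B′ , B′∈ , l∈B′ = find l∈ in proj₂ (sep (lookupᴬ ex B′∈) x∈ l∈B′)) L∈ ∷ u ,
        here x∈ ∷ mapᴬ there L∈

    drop-two : ∀ i (Bs : List (Sub (size D))) → length (drop (i ∸ 1) Bs) ≤ 2 + length (drop (suc i) Bs)
    drop-two i [] = ≤-trans (≤-reflexive (empty (i ∸ 1))) z≤n
      where
      empty : ∀ j → length (drop j ([] {A = Sub (size D)})) ≡ 0
      empty zero = refl
      empty (suc j) = refl
    drop-two zero (B ∷ Bs) = n≤1+n _
    drop-two (suc zero) (B ∷ []) = s≤s z≤n
    drop-two (suc zero) (B ∷ B′ ∷ Bs) = ≤-refl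
    drop-two (suc (suc i)) (B ∷ Bs) = drop-two (suc i) Bs

    -- A layer `i` that is hard to colour contains a `Triple`, which fits between the bags before
    -- `i ∸ 1` and those after `i`. At most two bags give way to three, so the chain grows, and
    -- `chain-short` limits how often.
    chain-col : ∀ fuel Bs → AllPairs Exact Bs → All Big Bs → size D < fuel + length Bs →
      Col full (triple-bound + triple-bound)
    chain-col zero Bs exs bs lt = contradiction (chain-short Bs exs bs) (λ le → <⇒≱ lt le)
    chain-col (suc fuel) Bs exs bs lt with all-or-some (λ x → triple (Layer (pos x Bs)))
      where
      Layer : ℕ → Sub (size D)
      Layer i = full ∩ sub (λ x → pos x Bs ≡ i) (λ x → pos x Bs ≟ℕ i)
    ... | inj₁ small = col-parity (λ v → pos v Bs) mono layer
      where
      mono : ∀ {x y} → x ∈ full → y ∈ full → x ⟶ y → pos x Bs ≤ suc (pos y Bs)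
      mono {x} {y} _ _ xy with pos x Bs ≤? suc (pos y Bs)
      ... | yes le = le
      ... | no n = ⊥-elim (no-back Bs exs bs xy (≰⇒> n))
      layer : ∀ i → Col (full ∩ sub (λ x → pos x Bs ≡ i) (λ x → pos x Bs ≟ℕ i)) triple-bound
      layer i with any? (λ x → pos x Bs ≟ℕ i)
      ... | yes (x , refl) = small x
      ... | no n = col-∅ (λ { (_ , e) → n (_ , e) })
    ... | inj₂ (x , T) = chain-col fuel Bs′ exs′ bs′ (≤-trans lt grown)
      where
      open Triple T
      i = pos x Bs
      Bs′ : List (Sub (size D))
      Bs′ = take (i ∸ 1) Bs ++ (B₁ ∷ B₂ ∷ B₃ ∷ drop (suc i) Bs)
      bh : ∀ {y} → pos y Bs ≡ i → All (Behind y) (take (i ∸ 1) Bs)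
      bh {y} e = subst (λ j → All (Behind y) (take (j ∸ 1) Bs)) e (all-behind y Bs exs bs)
      ah : ∀ {y} → pos y Bs ≡ i → All (Ahead y) (drop (suc i) Bs)
      ah {y} e = subst (λ j → All (Ahead y) (drop (suc j) Bs)) e (all-ahead y Bs exs)
      later : ∀ {B} → (∀ {y} → y ∈ B → pos y Bs ≡ i) → All (Exact B) (drop (suc i) Bs)
      later B⊆ = tabulateᴬ (λ C∈ → exact (λ y∈ z∈ → lookupᴬ (ah (B⊆ y∈)) C∈ _ z∈))
      earlier : ∀ {B C} → (∀ {y} → y ∈ B → pos y Bs ≡ i) → C ∈ₗ take (i ∸ 1) Bs → Exact C B
      earlier B⊆ C∈ = exact (λ z∈ y∈ → let n , ne = lookupᴬ (bh (B⊆ y∈)) C∈ _ z∈ in n , ne ∘ sym)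
      cross : ∀ {C} → C ∈ₗ take (i ∸ 1) Bs → All (Exact C) (drop (suc i) Bs)
      cross = pairs i Bs exs
        where
        pairs : ∀ i Bs → AllPairs Exact Bs → ∀ {C} → C ∈ₗ take (i ∸ 1) Bs → All (Exact C) (drop (suc i) Bs)
        pairs (suc (suc i)) (B ∷ Bs) (ex ∷ exs) (here refl) = All-drop⁺ (suc (suc i)) ex
        pairs (suc (suc i)) (B ∷ Bs) (ex ∷ exs) (there p) = pairs (suc i) Bs exs p
      exs′ : AllPairs Exact Bs′
      exs′ = AllPairs-++⁺ (AllPairs-take⁺ (i ∸ 1) exs)
        ((ex₁₂ ∷ ex₁₃ ∷ later {B₁} (proj₂ ∘ B₁⊆)) ∷ (ex₂₃ ∷ later {B₂} (proj₂ ∘ B₂⊆)) ∷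
          later {B₃} (proj₂ ∘ B₃⊆) ∷ AllPairs-drop⁺ (suc i) exs)
        (tabulateᴬ (λ {C} C∈ → earlier {B₁} {C} (proj₂ ∘ B₁⊆) C∈ ∷ earlier {B₂} {C} (proj₂ ∘ B₂⊆) C∈ ∷
          earlier {B₃} {C} (proj₂ ∘ B₃⊆) C∈ ∷ cross C∈))
      bs′ : All Big Bs′
      bs′ = All-++⁺ (All-take⁺ (i ∸ 1) bs) (big₁ ∷ big₂ ∷ big₃ ∷ All-drop⁺ (suc i) bs)
      grown : suc fuel + length Bs ≤ fuel + length Bs′
      grown = begin
        suc fuel + length Bs   ≡⟨ sym (+-suc fuel (length Bs)) ⟩
        fuel + suc (length Bs)
          ≡⟨ cong (λ z → fuel + suc z) (trans (sym (cong length (take++drop≡id (i ∸ 1) Bs))) (length-++ (take (i ∸ 1) Bs))) ⟩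
        fuel + suc (length (take (i ∸ 1) Bs) + length (drop (i ∸ 1) Bs))
          ≤⟨ +-monoʳ-≤ fuel (s≤s (+-monoʳ-≤ (length (take (i ∸ 1) Bs)) (drop-two i Bs))) ⟩
        fuel + suc (length (take (i ∸ 1) Bs) + (2 + length (drop (suc i) Bs)))
          ≡⟨ cong (fuel +_) (trans (sym (+-suc _ _)) (sym (length-++ (take (i ∸ 1) Bs)))) ⟩
        fuel + length Bs′ ∎
        where open ≤-Reasoning

  delta : ∀ {D} → Dense c₀ c h f q r D → Dig.Col D full (triple-bound + triple-bound)
  delta {D} dense = chain-col dense (suc (size D)) [] [] [] (≤-reflexive (sym (+-identityʳ _)))

-- Quasi-transitive digraphs

match : List ℕ → List ℕ → ℕ → ℕ
match (x ∷ xs) (y ∷ ys) γ with γ ≟ℕ x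
... | yes _ = y
... | no _ = match xs ys γ
match _ _ γ = γ

match-∈ : ∀ xs ys {γ} → length xs ≤ length ys → γ ∈ₗ xs → match xs ys γ ∈ₗ ys
match-∈ (x ∷ xs) (y ∷ ys) {γ} (s≤s le) p with γ ≟ℕ x
... | yes _ = here refl
match-∈ (x ∷ xs) (y ∷ ys) (s≤s le) (here e) | no ne = contradiction e ne
match-∈ (x ∷ xs) (y ∷ ys) (s≤s le) (there p) | no ne = there (match-∈ xs ys le p)

match-inj : ∀ xs ys {γ δ} → length xs ≤ length ys → Unique ys → γ ∈ₗ xs → δ ∈ₗ xs →
  match xs ys γ ≡ match xs ys δ → γ ≡ δ
match-inj (x ∷ xs) (y ∷ ys) {γ} {δ} (s≤s le) (n ∷ u) p q e with γ ≟ℕ x | δ ≟ℕ x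
... | yes a | yes b = trans a (sym b)
match-inj (x ∷ xs) (y ∷ ys) (s≤s le) (n ∷ u) p (here b) e | yes a | no b′ = contradiction b b′
match-inj (x ∷ xs) (y ∷ ys) (s≤s le) (n ∷ u) p (there q) e | yes a | no b′ = contradiction e (lookupᴬ n (match-∈ xs ys le q))
match-inj (x ∷ xs) (y ∷ ys) (s≤s le) (n ∷ u) (here a) q e | no a′ | yes b = contradiction a a′
match-inj (x ∷ xs) (y ∷ ys) (s≤s le) (n ∷ u) (there p) q e | no a′ | yes b = contradiction (sym e) (lookupᴬ n (match-∈ xs ys le p))
match-inj (x ∷ xs) (y ∷ ys) (s≤s le) (n ∷ u) (here a) q e | no a′ | no b′ = contradiction a a′
match-inj (x ∷ xs) (y ∷ ys) (s≤s le) (n ∷ u) (there p) (here b) e | no a′ | no b′ = contradiction b b′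
match-inj (x ∷ xs) (y ∷ ys) (s≤s le) (n ∷ u) (there p) (there q) e | no a′ | no b′ = match-inj xs ys le u p q e

module QuasiTransitive (D : Digraph)
  (quasi : ∀ {x y z} → arc D x y ≡ true → arc D y z ≡ true → arc D x z ≡ true ⊎ arc D z x ≡ true) (k : ℕ) where
  open Dig D

  -- Acyclicity reduced to triples of vertices: recolourings can be tested on triangles, and no rank
  -- has to be maintained.
  TriangleFree : Sub (size D) → Set
  TriangleFree X = Σ (V → ℕ) λ κ → (∀ {x} → x ∈ X → κ x < k) × ¬ MonoTriangle κ X

  col⇒free : ∀ {X} → Col X k → TriangleFree X
  col⇒free c = col c , col< c , col-no-triangle c

  -- In a quasi-transitive digraph a triangle-free set is transitive, hence acyclic.
  free⇒col : ∀ {X} → TriangleFree X → Col X k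
  free⇒col {X} (κ , κ< , no-tri) with peel (λ x y → (x ⟶? y) ×-dec (κ x ≟ℕ κ y)) X
  ... | inj₁ (rk , dn) with rk′ , fl ← flip-rank rk = record
    { col = κ ; rk = rk′ ; col< = κ< ; up = λ p q r e → fl (dn p q (r , e)) }
  ... | inj₂ (S , S⊆ , start , next) = ⊥-elim (loop (pigeonhole (n<1+n (size D)) (λ i → proj₁ (g (toℕ i)))))
    where
    g : ℕ → ∃ S
    g zero = start
    g (suc i) = let y , s , _ = next (proj₂ (g i)) in y , s
    v : ℕ → V
    v i = proj₁ (g i)
    g∈ : ∀ i → v i ∈ X
    g∈ i = S⊆ (proj₂ (g i))
    R : V → V → Set
    R x y = x ⟶ y × κ x ≡ κ y
    R-trans : ∀ {x y z} → x ∈ X → y ∈ X → z ∈ X → R x y → R y z → R x z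
    R-trans px py pz (xy , e) (yz , f) with quasi xy yz
    ... | inj₁ xz = xz , trans e f
    ... | inj₂ zx = contradiction (tri px py pz xy yz zx e f) no-tri
    steps : ∀ i d → R (v i) (v (suc d + i))
    steps i zero = proj₂ (proj₂ (next (proj₂ (g i))))
    steps i (suc d) = R-trans (g∈ i) (g∈ (suc d + i)) (g∈ (suc (suc d) + i)) (steps i d) (proj₂ (proj₂ (next (proj₂ (g (suc d + i))))))
    loop : (∃₂ λ i j → toℕ i < toℕ j × v (toℕ i) ≡ v (toℕ j)) → ⊥
    loop (i , j , lt , e) = irrefl (subst (λ y → v (toℕ i) ⟶ y) (trans (cong v sum) (sym e))
      (proj₁ (steps (toℕ i) (toℕ j ∸ suc (toℕ i)))))
      where
      sum : suc (toℕ j ∸ suc (toℕ i)) + toℕ i ≡ toℕ j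
      sum = trans (sym (+-suc _ (toℕ i))) (m∸n+n≡m lt)

  -- Strong connectivity in closure form: a set that meets `B` and is closed under arcs inside `B`
  -- contains all of `B`.
  Linked : Sub (size D) → Set₁
  Linked B = ∀ (S : Sub (size D)) {x} → x ∈ B → x ∈ S →
    (∀ {y z} → y ∈ B → y ∈ S → z ∈ B → y ⟶ z → z ∈ S) → ∀ {y} → y ∈ B → y ∈ S

  record Apart (X A B : Sub (size D)) : Set₁ where
    field
      A⊆ : ∀ {x} → x ∈ A → x ∈ X
      B⊆ : ∀ {x} → x ∈ B → x ∈ X
      a₀ : ∃ (_∈ A)
      b₀ : ∃ (_∈ B)
      o-AB : ∀ {a b} → a ∈ A → b ∈ B → a o b × a ≢ b
      linkA : Linked A
      linkB : Linked B

  apart-sym : ∀ {X A B} → Apart X A B → Apart X B A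
  apart-sym s = record { A⊆ = B⊆ ; B⊆ = A⊆ ; a₀ = b₀ ; b₀ = a₀ ; linkA = linkB ; linkB = linkA
    ; o-AB = λ p q → let aob , ne = o-AB q p in o-sym aob , ne ∘ sym }
    where open Apart s

  -- If `z → a`, quasi-transitivity lets arcs between `z` and `B` only leave `z`, and `Out z` is
  -- closed along arcs of `B`. If `a → z`, they only enter `z`, and the complement of `In z` is
  -- closed. By `Linked`, `z` is adjacent to all of `B` or to none.
  spread : ∀ {a B z} → (∀ {b} → b ∈ B → a o b) → Linked B → ¬ a o z → ∀ {b} → b ∈ B → z o b → ∀ {b′} → b′ ∈ B → z o b′
  spread {a} {B} {z} a-o link az {b} b∈ (zb , bz) {b′} b′∈ with adj? z b′ | adj? a z
  ... | inj₂ (inj₂ zo) | _ = zo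
  ... | _ | inj₂ (inj₂ ao) = contradiction ao az
  ... | inj₁ zb′ | inj₁ a→z = ⊥-elim (clash (quasi a→z zb′))
    where
    clash : a ⟶ b′ ⊎ b′ ⟶ a → ⊥
    clash (inj₁ r) = proj₁ (a-o b′∈) r
    clash (inj₂ r) = proj₂ (a-o b′∈) r
  ... | inj₂ (inj₁ b′z) | inj₂ (inj₁ z→a) = ⊥-elim (clash (quasi b′z z→a))
    where
    clash : b′ ⟶ a ⊎ a ⟶ b′ → ⊥
    clash (inj₁ r) = proj₂ (a-o b′∈) r
    clash (inj₂ r) = proj₁ (a-o b′∈) r
  ... | inj₁ zb′ | inj₂ (inj₁ z→a) = contradiction (link (Out z) b′∈ zb′ closed b∈) zb
    where
    closed : ∀ {x y} → x ∈ B → z ⟶ x → y ∈ B → x ⟶ y → z ⟶ y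
    closed x∈ zx y∈ xy with quasi zx xy
    ... | inj₁ zy = zy
    ... | inj₂ yz with quasi yz z→a
    ...   | inj₁ r = contradiction r (proj₂ (a-o y∈))
    ...   | inj₂ r = contradiction r (proj₁ (a-o y∈))
  ... | inj₂ (inj₁ b′z) | inj₁ a→z = contradiction b′z (proj₂ (link (full ∖ In z) b∈ (tt , bz) closed b′∈))
    where
    closed : ∀ {x y} → x ∈ B → x ∈ (full ∖ In z) → y ∈ B → x ⟶ y → y ∈ (full ∖ In z)
    closed {x} {y} x∈ (_ , nxz) y∈ xy = tt , λ yz → case quasi xy yz of λ
      { (inj₁ xz) → nxz xz
      ; (inj₂ zx) → case quasi a→z zx of λ { (inj₁ r) → proj₁ (a-o x∈) r ; (inj₂ r) → proj₂ (a-o x∈) r } }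

  tri? : ∀ κ X → Dec (MonoTriangle κ X)
  tri? κ X = map′ (λ { (x , y , z , (a , b , c) , (d , e , f) , g , h) → tri a b c d e f g h })
      (λ { (tri a b c d e f g h) → _ , _ , _ , (a , b , c) , (d , e , f) , g , h })
    (any? (λ x → any? (λ y → any? (λ z →
      ((x ∈? X) ×-dec (y ∈? X) ×-dec (z ∈? X)) ×-dec ((x ⟶? y) ×-dec (y ⟶? z) ×-dec (z ⟶? x)) ×-dec
      (κ x ≟ℕ κ y) ×-dec (κ y ≟ℕ κ z)))))

  palette : (V → ℕ) → Sub (size D) → List ℕ
  palette κ Y = filter (λ γ → any? (λ y → (y ∈? Y) ×-dec (κ y ≟ℕ γ))) (upTo k)

  module Recolour {X A B : Sub (size D)} (ap : Apart X A B)
    (φ : V → ℕ) (φ< : ∀ {x} → x ∈ (X ∖ A) → φ x < k) (φ-free : ¬ MonoTriangle φ (X ∖ A))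
    (ψ : V → ℕ) (ψ< : ∀ {x} → x ∈ (X ∖ B) → ψ x < k) (ψ-free : ¬ MonoTriangle ψ (X ∖ B))
    (fits : length (palette ψ A) ≤ length (palette φ B)) where
    open Apart ap

    PA PB : List ℕ
    PA = palette ψ A
    PB = palette φ B

    A⊆X∖B : ∀ {x} → x ∈ A → x ∈ (X ∖ B)
    A⊆X∖B a∈ = A⊆ a∈ , λ b∈ → proj₂ (o-AB a∈ b∈) refl

    ψ∈ : ∀ {a} → a ∈ A → ψ a ∈ₗ PA
    ψ∈ a∈ = ∈-filter⁺ (λ γ → any? (λ y → (y ∈? A) ×-dec (ψ y ≟ℕ γ))) (∈-upTo⁺ (ψ< (A⊆X∖B a∈))) (_ , a∈ , refl)

    PB-split : ∀ {γ} → γ ∈ₗ PB → γ ∈ₗ upTo k × ∃ λ b → b ∈ B × φ b ≡ γ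
    PB-split = ∈-filter⁻ (λ γ → any? (λ y → (y ∈? B) ×-dec (φ y ≟ℕ γ))) {xs = upTo k}

    -- The colours of `ψ` on `A` are renamed injectively into those of `φ` on `B`, so every colour
    -- on `A` also occurs on `B`, where `φ` is kept.
    κ : V → ℕ
    κ x with x ∈? A
    ... | yes _ = match PA PB (ψ x)
    ... | no _ = φ x

    κ-in : ∀ {x} → x ∈ A → κ x ≡ match PA PB (ψ x)
    κ-in {x} p with x ∈? A
    ... | yes _ = refl
    ... | no n = contradiction p n

    κ-out : ∀ {x} → x ∉ A → κ x ≡ φ x
    κ-out {x} n with x ∈? A
    ... | yes p = contradiction p n
    ... | no _ = refl

    κ< : ∀ {x} → x ∈ X → κ x < k
    κ< {x} p with x ∈? A
    ... | yes a = ∈-upTo⁻ (proj₁ (PB-split (match-∈ PA PB fits (ψ∈ a))))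
    ... | no n = φ< (p , n)

    Bigger : Set₁
    Bigger = ∃ λ A′ → Apart X A′ B × (∀ {x} → x ∈ A → x ∈ A′) × ∃ λ p → p ∈ A′ × p ∉ A

    -- Pick `b` in `B` with the colour of the triangle. Adjacency of `p` or `q` to `b` would make
    -- `b` adjacent to a vertex of `A` or close a triangle on `b`, `p`, `q` that is monochromatic
    -- under `φ`. By `spread`, `p` and `q` avoid all of `B`; through the triangle they join `A` in
    -- one strongly connected set.
    mixed : ∀ {a p q} → a ∈ A → p ∈ X → p ∉ A → q ∈ X → a ⟶ p → p ⟶ q → q ⟶ a → κ a ≡ κ p → κ p ≡ κ q → Bigger
    mixed {a} {p} {q} a∈ p∈ p∉ q∈ ap pq qa e f = A′ , grown , inj₁ , p , inj₂ (inj₁ refl) , p∉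
      where
      b-data : ∃ λ b → b ∈ B × φ b ≡ κ a
      b-data = let b , b∈ , eb = proj₂ (PB-split (match-∈ PA PB fits (ψ∈ a∈))) in b , b∈ , trans eb (sym (κ-in a∈))
      b = proj₁ b-data
      b∈ = proj₁ (proj₂ b-data)
      φb = proj₂ (proj₂ b-data)
      a-o : ∀ {b} → b ∈ B → a o b
      a-o b∈ = proj₁ (o-AB a∈ b∈)
      no-adj : ∀ {x y} → x o y → ¬ (x ⟶ y ⊎ y ⟶ x)
      no-adj (n , m) (inj₁ r) = n r
      no-adj (n , m) (inj₂ r) = m r
      b∉ : b ∉ A
      b∉ b∈A = proj₂ (o-AB b∈A b∈) refl
      p-o-b : p o b
      p-o-b = (λ pb → no-adj (a-o b∈) (quasi ap pb)) , λ bp → case q ∈? A of λ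
        { (yes q∈A) → no-adj (o-sym (proj₁ (o-AB q∈A b∈))) (quasi bp pq)
        ; (no q∉) → case quasi bp pq of λ
          { (inj₁ bq) → no-adj (o-sym (a-o b∈)) (quasi bq qa)
          ; (inj₂ qb) → φ-free (tri (B⊆ b∈ , b∉) (p∈ , p∉) (q∈ , q∉) bp pq qb
              (trans φb (trans e (κ-out p∉))) (trans (sym (κ-out p∉)) (trans f (κ-out q∉)))) } }
      q-o-b : q o b
      q-o-b = (λ qb → no-adj p-o-b (quasi pq qb)) , λ bq → no-adj (o-sym (a-o b∈)) (quasi bq qa)
      A′ : Sub (size D)
      A′ = sub (λ x → x ∈ A ⊎ (x ≡ p ⊎ x ≡ q)) (λ x → (x ∈? A) ⊎-dec ((x ≟F p) ⊎-dec (x ≟F q)))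
      o′ : ∀ {x y} → x ∈ A′ → y ∈ B → x o y × x ≢ y
      o′ (inj₁ x∈) y∈ = o-AB x∈ y∈
      o′ (inj₂ (inj₁ refl)) y∈ = spread {B = B} a-o linkB (λ { (n , _) → n ap }) b∈ p-o-b y∈ , λ { refl → proj₁ (a-o y∈) ap }
      o′ (inj₂ (inj₂ refl)) y∈ = spread {B = B} a-o linkB (λ { (_ , n) → n qa }) b∈ q-o-b y∈ , λ { refl → proj₂ (a-o y∈) qa }
      link′ : Linked A′
      link′ S {x} x∈ xS closed = all
        where
        A-from : ∀ {y} → y ∈ A → y ∈ S → a ∈ S
        A-from y∈ yS = linkA S y∈ yS (λ u uS w r → closed (inj₁ u) uS (inj₁ w) r) a∈
        q→a : q ∈ S → a ∈ S
        q→a qS = closed (inj₂ (inj₂ refl)) qS (inj₁ a∈) qa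
        p→q : p ∈ S → q ∈ S
        p→q pS = closed (inj₂ (inj₁ refl)) pS (inj₂ (inj₂ refl)) pq
        aS : a ∈ S
        aS = case x∈ of λ
          { (inj₁ x∈A) → A-from x∈A xS
          ; (inj₂ (inj₁ refl)) → q→a (p→q xS)
          ; (inj₂ (inj₂ refl)) → q→a xS }
        pS : p ∈ S
        pS = closed (inj₁ a∈) aS (inj₂ (inj₁ refl)) ap
        all : ∀ {y} → y ∈ A′ → y ∈ S
        all (inj₁ y∈) = linkA S a∈ aS (λ u uS w r → closed (inj₁ u) uS (inj₁ w) r) y∈
        all (inj₂ (inj₁ refl)) = pS
        all (inj₂ (inj₂ refl)) = p→q pS
      grown : Apart X A′ B
      grown = record { A⊆ = λ { (inj₁ x∈) → A⊆ x∈ ; (inj₂ (inj₁ refl)) → p∈ ; (inj₂ (inj₂ refl)) → q∈ }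
        ; B⊆ = B⊆ ; a₀ = a , inj₁ a∈ ; b₀ = b₀ ; o-AB = o′ ; linkA = link′ ; linkB = linkB }

    PB-unique : Unique PB
    PB-unique = Unique-filter⁺ (λ γ → any? (λ y → (y ∈? B) ×-dec (φ y ≟ℕ γ))) (Unique-upTo⁺ k)

    same-ψ : ∀ {x y} → x ∈ A → y ∈ A → κ x ≡ κ y → ψ x ≡ ψ y
    same-ψ a b e = match-inj PA PB fits PB-unique (ψ∈ a) (ψ∈ b) (trans (sym (κ-in a)) (trans e (κ-in b)))

    same-φ : ∀ {x y} → x ∉ A → y ∉ A → κ x ≡ κ y → φ x ≡ φ y
    same-φ a b e = trans (sym (κ-out a)) (trans e (κ-out b))

    recolour : TriangleFree X ⊎ Bigger
    recolour with tri? κ X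
    ... | no none = inj₁ (κ , κ< , none)
    ... | yes (tri {x} {y} {z} x∈ y∈ z∈ xy yz zx e f) = inj₂ (enlarge (x ∈? A) (y ∈? A) (z ∈? A))
      where
      enlarge : Dec (x ∈ A) → Dec (y ∈ A) → Dec (z ∈ A) → Bigger
      enlarge (yes p) (no n) _ = mixed p y∈ n z∈ xy yz zx e f
      enlarge _ (yes p) (no n) = mixed p z∈ n x∈ yz zx xy f (sym (trans e f))
      enlarge (no n) _ (yes p) = mixed p x∈ n y∈ zx xy yz (sym (trans e f)) e
      enlarge (no a) (no b) (no c) = contradiction
        (tri (x∈ , a) (y∈ , b) (z∈ , c) xy yz zx (same-φ a b e) (same-φ b c f)) φ-free
      enlarge (yes a) (yes b) (yes c) = contradiction
        (tri (A⊆X∖B a) (A⊆X∖B b) (A⊆X∖B c) xy yz zx (same-ψ a b e) (same-ψ b c f)) ψ-free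

  Clique : Sub (size D) → Set
  Clique T = ∀ {x y} → x ∈ T → y ∈ T → x o y → x ≡ y

  module _ (cliques : ∀ T → Clique T → Col T k) where

    free : ∀ m X → count X ≤ m → TriangleFree X
    -- The side with the smaller palette is renamed. A failure enlarges that side, so the sum of the
    -- two complements in `X` decreases.
    grow : ∀ m X → (∀ Y → count Y < count X → TriangleFree Y) → ∀ {A B} → Apart X A B →
      count (X ∖ A) + count (X ∖ B) ≤ m → TriangleFree X

    free m X le with any? (λ u → any? (λ v → ((u ∈? X) ×-dec (v ∈? X)) ×-dec (u o? v) ×-dec ¬? (u ≟F v)))
    ... | no none = col⇒free (cliques X (λ {x} {y} p q xoy → decidable-stable (x ≟F y) (λ ne → none (x , y , (p , q) , xoy , ne))))
    free zero X le | yes (u , v , (u∈ , _) , _) =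
      contradiction (count-strict (X ∖ X) X proj₁ u∈ (λ q → proj₂ q u∈)) (λ lt → <⇒≱ lt (≤-trans le z≤n))
    free (suc m) X le | yes (u , v , (u∈ , v∈) , uov , ne) =
      grow _ X (λ Y lt → free m Y (≤-pred (≤-trans lt le))) {sing u} {sing v} (record
        { A⊆ = λ { refl → u∈ } ; B⊆ = λ { refl → v∈ } ; a₀ = u , refl ; b₀ = v , refl
        ; o-AB = λ { refl refl → uov , ne } ; linkA = λ { S refl xS _ refl → xS } ; linkB = λ { S refl xS _ refl → xS } })
        (≤-refl {count (X ∖ sing u) + count (X ∖ sing v)})

    grow m X ih {A} {B} ap le
      with φ , φ< , φ-free ← ih (X ∖ A) (count-strict (X ∖ A) X proj₁
             (Apart.A⊆ ap (proj₂ (Apart.a₀ ap))) (λ q → proj₂ q (proj₂ (Apart.a₀ ap))))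
         | ψ , ψ< , ψ-free ← ih (X ∖ B) (count-strict (X ∖ B) X proj₁
             (Apart.B⊆ ap (proj₂ (Apart.b₀ ap))) (λ q → proj₂ q (proj₂ (Apart.b₀ ap))))
      with ≤-total (length (palette ψ A)) (length (palette φ B))
    ... | inj₁ fits with Recolour.recolour ap φ φ< φ-free ψ ψ< ψ-free fits
    ...   | inj₁ done = done
    ...   | inj₂ (A′ , ap′ , A⊆A′ , p , p∈ , p∉) with m | ≤-trans (+-mono-<-≤
              (count-strict (X ∖ A′) (X ∖ A) (λ { (x , n) → x , n ∘ A⊆A′ })
                (Apart.A⊆ ap′ p∈ , p∉) (λ q → proj₂ q p∈)) (≤-refl {count (X ∖ B)})) le
    ...     | zero | ()
    ...     | suc m′ | s≤s le′ = grow m′ X ih ap′ le′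
    grow m X ih {A} {B} ap le | inj₂ fits with Recolour.recolour (apart-sym ap) ψ ψ< ψ-free φ φ< φ-free fits
    ...   | inj₁ done = done
    ...   | inj₂ (B′ , ap′ , B⊆B′ , p , p∈ , p∉) with m | ≤-trans (+-mono-≤-< (≤-refl {count (X ∖ A)})
              (count-strict (X ∖ B′) (X ∖ B) (λ { (x , n) → x , n ∘ B⊆B′ })
                (Apart.A⊆ ap′ p∈ , p∉) (λ q → proj₂ q p∈))) le
    ...     | zero | ()
    ...     | suc m′ | s≤s le′ = grow m′ X ih (apart-sym ap′) le′

    reduce : ∀ X → Col X k
    reduce X = free⇒col (free (count X) X ≤-refl)

-- Copies and induced subdigraphs

last-or-step : ∀ m (t : Fin (suc m)) → t ≡ fromℕ m ⊎ ∃ λ t′ → t ≡ inject₁ t′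
last-or-step zero zero = inj₁ refl
last-or-step (suc m) zero = inj₂ (zero , refl)
last-or-step (suc m) (suc t) with last-or-step m t
... | inj₁ refl = inj₁ refl
... | inj₂ (t′ , refl) = inj₂ (suc t′ , refl)

col⇒dichromatic : ∀ {D k} → Dig.Col D full k → DichromaticAtMost D k
col⇒dichromatic {D} {k} C = (λ x → fromℕ< (col< {x} tt)) , acyclic
  where
  open Dig D using (V; _⟶_; no-endless)
  open Dig.Col C
  acyclic : ∀ a → Acyclic D (λ x → fromℕ< (col< {x} tt) ≡ a)
  acyclic a cyc = no-endless rk (λ x → ∃ λ t → v t ≡ x) (v zero , zero , refl)
      (λ { (t , refl) → case last-or-step m t of λ
        { (inj₁ refl) → v zero , (zero , refl) , up tt tt close (same (fromℕ m) zero)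
        ; (inj₂ (t′ , refl)) → v (suc t′) , (suc t′ , refl) , up tt tt (step t′) (same (inject₁ t′) (suc t′)) } })
    where
    open CycleIn cyc
    same : ∀ s t → col (v s) ≡ col (v t)
    same s t = trans (sym (toℕ-fromℕ< (col< {v s} tt)))
      (trans (cong toℕ (trans (inside s) (sym (inside t)))) (toℕ-fromℕ< (col< {v t} tt)))

-- If ranks fail, `peel` leaves an endless monochromatic walk. Its first repetition bounds a segment
-- with distinct vertices, a cycle; looplessness excludes length one.
dichromatic⇒col : ∀ {D k} → DichromaticAtMost D k → Dig.Col D full k
dichromatic⇒col {D} {k} (c , acyclic) with peel (λ x y → Dig._⟶?_ D x y ×-dec (c x ≟F c y)) full
... | inj₁ (rk , dn) = let rk′ , fl = Dig.flip-rank D rk in record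
  { col = toℕ ∘ c ; rk = rk′ ; col< = λ {x} _ → toℕ<n (c x)
  ; up = λ p q r e → fl (dn p q (r , toℕ-injective e)) }
... | inj₂ (S , _ , start , next) = ⊥-elim (meet (first (suc (size D))))
  where
  open Dig D using (V; _⟶_; irrefl)
  g : ℕ → ∃ S
  g zero = start
  g (suc i) = let y , s , _ = next (proj₂ (g i)) in y , s
  v : ℕ → V
  v i = proj₁ (g i)
  v-arc : ∀ i → v i ⟶ v (suc i)
  v-arc i = proj₁ (proj₂ (proj₂ (next (proj₂ (g i)))))
  v-col : ∀ i → c (v i) ≡ c (v 0)
  v-col zero = refl
  v-col (suc i) = trans (sym (proj₂ (proj₂ (proj₂ (next (proj₂ (g i))))))) (v-col i)
  Distinct : ℕ → Set
  Distinct j = ∀ {a b} → a < j → b < j → v a ≡ v b → a ≡ b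
  Collision : Set
  Collision = ∃₂ λ i m → Distinct (i + suc m) × v i ≡ v (i + suc m)
  first : ∀ j → Distinct j ⊎ Collision
  first zero = inj₁ λ ()
  first (suc j) with first j
  ... | inj₂ r = inj₂ r
  ... | inj₁ d with any? (λ (i : Fin j) → v (toℕ i) ≟F v j)
  ...   | yes (i , e) = inj₂ (toℕ i , j ∸ suc (toℕ i) , subst Distinct (sym eq) d , trans e (cong v (sym eq)))
    where
    eq : toℕ i + suc (j ∸ suc (toℕ i)) ≡ j
    eq = trans (+-suc (toℕ i) _) (trans (+-comm (suc (toℕ i)) _) (m∸n+n≡m (toℕ<n i)))
  ...   | no n = inj₁ d′
    where
    fresh : ∀ {a} → a < j → v a ≢ v j
    fresh lt e = n (fromℕ< lt , trans (cong v (toℕ-fromℕ< lt)) e)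
    d′ : Distinct (suc j)
    d′ {a} {b} la lb e with a ≟ℕ j | b ≟ℕ j
    ... | yes refl | yes refl = refl
    ... | yes refl | no b≢ = contradiction (sym e) (fresh (≤∧≢⇒< (≤-pred lb) b≢))
    ... | no a≢ | yes refl = contradiction e (fresh (≤∧≢⇒< (≤-pred la) a≢))
    ... | no a≢ | no b≢ = d (≤∧≢⇒< (≤-pred la) a≢) (≤∧≢⇒< (≤-pred lb) b≢) e
  meet : Distinct (suc (size D)) ⊎ Collision → ⊥
  meet (inj₁ d) with i , j , lt , e ← pigeonhole (n<1+n (size D)) (λ i → v (toℕ i)) = <⇒≢ lt (d (toℕ<n i) (toℕ<n j) e)
  meet (inj₂ (i , m , d , e)) = acyclic (c (v 0)) record
    { m = m ; long = long m e ; v = λ t → v (i + toℕ t)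
    ; distinct = λ {s} {t} eq → toℕ-injective (+-cancelˡ-≡ i _ _ (d (+-monoʳ-< i (toℕ<n s)) (+-monoʳ-< i (toℕ<n t)) eq))
    ; step = λ t → subst (_⟶ v (i + suc (toℕ t))) (cong (λ z → v (i + z)) (sym (toℕ-inject₁ t)))
        (subst (λ z → v (i + toℕ t) ⟶ v z) (sym (+-suc i (toℕ t))) (v-arc (i + toℕ t)))
    ; close = subst (_⟶ v (i + 0)) (cong (λ z → v (i + z)) (sym (toℕ-fromℕ m)))
        (subst (v (i + m) ⟶_) (sym (trans (cong v (+-identityʳ i)) (trans e (cong v (+-suc i m))))) (v-arc (i + m)))
    ; inside = λ t → v-col (i + toℕ t) }
    where
    long : ∀ m → v i ≡ v (i + suc m) → 1 ≤ m
    long zero e = contradiction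
      (subst (v i ⟶_) (sym (trans e (cong v (trans (+-suc i 0) (cong suc (+-identityʳ i)))))) (v-arc i)) irrefl
    long (suc m) _ = s≤s z≤n

lookup-unique : ∀ {a} {A : Set a} {xs : List A} → Unique xs → ∀ {i j} → lookup xs i ≡ lookup xs j → i ≡ j
lookup-unique (n ∷ u) {zero} {zero} e = refl
lookup-unique (n ∷ u) {zero} {suc j} e = contradiction e (lookupᴬ n (∈-lookup j))
lookup-unique (n ∷ u) {suc i} {zero} e = contradiction (sym e) (lookupᴬ n (∈-lookup i))
lookup-unique (n ∷ u) {suc i} {suc j} e = cong suc (lookup-unique u e)

module Induced (D : Digraph) (X : Sub (size D)) where

  members : List (Fin (size D))
  members = filter (_∈? X) (allFin (size D))

  ι : Fin (length members) → Fin (size D)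
  ι = lookup members

  induced : Digraph
  induced = record { size = length members ; arc = λ i j → arc D (ι i) (ι j)
    ; loopless = λ i → loopless D (ι i) ; oriented = λ i j → oriented D (ι i) (ι j) }

  ι-inj : ∀ {i j} → ι i ≡ ι j → i ≡ j
  ι-inj = lookup-unique (Unique-filter⁺ (_∈? X) (Unique-allFin⁺ (size D)))

  ι-∈ : ∀ i → ι i ∈ X
  ι-∈ i = proj₂ (∈-filter⁻ (_∈? X) {xs = allFin (size D)} (∈-lookup i))

  ι-surj : ∀ {x} → x ∈ X → ∃ λ i → ι i ≡ x
  ι-surj {x} p = let q = ∈-filter⁺ (_∈? X) (∈-allFin x) p in index q , sym (lookup-index q)

  copy-out : ∀ {H} → (φ : InducedIn H induced) → Σ (InducedIn H D) λ ψ → ∀ i → proj₁ ψ i ∈ X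
  copy-out (φ , inj , arcs) = (ι ∘ φ , inj ∘ ι-inj , arcs) , λ i → ι-∈ (φ i)

  free-induced : ∀ H → Free H D → Free H induced
  free-induced H free φ = free (proj₁ (copy-out {H} φ))

  col-out : ∀ {k} → Dig.Col induced full k → Dig.Col D X k
  col-out c = record
    { col = λ x → val x col (x ∈? X) ; rk = λ x → val x rk (x ∈? X)
    ; col< = λ {x} p → small p (x ∈? X)
    ; up = λ {x} {y} p q r e → rise p q r (x ∈? X) (y ∈? X) e }
    where
    open Dig.Col c
    val : ∀ x → (Fin (length members) → ℕ) → Dec (x ∈ X) → ℕ
    val x h (yes p) = h (proj₁ (ι-surj p))
    val x h (no _) = 0
    small : ∀ {x} → x ∈ X → (d : Dec (x ∈ X)) → val x col d < _
    small p (yes q) = col< tt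
    small p (no n) = contradiction p n
    rise : ∀ {x y} → x ∈ X → y ∈ X → arc D x y ≡ true → (d : Dec (x ∈ X)) (d′ : Dec (y ∈ X)) →
      val x col d ≡ val y col d′ → val x rk d < val y rk d′
    rise p q r (no n) _ _ = contradiction p n
    rise p q r (yes _) (no n) _ = contradiction q n
    rise p q r (yes p′) (yes q′) e = up tt tt
      (trans (cong₂ (arc D) (proj₂ (ι-surj p′)) (proj₂ (ι-surj q′))) r) e

copy? : ∀ H D → Dec (InducedIn H D)
copy? H D = map′ (λ { (v , inj , arcs) → lookupᵛ v , (λ {i} {j} → inj i j) , arcs }) from
  (vec-any? (size H) {P = λ v → (∀ i j → lookupᵛ v i ≡ lookupᵛ v j → i ≡ j) × (∀ i j → arc D (lookupᵛ v i) (lookupᵛ v j) ≡ arc H i j)}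
    (λ v → all? (λ i → all? (λ j → (lookupᵛ v i ≟F lookupᵛ v j) →-dec (i ≟F j))) ×-dec
           all? (λ i → all? (λ j → arc D (lookupᵛ v i) (lookupᵛ v j) ≟B arc H i j))))
  where
  from : InducedIn H D → _
  from (φ , inj , arcs) = tabulateᵛ φ ,
    (λ i j e → inj (trans (sym (lookup∘tabulate φ i)) (trans e (lookup∘tabulate φ j)))) ,
    (λ i j → trans (cong₂ (arc D) (lookup∘tabulate φ i) (lookup∘tabulate φ j)) (arcs i j))

module Glue (D₁ D₂ : Digraph) {f : Fin (size D₁) → Fin (size D₂) → Bool} {g : Fin (size D₂) → Fin (size D₁) → Bool}
  (ok : ∀ i j → f i j ≡ true → g j i ≡ false) (ok′ : ∀ i j → g i j ≡ true → f j i ≡ false) (D : Digraph) where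

  private n = size D₁

  glue-copy : (φ : InducedIn D₁ D) (ψ : InducedIn D₂ D) → (∀ i j → proj₁ φ i ≢ proj₁ ψ j) →
    (∀ i j → arc D (proj₁ φ i) (proj₁ ψ j) ≡ f i j) → (∀ j i → arc D (proj₁ ψ j) (proj₁ φ i) ≡ g j i) →
    Σ (InducedIn (glue D₁ D₂ f g ok ok′) D) λ χ →
      ∀ k → (∃ λ i → proj₁ χ k ≡ proj₁ φ i) ⊎ (∃ λ j → proj₁ χ k ≡ proj₁ ψ j)
  glue-copy (φ , φ-inj , φ-arc) (ψ , ψ-inj , ψ-arc) apart fwd bwd = (χ , inj , arcs) , image
    where
    h : Fin n ⊎ Fin (size D₂) → Fin (size D)
    h (inj₁ i) = φ i
    h (inj₂ j) = ψ j
    h-inj : ∀ s t → h s ≡ h t → s ≡ t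
    h-inj (inj₁ i) (inj₁ j) e = cong inj₁ (φ-inj e)
    h-inj (inj₁ i) (inj₂ j) e = contradiction e (apart i j)
    h-inj (inj₂ i) (inj₁ j) e = contradiction (sym e) (apart j i)
    h-inj (inj₂ i) (inj₂ j) e = cong inj₂ (ψ-inj e)
    χ : Fin (n + size D₂) → Fin (size D)
    χ k = h (splitAt n k)
    inj : Injective _≡_ _≡_ χ
    inj {k} {l} e = trans (sym (join-splitAt n (size D₂) k))
      (trans (cong (join n (size D₂)) (h-inj (splitAt n k) (splitAt n l) e)) (join-splitAt n (size D₂) l))
    arcs : ∀ k l → arc D (χ k) (χ l) ≡ arc (glue D₁ D₂ f g ok ok′) k l
    arcs k l with splitAt n k | splitAt n l
    ... | inj₁ i | inj₁ j = φ-arc i j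
    ... | inj₁ i | inj₂ j = fwd i j
    ... | inj₂ i | inj₁ j = bwd i j
    ... | inj₂ i | inj₂ j = ψ-arc i j
    image : ∀ k → (∃ λ i → χ k ≡ φ i) ⊎ (∃ λ j → χ k ≡ ψ j)
    image k with splitAt n k
    ... | inj₁ i = inj₁ (i , refl)
    ... | inj₂ j = inj₂ (j , refl)

  module Parts (χ : InducedIn (glue D₁ D₂ f g ok ok′) D) where

    left-part : InducedIn D₁ D
    left-part = (λ i → proj₁ χ (i ↑ˡ size D₂)) , (λ e → ↑ˡ-injective (size D₂) _ _ (proj₁ (proj₂ χ) e)) , arcs
      where
      arcs : ∀ i j → arc D (proj₁ χ (i ↑ˡ size D₂)) (proj₁ χ (j ↑ˡ size D₂)) ≡ arc D₁ i j
      arcs i j with proj₂ (proj₂ χ) (i ↑ˡ size D₂) (j ↑ˡ size D₂)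
      ... | e rewrite splitAt-↑ˡ n i (size D₂) | splitAt-↑ˡ n j (size D₂) = e

    right-part : InducedIn D₂ D
    right-part = (λ j → proj₁ χ (n ↑ʳ j)) , (λ e → ↑ʳ-injective n _ _ (proj₁ (proj₂ χ) e)) , arcs
      where
      arcs : ∀ i j → arc D (proj₁ χ (n ↑ʳ i)) (proj₁ χ (n ↑ʳ j)) ≡ arc D₂ i j
      arcs i j with proj₂ (proj₂ χ) (n ↑ʳ i) (n ↑ʳ j)
      ... | e rewrite splitAt-↑ʳ n (size D₂) i | splitAt-↑ʳ n (size D₂) j = e

    across : ∀ i j → arc D (proj₁ left-part i) (proj₁ right-part j) ≡ f i j
    across i j with proj₂ (proj₂ χ) (i ↑ˡ size D₂) (n ↑ʳ j)
    ... | e rewrite splitAt-↑ˡ n i (size D₂) | splitAt-↑ʳ n (size D₂) j = e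

    back : ∀ j i → arc D (proj₁ right-part j) (proj₁ left-part i) ≡ g j i
    back j i with proj₂ (proj₂ χ) (n ↑ʳ j) (i ↑ˡ size D₂)
    ... | e rewrite splitAt-↑ˡ n i (size D₂) | splitAt-↑ʳ n (size D₂) j = e

    disjoint : ∀ i j → proj₁ left-part i ≢ proj₁ right-part j
    disjoint i j e with trans (sym (splitAt-↑ˡ n i (size D₂)))
      (trans (cong (splitAt n) (proj₁ (proj₂ χ) e)) (splitAt-↑ʳ n (size D₂) j))
    ... | ()

infixl 5 _+P₃

_+P₃ : ℕ → Digraph
r +P₃ = (r ·K₁) ⊕ P₃

glue-into : ∀ {H} D₁ D₂ {f g ok ok′} D → H ≡ glue D₁ D₂ f g ok ok′ →
  (φ : InducedIn D₁ D) (ψ : InducedIn D₂ D) → (∀ i j → proj₁ φ i ≢ proj₁ ψ j) →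
  (∀ i j → arc D (proj₁ φ i) (proj₁ ψ j) ≡ f i j) → (∀ j i → arc D (proj₁ ψ j) (proj₁ φ i) ≡ g j i) →
  Σ (InducedIn H D) λ χ → ∀ k → (∃ λ i → proj₁ χ k ≡ proj₁ φ i) ⊎ (∃ λ j → proj₁ χ k ≡ proj₁ ψ j)
glue-into D₁ D₂ {ok = ok} {ok′} D refl = Glue.glue-copy D₁ D₂ ok ok′ D

⊕-ok : ∀ {A B : Set} (i : A) (j : B) → false ≡ true → false ≡ false
⊕-ok _ _ _ = refl

module Copies (D : Digraph) where
  open Dig D
  open Independence D

  false-arc : ∀ {x y} → ¬ x ⟶ y → arc D x y ≡ false
  false-arc {x} {y} n with arc D x y
  ... | true = contradiction refl n
  ... | false = refl

  no-arc : ∀ {x y} → arc D x y ≡ false → ¬ x ⟶ y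
  no-arc e p = case trans (sym p) e of λ ()

  vertex : V → InducedIn K₁ D
  vertex v = (λ _ → v) , (λ { {zero} {zero} _ → refl }) , λ _ _ → loopless D v

  empty : InducedIn (0 ·K₁) D
  empty = (λ ()) , (λ { {()} }) , λ ()

  path-copy : ∀ {x y a} → x ⟶ y → y ⟶ a → x o a → InducedIn P₃ D
  path-copy {x} {y} {a} xy ya (xa , ax) = φ , (λ {i} {j} → inj i j) , arcs
    where
    φ : Fin 3 → V
    φ zero = x
    φ (suc zero) = y
    φ (suc (suc zero)) = a
    loop : ∀ {u v} → u ≡ v → ¬ u ⟶ v
    loop refl = irrefl
    x≢a : x ≢ a
    x≢a refl = asym xy ya
    inj : ∀ i j → φ i ≡ φ j → i ≡ j
    inj zero zero e = refl
    inj zero (suc zero) e = contradiction xy (loop e)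
    inj zero (suc (suc zero)) e = contradiction e x≢a
    inj (suc zero) zero e = contradiction xy (loop (sym e))
    inj (suc zero) (suc zero) e = refl
    inj (suc zero) (suc (suc zero)) e = contradiction ya (loop e)
    inj (suc (suc zero)) zero e = contradiction (sym e) x≢a
    inj (suc (suc zero)) (suc zero) e = contradiction ya (loop (sym e))
    inj (suc (suc zero)) (suc (suc zero)) e = refl
    arcs : ∀ i j → arc D (φ i) (φ j) ≡ arc P₃ i j
    arcs zero zero = loopless D x
    arcs zero (suc zero) = xy
    arcs zero (suc (suc zero)) = false-arc xa
    arcs (suc zero) zero = oriented D x y xy
    arcs (suc zero) (suc zero) = loopless D y
    arcs (suc zero) (suc (suc zero)) = ya
    arcs (suc (suc zero)) zero = false-arc ax
    arcs (suc (suc zero)) (suc zero) = oriented D y a ya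
    arcs (suc (suc zero)) (suc (suc zero)) = loopless D a

  join-apart : ∀ D₁ D₂ (φ : InducedIn D₁ D) (ψ : InducedIn D₂ D) →
    (∀ i j → proj₁ φ i o proj₁ ψ j × proj₁ φ i ≢ proj₁ ψ j) →
    Σ (InducedIn (D₁ ⊕ D₂) D) λ χ → ∀ k → (∃ λ i → proj₁ χ k ≡ proj₁ φ i) ⊎ (∃ λ j → proj₁ χ k ≡ proj₁ ψ j)
  join-apart D₁ D₂ φ ψ apart = Glue.glue-copy D₁ D₂ ⊕-ok ⊕-ok D φ ψ (λ i j → proj₂ (apart i j))
    (λ i j → false-arc (proj₁ (proj₁ (apart i j)))) (λ j i → false-arc (proj₂ (proj₁ (apart i j))))

  module Split (D₁ D₂ : Digraph) (χ : InducedIn (D₁ ⊕ D₂) D) where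
    open Glue.Parts D₁ D₂ ⊕-ok ⊕-ok D χ public

    parts-apart : ∀ i j → proj₁ left-part i o proj₁ right-part j × proj₁ left-part i ≢ proj₁ right-part j
    parts-apart i j = (no-arc (across i j) , no-arc (back j i)) , disjoint i j

  cons-copy : ∀ r v (χ : InducedIn (r +P₃) D) → (∀ k → v o proj₁ χ k × v ≢ proj₁ χ k) → InducedIn (suc r +P₃) D
  cons-copy r v χ apart = proj₁ (join-apart (suc r ·K₁) P₃ (proj₁ isolated) right-part apart′)
    where
    open Split (r ·K₁) P₃ χ
    isolated = join-apart K₁ (r ·K₁) (vertex v) left-part (λ _ i → apart (i ↑ˡ 3))
    apart′ : ∀ i j → proj₁ (proj₁ isolated) i o proj₁ right-part j × proj₁ (proj₁ isolated) i ≢ proj₁ right-part j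
    apart′ i j with proj₁ (proj₁ isolated) i | proj₂ isolated i
    ... | _ | inj₁ (_ , refl) = apart (size (r ·K₁) ↑ʳ j)
    ... | _ | inj₂ (i′ , refl) = parts-apart i′ j

  shrink-copy : ∀ r → InducedIn (suc r +P₃) D → InducedIn (r +P₃) D
  shrink-copy r χ = proj₁ (join-apart (r ·K₁) P₃ (Split.right-part K₁ (r ·K₁) left-part) right-part (λ i j → parts-apart (1 ↑ʳ i) j))
    where open Split (suc r ·K₁) P₃ χ

  stable-copy : ∀ {L} r → Stable L → length L ≡ r → Σ (InducedIn (r ·K₁) D) λ φ → ∀ i → proj₁ φ i ∈ₗ L
  stable-copy zero [] refl = empty , λ ()
  stable-copy {l ∷ L} (suc r) (ls ∷ st) refl with φ , φ∈ ← stable-copy r st refl =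
    proj₁ χ , λ k → case proj₂ χ k of λ
      { (inj₁ (_ , e)) → here e ; (inj₂ (i , e)) → there (subst (_∈ₗ L) (sym e) (φ∈ i)) }
    where χ = join-apart K₁ (r ·K₁) (vertex l) φ (λ _ i → lookupᴬ ls (φ∈ i))

  path-free : ∀ r → Free (r +P₃) D → ∀ {x y a L} → x ⟶ y → y ⟶ a → x o a → Stable L → length L ≡ r →
    All (λ l → (l o x × l ≢ x) × (l o y × l ≢ y) × (l o a × l ≢ a)) L → ⊥
  path-free r free {x} {y} {a} xy ya xa st len apart with φ , φ∈ ← stable-copy r st len =
    free (proj₁ (join-apart (r ·K₁) P₃ φ (path-copy xy ya xa) (λ i → λ
      { zero → proj₁ (lookupᴬ apart (φ∈ i))
      ; (suc zero) → proj₁ (proj₂ (lookupᴬ apart (φ∈ i)))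
      ; (suc (suc zero)) → proj₂ (proj₂ (lookupᴬ apart (φ∈ i))) })))

  arrow-copy : ∀ H₁ H₂ (φ : InducedIn H₁ D) (ψ : InducedIn H₂ D) → (∀ i j → proj₁ φ i ⟶ proj₁ ψ j) →
    InducedIn (H₁ ⇒ H₂) D
  arrow-copy H₁ H₂ φ ψ arcs = proj₁ (glue-into {H₁ ⇒ H₂} H₁ H₂ D refl φ ψ (λ i j e → irrefl (subst (_⟶ proj₁ ψ j) e (arcs i j)))
    arcs (λ j i → oriented D _ _ (arcs i j)))

  delta-copy : ∀ H {w x} (φ : InducedIn H D) → w ⟶ x → (∀ i → x ⟶ proj₁ φ i) → (∀ i → proj₁ φ i ⟶ w) →
    InducedIn (Δ K₁ K₁ H) D
  delta-copy H {w} {x} φ wx xφ φw = proj₁ (glue-into {Δ K₁ K₁ H} (K₁ ⇒ K₁) H D refl edge φ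
      (λ { zero j e → irrefl (subst (proj₁ φ j ⟶_) e (φw j)) ; (suc zero) j e → irrefl (subst (_⟶ proj₁ φ j) e (xφ j)) })
      (λ { zero j → oriented D _ _ (φw j) ; (suc zero) j → xφ j })
      (λ { j zero → φw j ; j (suc zero) → oriented D _ _ (xφ j) }))
    where
    ends : Fin 2 → V
    ends zero = w
    ends (suc zero) = x
    edge : InducedIn (K₁ ⇒ K₁) D
    edge = ends , inj , λ { zero zero → loopless D w ; zero (suc zero) → wx
        ; (suc zero) zero → oriented D w x wx ; (suc zero) (suc zero) → loopless D x }
      where
      inj : Injective _≡_ _≡_ ends
      inj {zero} {zero} e = refl
      inj {zero} {suc zero} e = ⊥-elim (irrefl (subst (_⟶ x) e wx))
      inj {suc zero} {zero} e = ⊥-elim (irrefl (subst (w ⟶_) e wx))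
      inj {suc zero} {suc zero} e = refl

-- Assembly by induction on r

CopyIn : Digraph → (D : Digraph) → Sub (size D) → Set
CopyIn H D X = Σ (InducedIn H D) λ φ → ∀ i → proj₁ φ i ∈ X

col-or-copy : ∀ A B {c} → (∀ D → Free A D → Free B D → DichromaticAtMost D c) →
  ∀ {D} → Free B D → ∀ X → Dig.Col D X c ⊎ CopyIn A D X
col-or-copy A B bound {D} free X with copy? A (Induced.induced D X)
... | yes φ = inj₂ (Induced.copy-out D X {A} φ)
... | no n = inj₁ (Induced.col-out D X (dichromatic⇒col (bound _ n (Induced.free-induced D X B free))))

-- Carries the hypotheses on the smaller digraphs, given for one `r`, down to the `r` of the
-- induction hypothesis.
chi-down : ∀ H r → ChiFinite H (suc r) → ChiFinite H r
chi-down H r (c , bound) = c , λ D free free′ → bound D free (free′ ∘ Copies.shrink-copy D r)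

-- A copy of the smaller forbidden digraph among the non-neighbours would be completed by `v`. The
-- extra colour is for `v`, which lies in `Non v`.
non-bounded : ∀ H r {c} → (∀ D → Free H D → Free (r +P₃) D → DichromaticAtMost D c) →
  ∀ {D} → Free H D → Free (suc r +P₃) D → ∀ v → Dig.Col D (Dig.Non D v) (1 + c)
non-bounded H r bound {D} freeH freeF v with col-or-copy (r +P₃) H (λ D f g → bound D g f) freeH (Dig.Non D v ∖ sing v)
... | inj₁ c = Dig.col-∪ D (sing v) {Z = Dig.Non D v ∖ sing v} _,_ (Dig.col-stable D λ { refl refl → Dig.irrefl D }) c
... | inj₂ (φ , φ∈) = contradiction
      (Copies.cons-copy D r v φ (λ k → proj₁ (φ∈ k) , λ e → proj₂ (φ∈ k) (sym e))) freeF

module Cliques (D : Digraph) (free : Free (0 +P₃) D) where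
  open Dig D

  quasi : ∀ {x y z} → x ⟶ y → y ⟶ z → x ⟶ z ⊎ z ⟶ x
  quasi {x} {y} {z} xy yz with adj? x z
  ... | inj₁ r = inj₁ r
  ... | inj₂ (inj₁ r) = inj₂ r
  ... | inj₂ (inj₂ n) = ⊥-elim (Copies.path-free D 0 free xy yz n [] refl [])

  open QuasiTransitive D quasi using (Clique; reduce) public

  module Restricted {T : Sub (size D)} (clique : ∀ {x y} → x ∈ T → y ∈ T → x o y → x ≡ y) where
    open Induced D T public

    complete : ∀ {i j} → Dig._o_ induced i j → i ≡ j
    complete {i} {j} n = ι-inj (clique (ι-∈ i) (ι-∈ j) n)

    non-single : ∀ v → Dig.Col induced (Dig.Non induced v) 1
    non-single v = Dig.col-stable induced (λ p q r → Dig.irrefl induced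
      (subst (λ z → Dig._⟶_ induced z _) (trans (sym (complete p)) (complete q)) r))

arrow-setting : ∀ H₁ H₂ r {c₀ D} (χ₁ : ChiFinite H₁ r) (χ₂ : ChiFinite H₂ r) →
  (∀ v → Dig.Col D (Dig.Non D v) c₀) → Free (H₁ ⇒ H₂) D → Free (r +P₃) D →
  Setting c₀ (proj₁ χ₁) (proj₁ χ₂) (size H₁) (size H₂) D
arrow-setting H₁ H₂ r {D = D} (c₁ , b₁) (c₂ , b₂) non free freeF = record
  { C₁ = Copy H₁ ; C₂ = Copy H₂ ; non = non ; has₁ = has H₁ b₁ ; has₂ = has H₂ b₂
  ; no₁₂ = λ { (φ , refl) (ψ , refl) arcs → free (Copies.arrow-copy D H₁ H₂ φ ψ (λ i j → arcs (∈-tabulate⁺ i) (∈-tabulate⁺ j))) } }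
  where
  Copy : Digraph → List (Fin (size D)) → Set
  Copy H J = Σ (InducedIn H D) λ φ → J ≡ tabulate (proj₁ φ)
  has : ∀ H {c} → (∀ D → Free H D → Free (r +P₃) D → DichromaticAtMost D c) → ∀ X → Dig.Col D X c ⊎
    ∃ λ J → All (_∈ X) J × length J ≤ size H × Copy H J
  has H b X with col-or-copy H (r +P₃) b freeF X
  ... | inj₁ c = inj₁ c
  ... | inj₂ (φ , φ∈) = inj₂ (tabulate (proj₁ φ) , All-tabulate⁺ φ∈ , ≤-reflexive (length-tabulate (proj₁ φ)) , φ , refl)

arrow-finite : ∀ r H₁ H₂ → ChiFinite H₁ r → ChiFinite H₂ r → ChiFinite (H₁ ⇒ H₂) r
arrow-finite zero H₁ H₂ χ₁ χ₂ = k , λ D free freeF →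
    let open Cliques D freeF in
    col⇒dichromatic (reduce k (λ T clique → let open Restricted clique in
      col-out (coloured (arrow-setting H₁ H₂ 0 χ₁ χ₂ non-single (free-induced (H₁ ⇒ H₂) free) (free-induced (0 +P₃) freeF)))) full)
  where
  result = Arrow.arrow 1 (proj₁ χ₁) (proj₁ χ₂) (size H₁) (size H₂)
  k = proj₁ result
  coloured = proj₂ result
arrow-finite (suc r) H₁ H₂ χ₁ χ₂ = k , λ D free freeF →
    col⇒dichromatic (coloured (arrow-setting H₁ H₂ (suc r) χ₁ χ₂ (non-bounded (H₁ ⇒ H₂) r (proj₂ ih) free freeF) free freeF))
  where
  ih = arrow-finite r H₁ H₂ (chi-down H₁ r χ₁) (chi-down H₂ r χ₂)
  result = Arrow.arrow (1 + proj₁ ih) (proj₁ χ₁) (proj₁ χ₂) (size H₁) (size H₂)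
  k = proj₁ result
  coloured = proj₂ result

delta-hero : ∀ H r {D} (χ : ChiFinite H r) → Free (Δ K₁ K₁ H) D → Free (r +P₃) D → ∀ X →
  Dig.Col D X (proj₁ χ) ⊎ ∃ λ J → All (_∈ X) J × length J ≤ size H ×
    (∀ {w x} → Dig._⟶_ D w x → All (Dig._⟶_ D x) J → All (λ j → Dig._⟶_ D j w) J → ⊥)
delta-hero H r {D = D} (c , b) free freeF X with col-or-copy H (r +P₃) b freeF X
... | inj₁ p = inj₁ p
... | inj₂ (φ , φ∈) = inj₂ (tabulate (proj₁ φ) , All-tabulate⁺ φ∈ , ≤-reflexive (length-tabulate (proj₁ φ)) ,
      λ wx xJ Jw → free (Copies.delta-copy D H φ wx (All-tabulate⁻ xJ) (All-tabulate⁻ Jw)))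

delta-finite : ∀ r H → ChiFinite H r → ChiFinite (Δ K₁ K₁ H) r
delta-finite zero H χ = k + k , λ D free freeF →
    let open Cliques D freeF in
    col⇒dichromatic (reduce (k + k) (λ T clique → let open Restricted clique in
      col-out (Chains.delta 1 (proj₁ χ) (size H) 0 1 0 (dense {D} free freeF {T} clique))) full)
  where
  k = Chains.triple-bound 1 (proj₁ χ) (size H) 0 1 0
  dense : ∀ {D} → Free (Δ K₁ K₁ H) D → (freeF : Free (0 +P₃) D) → ∀ {T} → Cliques.Clique D freeF 0 T →
    Dense 1 (proj₁ χ) (size H) 0 1 0 (Induced.induced D T)
  dense {D} free freeF {T} clique = record
    { non = non-single
    ; hero = delta-hero H 0 χ (free-induced (Δ K₁ K₁ H) free) (free-induced (0 +P₃) freeF)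
    ; frag = frag
    ; path = λ xy ya xa _ _ _ → Copies.path-free induced 0 (free-induced (0 +P₃) freeF) xy ya xa [] refl [] }
    where
    open Cliques D freeF
    open Restricted {T} clique
    -- In a clique no vertex is non-adjacent to another, so one vertex serves as fragment; hence the
    -- parameters `f = 0` and `q = 1`.
    frag : ∀ X → Dig.Col induced X 0 ⊎ ∃ λ J → All (_∈ X) J × length J ≤ 1 ×
      (∀ {x} → All (λ j → Dig._o_ induced x j × x ≢ j) J → ⊥)
    frag X with any? (_∈? X)
    ... | no n = inj₁ (Dig.col-∅ induced (λ p → n (_ , p)))
    ... | yes (j , p) = inj₂ (j ∷ [] , p ∷ [] , ≤-refl , λ { ((n , ne) ∷ []) → ne (complete n) })
delta-finite (suc r) H χ = k + k , λ D free freeF →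
    col⇒dichromatic (Chains.delta (1 + f) (proj₁ χ) (size H) f (size (r +P₃)) (suc r) (dense free freeF))
  where
  ih = delta-finite r H (chi-down H r χ)
  f = proj₁ ih
  k = Chains.triple-bound (1 + f) (proj₁ χ) (size H) f (size (r +P₃)) (suc r)
  dense : ∀ {D} → Free (Δ K₁ K₁ H) D → Free (suc r +P₃) D →
    Dense (1 + f) (proj₁ χ) (size H) f (size (r +P₃)) (suc r) D
  dense {D} free freeF = record
    { non = non-bounded (Δ K₁ K₁ H) r (proj₂ ih) free freeF
    ; hero = delta-hero H (suc r) χ free freeF
    ; frag = frag
    ; path = Copies.path-free D (suc r) freeF }
    where
    open Dig D
    frag : ∀ X → Col X f ⊎ ∃ λ J → All (_∈ X) J × length J ≤ size (r +P₃) × (∀ {x} → All (λ j → x o j × x ≢ j) J → ⊥)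
    frag X with col-or-copy (r +P₃) (Δ K₁ K₁ H) (λ D a b → proj₂ ih D b a) free X
    ... | inj₁ c = inj₁ c
    ... | inj₂ (φ , φ∈) = inj₂ (tabulate (proj₁ φ) , All-tabulate⁺ φ∈ , ≤-reflexive (length-tabulate (proj₁ φ)) ,
          λ {x} apart → freeF (Copies.cons-copy D r x φ (All-tabulate⁻ apart)))

theorem1p12 : (r : ℕ) →
    ChiFinite K₁ r
    × (∀ (H₁ H₂ : Digraph) → ChiFinite H₁ r → ChiFinite H₂ r → ChiFinite (H₁ ⇒ H₂) r)
    × (∀ (H₁ : Digraph) → ChiFinite H₁ r → ChiFinite (Δ K₁ K₁ H₁) r)
theorem1p12 r = single , arrow-finite r , delta-finite r
  where
  single : ChiFinite K₁ r
  single = 0 , λ D free _ → col⇒dichromatic (Dig.col-∅ D (λ {x} _ → free (Copies.vertex D x)))
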